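{- Let $n\ge 3$, let $\widetilde B_n$ have generators $r_0,\dots,r_n$, and for $U^W_{\widetilde B_n}(q):=\sum_{w\in\widetilde B_n}q^{\ell_W(\phi(w))}$ (with $\ell_W$ the length function of $W$) the following hold. \begin{enumerate} \item For $\phi:\widetilde B_n\to\widetilde D_{n+1}$ given by $\phi(r_0)=s_0s_1$ and $\phi(r_i)=s_{i+1}$ for $1\le i\le n$: $$U_{\widetilde B_n}^{\widetilde D_{n+1}}(q)=\frac{[2]_q[3]_{ -q}[4]_q}{(1-q)(1-q^3)(1+q^n)}\prod_{k=3}^{n}\frac{[2k+1]_q-q^k}{1-q^{2k-1}}.$$ \item For $\phi:\widetilde B_n\to\widetilde D_{2n}$ given by $\phi(r_0)=s_n$, $\phi(r_i)=s_{n-i}s_{n+i}$ for $1\le i\le n-2$, $\phi(r_{n-1})=s_0s_{2n}$, $\phi(r_n)=s_1s_{2n-1}$: $$U_{\widetilde B_n}^{\widetilde D_{2n}}(q)=\left(\prod_{k=1}^{2n}[k]_{(-1)^kq}\right)\cdot\frac{\prod_{k=1}^{n-1}(1+q^{2k})}{\prod_{k=1}^{n}(1-q^{2(n+k)-3})}.$$ \item For $\phi:\widetilde B_n\to\widetilde D_{2n+1}$ given by $\phi(r_0)=s_ns_{n+1}s_n$, $\phi(r_i)=s_{n-i}s_{n+1+i}$ for $1\le i\le n-2$, $\phi(r_{n-1})=s_0s_{2n+1}$, $\phi(r_n)=s_1s_{2n}$: $$U_{\widetilde B_n}^{\widetilde D_{2n+1}}(q)=\left(\prod_{k=1}^{2n+1}[k]_{(-1)^kq}\right)\cdot\frac{\prod_{k=1}^{n-1}(1+q^{2k})}{\prod_{k=1}^{n}(1-q^{2(n+k)-1})}.$$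 \end{enumerate}
   Context: $[k]_q:=1+q+\cdots+q^{k-1}$ (and $[k]_{ -q}$, $[k]_{(-1)^kq}$ denote its substitutions). All groups below are Coxeter groups: generators are involutions, and pairs of distinct generators not listed commute ($m=2$). $\widetilde B_n$ ($n\ge3$): generators $r_0,\dots,r_n$ with $(r_0r_1)^4=e$, $(r_ir_{i+1})^3=e$ for $1\le i\le n-3$, $(r_{n-2}r_{n-1})^3=(r_{n-2}r_n)^3=e$. $\widetilde D_N$ ($N\ge4$): generators $s_0,\dots,s_N$ with $(s_0s_2)^3=(s_1s_2)^3=e$, $(s_is_{i+1})^3=e$ for $2\le i\le N-3$, $(s_{N-2}s_{N-1})^3=(s_{N-2}s_N)^3=e$. In each part the assignment on generators extends to an injective group homomorphism (a folding by the nontrivial graph automorphism of the Coxeter graph of $\widetilde D$). -}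

module Defs where

open import Data.Nat as ℕ using (ℕ; zero; suc; _≤_; _∸_; _≡ᵇ_; _≤ᵇ_)
open import Data.Nat.Base using (_%_)
open import Data.Bool using (Bool; true; false; _∧_; _∨_; if_then_else_)
open import Data.Fin using (Fin; toℕ)
open import Data.Integer as ℤ using (ℤ; +_; -_)
open import Data.List using (List; []; _∷_; _++_; length; concatMap; applyUpTo; foldr; map; replicate)
open import Data.List.Relation.Unary.All using (All)
open import Data.List.Relation.Unary.Any using (Any)
open import Data.List.Relation.Unary.AllPairs using (AllPairs)
open import Data.Product using (Σ; _×_)
open import Relation.Binary.PropositionalEquality using (_≡_)
open import Relation.Nullary using (¬_)

-- Coxeter groups given by a Coxeter matrix on k generators (all entries
-- finite), presented as words modulo the Coxeter relations.

Word : ℕ → Set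
Word k = List (Fin k)

CoxMatrix : ℕ → Set
CoxMatrix k = Fin k → Fin k → ℕ

alt : ∀ {k} → Fin k → Fin k → ℕ → Word k
alt s t zero    = []
alt s t (suc m) = s ∷ alt t s m

data CoxRel {k} (M : CoxMatrix k) : Word k → Word k → Set where
  invol : (s : Fin k) → CoxRel M (s ∷ s ∷ []) []
  braid : (s t : Fin k) → CoxRel M (alt s t (M s t)) (alt t s (M s t))

-- the congruence on words generated by the Coxeter relations;
-- the Coxeter group W(M) is  Word k / ≈
data _⊢_≈_ {k} (M : CoxMatrix k) : Word k → Word k → Set where
  step  : ∀ u v {l r} → CoxRel M l r → M ⊢ (u ++ l ++ v) ≈ (u ++ r ++ v)
  refl  : ∀ {w} → M ⊢ w ≈ w
  sym   : ∀ {w w'} → M ⊢ w ≈ w' → M ⊢ w' ≈ w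
  trans : ∀ {w w' w''} → M ⊢ w ≈ w' → M ⊢ w' ≈ w'' → M ⊢ w ≈ w''

HasLength : ∀ {k} (M : CoxMatrix k) → Word k → ℕ → Set
HasLength M w m =
  Σ (Word _) (λ u → (M ⊢ u ≈ w) × (length u ≡ m)) ×
  (∀ u → M ⊢ u ≈ w → m ≤ length u)

record CountsTo {k} (M : CoxMatrix k) (P : Word k → Set) (c : ℕ) : Set where
  field
    elems    : List (Word k)
    size     : length elems ≡ c
    sound    : All P elems
    distinct : AllPairs (λ u v → ¬ (M ⊢ u ≈ v)) elems
    complete : ∀ w → P w → Any (λ u → M ⊢ w ≈ u) elems

min max : ℕ → ℕ → ℕ
min = ℕ._⊓_
max = ℕ._⊔_

fromEdges : ∀ {k} → (ℕ → ℕ → ℕ) → CoxMatrix k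
fromEdges lab i j =
  let a = toℕ i ; b = toℕ j in
  if a ≡ᵇ b then 1 else lab (min a b) (max a b)

labB : ℕ → ℕ → ℕ → ℕ
labB n lo hi =
  if (lo ≡ᵇ 0) ∧ (hi ≡ᵇ 1) then 4 else
  if ((1 ≤ᵇ lo) ∧ (lo ≤ᵇ n ∸ 3) ∧ (hi ≡ᵇ suc lo))
     ∨ ((lo ≡ᵇ n ∸ 2) ∧ ((hi ≡ᵇ n ∸ 1) ∨ (hi ≡ᵇ n)))
  then 3 else 2

MB : (n : ℕ) → CoxMatrix (suc n)
MB n = fromEdges (labB n)

labD : ℕ → ℕ → ℕ → ℕ
labD N lo hi =
  if (((lo ≡ᵇ 0) ∨ (lo ≡ᵇ 1)) ∧ (hi ≡ᵇ 2))
     ∨ ((2 ≤ᵇ lo) ∧ (lo ≤ᵇ N ∸ 3) ∧ (hi ≡ᵇ suc lo))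
     ∨ ((lo ≡ᵇ N ∸ 2) ∧ ((hi ≡ᵇ N ∸ 1) ∨ (hi ≡ᵇ N)))
  then 3 else 2

MD : (N : ℕ) → CoxMatrix (suc N)
MD N = fromEdges (labD N)

-- generator with index m of a group with k+1 generators
-- (clamped; only ever applied to in-range indices below)
gen : (k : ℕ) → ℕ → Fin (suc k)
gen zero    _       = Fin.zero
gen (suc k) zero    = Fin.zero
gen (suc k) (suc m) = Fin.suc (gen k m)

φ₁gen : (n : ℕ) → Fin (suc n) → Word (suc (suc n))
φ₁gen n r with toℕ r
... | zero  = gen (suc n) 0 ∷ gen (suc n) 1 ∷ []
... | suc i = gen (suc n) (suc (suc i)) ∷ []

φ₂gen : (n : ℕ) → Fin (suc n) → Word (suc (n ℕ.+ n))
φ₂gen n r =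
  let i = toℕ r ; g = gen (n ℕ.+ n) in
  if i ≡ᵇ 0 then g n ∷ [] else
  if i ≡ᵇ n ∸ 1 then g 0 ∷ g (n ℕ.+ n) ∷ [] else
  if i ≡ᵇ n then g 1 ∷ g (n ℕ.+ n ∸ 1) ∷ [] else
  g (n ∸ i) ∷ g (n ℕ.+ i) ∷ []

φ₃gen : (n : ℕ) → Fin (suc n) → Word (suc (suc (n ℕ.+ n)))
φ₃gen n r =
  let i = toℕ r ; g = gen (suc (n ℕ.+ n)) in
  if i ≡ᵇ 0 then g n ∷ g (suc n) ∷ g n ∷ [] else
  if i ≡ᵇ n ∸ 1 then g 0 ∷ g (suc (n ℕ.+ n)) ∷ [] else
  if i ≡ᵇ n then g 1 ∷ g (n ℕ.+ n) ∷ [] else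
  g (n ∸ i) ∷ g (suc (n ℕ.+ i)) ∷ []

extend : ∀ {k l} → (Fin k → Word l) → Word k → Word l
extend f = concatMap f

-- Integer polynomials in q (coefficient lists, constant term first)

Poly : Set
Poly = List ℤ

_+ₚ_ : Poly → Poly → Poly
[]       +ₚ q        = q
(a ∷ p)  +ₚ []       = a ∷ p
(a ∷ p)  +ₚ (b ∷ q)  = (a ℤ.+ b) ∷ (p +ₚ q)

scale : ℤ → Poly → Poly
scale c = map (c ℤ.*_)

_*ₚ_ : Poly → Poly → Poly
[]      *ₚ q = []
(a ∷ p) *ₚ q = scale a q +ₚ (+ 0 ∷ (p *ₚ q))

negₚ : Poly → Poly
negₚ = map -_

_-ₚ_ : Poly → Poly → Poly
p -ₚ q = p +ₚ negₚ q

oneₚ : Poly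
oneₚ = + 1 ∷ []

qpow : ℕ → Poly
qpow a = replicate a (+ 0) ++ oneₚ

qint : ℕ → Poly
qint k = replicate k (+ 1)

subNeg : Poly → Poly
subNeg []      = []
subNeg (a ∷ p) = a ∷ negₚ (subNeg p)

qintSigned : ℕ → Poly
qintSigned k = if (k % 2) ≡ᵇ 1 then subNeg (qint k) else qint k

prodFromTo : (ℕ → Poly) → ℕ → ℕ → Poly
prodFromTo f a b = foldr _*ₚ_ oneₚ (applyUpTo (λ i → f (a ℕ.+ i)) (suc b ∸ a))

coeff : Poly → ℕ → ℤ
coeff []      _       = + 0
coeff (a ∷ p) zero    = a
coeff (a ∷ p) (suc m) = coeff p m

convₚ : (ℕ → ℤ) → Poly → ℕ → ℤ
convₚ a []      m       = + 0
convₚ a (c ∷ p) zero    = c ℤ.* a zero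
convₚ a (c ∷ p) (suc m) = c ℤ.* a (suc m) ℤ.+ convₚ a p m

-- the power series Σ_m a_m q^m equals the rational function num/den
-- (den has constant term 1 in all uses), i.e. (Σ a_m q^m)·den = num
SeriesEq : (ℕ → ℕ) → Poly → Poly → Set
SeriesEq a num den = ∀ m → convₚ (λ i → + a i) den m ≡ coeff num m

IsUSeries : ∀ {k} (n : ℕ) (MW : CoxMatrix k) (φgen : Fin (suc n) → Word k)
            (a : ℕ → ℕ) → Set
IsUSeries n MW φgen a =
  ∀ m → CountsTo (MB n) (λ w → HasLength MW (extend φgen w) m) (a m)

num₁ den₁ num₂ den₂ num₃ den₃ : ℕ → Poly
num₁ n = qint 2 *ₚ (subNeg (qint 3) *ₚ (qint 4 *ₚ
         prodFromTo (λ k → qint (2 ℕ.* k ℕ.+ 1) -ₚ qpow k) 3 n))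
den₁ n = (oneₚ -ₚ qpow 1) *ₚ ((oneₚ -ₚ qpow 3) *ₚ ((oneₚ +ₚ qpow n) *ₚ
         prodFromTo (λ k → oneₚ -ₚ qpow (2 ℕ.* k ∸ 1)) 3 n))
num₂ n = prodFromTo qintSigned 1 (2 ℕ.* n) *ₚ
         prodFromTo (λ k → oneₚ +ₚ qpow (2 ℕ.* k)) 1 (n ∸ 1)
den₂ n = prodFromTo (λ k → oneₚ -ₚ qpow (2 ℕ.* (n ℕ.+ k) ∸ 3)) 1 n
num₃ n = prodFromTo qintSigned 1 (2 ℕ.* n ℕ.+ 1) *ₚ
         prodFromTo (λ k → oneₚ +ₚ qpow (2 ℕ.* k)) 1 (n ∸ 1)
den₃ n = prodFromTo (λ k → oneₚ -ₚ qpow (2 ℕ.* (n ℕ.+ k) ∸ 1)) 1 n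

{-# OPTIONS --safe #-}
-- Realise each group by Mozes's numbers game: an element is an integer vector, a generator is a left
-- descent exactly when its entry is negative, and by strong convergence all ways of firing negative
-- entries down to the base vector have the same length.  In this model the foldings identify symmetric
-- D̃-positions with B̃-positions, so the D̃-length of φ(w) is a weighted length of w, in which r₀ has
-- weight 2, 1, 3 and the other generators weight 1, 2, 2 in the three parts.
--
-- Let s and t be q to these weights.  As B̃ₙ has index 2 in C̃ₙ, its weighted Poincaré series is half of
-- that of C̃ₙ for the parameters s, t and u = 1.  In C̃ₙ let P k be the generating function of the elements
-- that ascend at the nodes below k and descend at all others, so that P 0 = 0 and P (n + 1) = 1.  Then
-- P k + P (k + 1) counts the elements that ascend below k and descend above k, which by the longest
-- element of a parabolic subgroup is W · uᵐ tᵐ⁽ᵐ⁻¹⁾ / (B k · B m) with m = n - k.  The alternating sum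
-- over k telescopes, and the resulting equation for W is solved by a q-Vandermonde summation.
module Submission where

-- Passing from B̃ to C̃ makes the sum tractable: deleting a node of C̃ leaves two chains of type B,
-- one formula covers all these subgroups, and the nodes are linearly ordered, as telescoping needs;
-- the fork of B̃ would bring in type D. The extra generator τ of C̃ exchanges the two tips of the
-- fork. It receives weight 0, whence u = 1: each element of B̃ is counted once with and once
-- without τ. Descents are read off from signs, so an entry 0 would be neither a descent nor an
-- ascent; `val≢0` excludes it on the orbit, and counts are therefore compared on regular positions.
-- Descent classes are counted through the axioms of `Count` alone: a quotient by a subgroup is an
-- equation between counts with denominators multiplied out, and a factor is cancelled only if its
-- constant term is not 0. The game on D̃ starts from the unfolded base of B̃ instead of (1, ...,
-- 1). Then the position of φ(w) is the unfolded position of w, and a reduced word of w expands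
-- letter by letter to a reduced word of φ(w).

open import Defs renaming (step to ≈-step; refl to ≈-refl; sym to ≈-sym; trans to ≈-trans)
open import Data.Nat.Base using (ℕ; zero; suc; _+_; _*_; _∸_; _≤_; _<_; z≤n; s≤s; _≡ᵇ_; _≤ᵇ_; _%_)
open import Data.Integer.Base as ℤ using (ℤ; +_; -[1+_])
import Data.Integer.Properties as ℤ
import Data.Integer.Tactic.RingSolver as ℤ-Solver
open import Data.List.Base using (List; []; _∷_; _++_; length; map; filter; deduplicate; cartesianProductWith; allFin; foldr; applyUpTo)
open import Data.Product.Base using (Σ; ∃; _×_; _,_; proj₁; proj₂)
open import Relation.Nullary using (¬_; Dec; yes; no)
open import Relation.Binary.PropositionalEquality using (_≡_; _≢_; refl; sym; trans; cong; cong₂; subst; subst₂; module ≡-Reasoning; ≢-sym)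
open import Algebra.Bundles using (CommutativeRing)
open import Data.Maybe.Base using (Maybe; just; nothing)
open import Level using (0ℓ)
import Algebra.Solver.Ring
import Algebra.Solver.Ring.AlmostCommutativeRing as ACR
open import Algebra.Properties.AbelianGroup ℤ.+-0-abelianGroup using () renaming (∙-cancelʳ to +-cancelʳ; ∙-cancelˡ to ℤ+-cancelˡ)
open import Algebra.Structures using (IsCommutativeRing)
import Relation.Binary.Reasoning.Setoid as SetoidReasoning
open import Data.Nat.Properties as ℕ hiding (_≟_; _≤?_; _<?_)
open import Data.Sum.Base using (_⊎_; inj₁; inj₂)
open import Data.Empty using (⊥; ⊥-elim)
open import Data.Unit.Base using (⊤; tt)
open import Relation.Nullary.Decidable using (_×-dec_; _→-dec_; ¬?; map′)
open import Data.Fin.Base as Fin using (Fin; toℕ; fromℕ<)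
import Data.Fin.Properties as Fin
open import Data.Nat.ListAction using (sum)
import Data.List.Properties as List
open import Relation.Binary.Definitions using (tri<; tri≈; tri>; DecidableEquality)
open import Data.List.Membership.Propositional using (_∈_)
open import Data.List.Membership.Propositional.Properties using (∈-cartesianProductWith⁺; ∈-allFin; ∈-map⁺; ∈-map⁻; ∈-filter⁺; ∈-filter⁻; ∈-deduplicate⁺; ∈-deduplicate⁻)
open import Data.List.Membership.Propositional.Properties.WithK using (unique∧set⇒bag)
open import Data.List.Relation.Binary.BagAndSetEquality using (∼bag⇒↭)
open import Data.List.Relation.Binary.Permutation.Propositional.Properties using (↭-length)
open import Data.List.Relation.Unary.All as All using (All; []; _∷_)
open import Data.List.Relation.Unary.Any using (Any; here; there)
open import Data.List.Relation.Unary.AllPairs using (AllPairs; []; _∷_)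
open import Data.List.Relation.Unary.Unique.Propositional using (Unique)
import Data.List.Relation.Unary.Unique.Propositional.Properties as Unique
open import Data.List.Relation.Unary.Unique.DecPropositional.Properties using (deduplicate-!)
open import Function.Bundles using (mk⇔; Equivalence)
open import Data.Bool.Base using (Bool; true; false; _∧_; _∨_; if_then_else_; T)
import Data.Bool.Properties as Bool
open import Data.Vec.Base using (Vec; []; _∷_)
import Data.Vec.Properties as Vec
open import Function.Base using (case_of_)
open import Data.List.Properties using (length-++)
open import Data.Nat.DivMod using ([m+n]%n≡m%n)
import Data.Nat.Tactic.RingSolver as ℕ-Solver

-- Power series

Series : Set
Series = ℕ → ℤ

infix 4 _≋_
_≋_ : Series → Series → Set
a ≋ b = ∀ m → a m ≡ b m

conv : Series → Series → Series
conv a b zero    = a 0 ℤ.* b 0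
conv a b (suc m) = a 0 ℤ.* b (suc m) ℤ.+ conv (λ i → a (suc i)) b m

conv-cong : ∀ {a a′ b b′} → a ≋ a′ → b ≋ b′ → conv a b ≋ conv a′ b′
conv-cong e f zero    = cong₂ ℤ._*_ (e 0) (f 0)
conv-cong e f (suc m) = cong₂ ℤ._+_ (cong₂ ℤ._*_ (e 0) (f (suc m))) (conv-cong (λ i → e (suc i)) f m)

conv-sucʳ : ∀ a b m → conv a b (suc m) ≡ conv a (λ i → b (suc i)) m ℤ.+ a (suc m) ℤ.* b 0
conv-sucʳ a b zero    = refl
conv-sucʳ a b (suc m) = trans (cong (λ z → a 0 ℤ.* b (suc (suc m)) ℤ.+ z) (conv-sucʳ (λ i → a (suc i)) b m))
  (sym (ℤ.+-assoc (a 0 ℤ.* b (suc (suc m))) (conv (λ i → a (suc i)) (λ i → b (suc i)) m) (a (suc (suc m)) ℤ.* b 0)))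

conv-comm : ∀ a b → conv a b ≋ conv b a
conv-comm a b zero    = ℤ.*-comm (a 0) (b 0)
conv-comm a b (suc m) = trans (cong₂ ℤ._+_ (ℤ.*-comm (a 0) (b (suc m))) (conv-comm (λ i → a (suc i)) b m))
    (trans (ℤ.+-comm _ (conv b (λ i → a (suc i)) m)) (sym (conv-sucʳ b a m)))

conv-distribʳ : ∀ c a b → conv (λ i → a i ℤ.+ b i) c ≋ (λ i → conv a c i ℤ.+ conv b c i)
conv-distribʳ c a b zero    = ℤ.*-distribʳ-+ (c 0) (a 0) (b 0)
conv-distribʳ c a b (suc m) = trans (cong₂ ℤ._+_ (ℤ.*-distribʳ-+ (c (suc m)) (a 0) (b 0)) (conv-distribʳ c (λ i → a (suc i)) (λ i → b (suc i)) m))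
  (lem (a 0 ℤ.* c (suc m)) (b 0 ℤ.* c (suc m)) (conv (λ i → a (suc i)) c m) _)
  where lem : ∀ p q r s → (p ℤ.+ q) ℤ.+ (r ℤ.+ s) ≡ (p ℤ.+ r) ℤ.+ (q ℤ.+ s)
        lem = ℤ-Solver.solve-∀

conv-scaleˡ : ∀ k a b → conv (λ i → k ℤ.* a i) b ≋ (λ i → k ℤ.* conv a b i)
conv-scaleˡ k a b zero    = ℤ.*-assoc k (a 0) (b 0)
conv-scaleˡ k a b (suc m) = trans (cong₂ ℤ._+_ (ℤ.*-assoc k (a 0) (b (suc m))) (conv-scaleˡ k (λ i → a (suc i)) b m)) (sym (ℤ.*-distribˡ-+ k _ _))

conv-assoc : ∀ a b c → conv (conv a b) c ≋ conv a (conv b c)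
conv-assoc a b c zero    = ℤ.*-assoc (a 0) (b 0) (c 0)
conv-assoc a b c (suc m) = begin
  a 0 ℤ.* b 0 ℤ.* c (suc m) ℤ.+ conv (λ i → conv a b (suc i)) c m
    ≡⟨ cong (λ z → a 0 ℤ.* b 0 ℤ.* c (suc m) ℤ.+ z) (conv-distribʳ c (λ i → a 0 ℤ.* b (suc i)) (conv (λ i → a (suc i)) b) m) ⟩
  a 0 ℤ.* b 0 ℤ.* c (suc m) ℤ.+ (conv (λ i → a 0 ℤ.* b (suc i)) c m ℤ.+ conv (conv (λ i → a (suc i)) b) c m)
    ≡⟨ cong₂ (λ x y → a 0 ℤ.* b 0 ℤ.* c (suc m) ℤ.+ (x ℤ.+ y)) (conv-scaleˡ (a 0) (λ i → b (suc i)) c m) (conv-assoc (λ i → a (suc i)) b c m) ⟩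
  a 0 ℤ.* b 0 ℤ.* c (suc m) ℤ.+ (a 0 ℤ.* conv (λ i → b (suc i)) c m ℤ.+ conv (λ i → a (suc i)) (conv b c) m)
    ≡⟨ lem (a 0) (b 0) (c (suc m)) _ _ ⟩
  a 0 ℤ.* conv b c (suc m) ℤ.+ conv (λ i → a (suc i)) (conv b c) m ∎
  where
  open ≡-Reasoning
  lem : ∀ p q r s t → p ℤ.* q ℤ.* r ℤ.+ (p ℤ.* s ℤ.+ t) ≡ p ℤ.* (q ℤ.* r ℤ.+ s) ℤ.+ t
  lem = ℤ-Solver.solve-∀

conv-zeroˡ : ∀ b → conv (λ _ → + 0) b ≋ (λ _ → + 0)
conv-zeroˡ b zero    = refl
conv-zeroˡ b (suc m) = trans (ℤ.+-identityˡ _) (conv-zeroˡ b m)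

constˢ : ℤ → Series
constˢ c zero    = c
constˢ c (suc _) = + 0

0ˢ 1ˢ : Series
0ˢ = constˢ (+ 0)
1ˢ = constˢ (+ 1)

conv-identityˡ : ∀ b → conv 1ˢ b ≋ b
conv-identityˡ b zero    = ℤ.*-identityˡ (b 0)
conv-identityˡ b (suc m) = trans (cong₂ ℤ._+_ (ℤ.*-identityˡ (b (suc m))) (conv-zeroˡ b m)) (ℤ.+-identityʳ _)

-- The constant terms agree because ℤ is a domain. Subtracting them through `conv-sucʳ` leaves the
-- same equation for the two tails, and coefficient m + 1 is coefficient m of the tail.
conv-cancelˡ : ∀ a b c → a 0 ≢ + 0 → conv a b ≋ conv a c → b ≋ c
conv-cancelˡ a b c a≢0 e zero    = ℤ.*-cancelˡ-≡ (a 0) (b 0) (c 0) {{ℤ.≢-nonZero a≢0}} (e 0)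
conv-cancelˡ a b c a≢0 e (suc m) = conv-cancelˡ a (λ i → b (suc i)) (λ i → c (suc i)) a≢0 tails m
  where
  tails : conv a (λ i → b (suc i)) ≋ conv a (λ i → c (suc i))
  tails m = +-cancelʳ (a (suc m) ℤ.* b 0) _ _ (trans (sym (conv-sucʳ a b m)) (trans (e (suc m)) (trans (conv-sucʳ a c m)
    (cong (λ z → conv a (λ i → c (suc i)) m ℤ.+ a (suc m) ℤ.* z) (sym (conv-cancelˡ a b c a≢0 e zero))))))

infixl 6 _⊕_ _⊝_
infixl 7 _⊗_
infix  8 ⊖_

opaque
  _⊕_ _⊗_ : Series → Series → Series
  (a ⊕ b) m = a m ℤ.+ b m
  a ⊗ b = conv a b

  ⊖_ : Series → Series
  (⊖ a) m = ℤ.- a m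

_⊝_ : Series → Series → Series
a ⊝ b = a ⊕ ⊖ b

opaque
  unfolding _⊕_

  ⊕-coeff : ∀ a b m → (a ⊕ b) m ≡ a m ℤ.+ b m
  ⊕-coeff a b m = refl

  ⊖-coeff : ∀ a m → (⊖ a) m ≡ ℤ.- a m
  ⊖-coeff a m = refl

  ⊗-cancelˡ : ∀ a {b c} → a 0 ≢ + 0 → a ⊗ b ≋ a ⊗ c → b ≋ c
  ⊗-cancelˡ a = conv-cancelˡ a _ _

  isCommutativeRing : IsCommutativeRing _≋_ _⊕_ _⊗_ ⊖_ 0ˢ 1ˢ
  isCommutativeRing = record
      { isRing = record
        { +-isAbelianGroup = record
          { isGroup = record
            { isMonoid = record
              { isSemigroup = record
                { isMagma = record
                  { isEquivalence = record { refl = λ _ → refl ; sym = λ e m → sym (e m) ; trans = λ e f m → trans (e m) (f m) }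
                  ; ∙-cong = λ e f m → cong₂ ℤ._+_ (e m) (f m) }
                ; assoc = λ a b c m → ℤ.+-assoc (a m) (b m) (c m) }
              ; identity = (λ { a zero → ℤ.+-identityˡ _ ; a (suc m) → ℤ.+-identityˡ _ }) , (λ { a zero → ℤ.+-identityʳ _ ; a (suc m) → ℤ.+-identityʳ _ }) }
            ; inverse = (λ { a zero → ℤ.+-inverseˡ (a zero) ; a (suc m) → ℤ.+-inverseˡ (a (suc m)) }) , (λ { a zero → ℤ.+-inverseʳ (a zero) ; a (suc m) → ℤ.+-inverseʳ (a (suc m)) })
            ; ⁻¹-cong = λ e m → cong ℤ.-_ (e m) }
          ; comm = λ a b m → ℤ.+-comm (a m) (b m) }
        ; *-cong = conv-cong
        ; *-assoc = conv-assoc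
        ; *-identity = conv-identityˡ , (λ b m → trans (conv-comm b 1ˢ m) (conv-identityˡ b m))
        ; distrib = (λ c a b m → trans (conv-comm c _ m) (trans (conv-distribʳ c a b m) (cong₂ ℤ._+_ (conv-comm a c m) (conv-comm b c m))))
                  , conv-distribʳ }
      ; *-comm = conv-comm }

seriesRing : CommutativeRing 0ℓ 0ℓ
seriesRing = record { isCommutativeRing = isCommutativeRing }


opaque
  unfolding _⊕_

  const-* : ∀ x y → constˢ (x ℤ.* y) ≋ constˢ x ⊗ constˢ y
  const-* x y zero    = refl
  const-* x y (suc m) = sym (trans (cong₂ ℤ._+_ (ℤ.*-zeroʳ x) (conv-zeroˡ (constˢ y) m)) refl)

  const-+ : ∀ x y → constˢ (x ℤ.+ y) ≋ constˢ x ⊕ constˢ y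
  const-+ x y zero    = refl
  const-+ x y (suc m) = refl

  const-neg : ∀ x → constˢ (ℤ.- x) ≋ ⊖ constˢ x
  const-neg x zero    = refl
  const-neg x (suc m) = refl

const-homo : CommutativeRing.rawRing ℤ.+-*-commutativeRing ACR.-Raw-AlmostCommutative⟶ ACR.fromCommutativeRing seriesRing
const-homo = record { ⟦_⟧ = constˢ ; +-homo = const-+ ; *-homo = const-* ; -‿homo = const-neg
                    ; 0-homo = λ _ → refl ; 1-homo = λ _ → refl }

constˢ-dec : ∀ x y → Maybe (constˢ x ≋ constˢ y)
constˢ-dec x y with x ℤ.≟ y
... | yes refl = just λ _ → refl
... | no _     = nothing


module ˢ where
  open CommutativeRing seriesRing public
module ≋-Reasoning = SetoidReasoning ˢ.setoid
open Algebra.Solver.Ring (CommutativeRing.rawRing ℤ.+-*-commutativeRing) (ACR.fromCommutativeRing seriesRing) const-homo constˢ-dec public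
  using (solve; con; _:=_; _:+_; _:*_; _:-_; :-_)

infixr 8 _^ˢ_
_^ˢ_ : Series → ℕ → Series
x ^ˢ zero  = 1ˢ
x ^ˢ suc n = x ⊗ x ^ˢ n

qˢ : Series
qˢ zero          = + 0
qˢ (suc zero)    = + 1
qˢ (suc (suc _)) = + 0

opaque
  unfolding _⊕_

  qˢ-zero : ∀ a → (qˢ ⊗ a) 0 ≡ + 0
  qˢ-zero a = refl

  qˢ-suc : ∀ a m → (qˢ ⊗ a) (suc m) ≡ a m
  qˢ-suc a m = trans (ℤ.+-identityˡ _) (trans (conv-cong tail (λ _ → refl) m) (conv-identityˡ a m))
    where tail : (λ i → qˢ (suc i)) ≋ 1ˢ
          tail zero    = refl
          tail (suc _) = refl

-- Turns a shift of weight between two counts into multiplication by a power of q; this is how the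
-- firing of a node acquires its factor.
delayed : ∀ w {a b : Series} → (∀ m → a (w + m) ≡ b m) → (∀ m → m < w → a m ≡ + 0) → a ≋ qˢ ^ˢ w ⊗ b
delayed zero    {a} {b} e z m = trans (e m) (sym (ˢ.*-identityˡ b m))
delayed (suc w) {a} {b} e z zero    = trans (z 0 (s≤s z≤n)) (sym (trans (ˢ.*-assoc qˢ (qˢ ^ˢ w) b 0) (qˢ-zero _)))
delayed (suc w) {a} {b} e z (suc m) = trans (delayed w {λ i → a (suc i)} {b} e (λ i l → z (suc i) (s≤s l)) m)
  (sym (trans (ˢ.*-assoc qˢ (qˢ ^ˢ w) b (suc m)) (qˢ-suc (qˢ ^ˢ w ⊗ b) m)))

-- Counting positions of the game of type C̃ by their descents

-- The numbers game on the chain 0 — 1 — ⋯ — n with double bonds at both ends (type C̃).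
record Chain (X : Set) (n : ℕ) : Set where
  field
    val   : X → ℕ → ℤ
    act   : ℕ → X → X
    self  : ∀ i x → i ≤ n → val (act i x) i ≡ ℤ.- val x i
    up₀   : ∀ x → 0 < n → val (act 0 x) 1 ≡ val x 1 ℤ.+ + 2 ℤ.* val x 0
    up    : ∀ i x → 1 ≤ i → i < n → val (act i x) (suc i) ≡ val x (suc i) ℤ.+ val x i
    down  : ∀ i x → suc i < n → val (act (suc i) x) i ≡ val x i ℤ.+ val x (suc i)
    downₙ : ∀ i x → suc i ≡ n → val (act (suc i) x) i ≡ val x i ℤ.+ + 2 ℤ.* val x (suc i)
    far   : ∀ i j x → i ≤ n → j ≤ n → i ≢ j → suc i ≢ j → suc j ≢ i → val (act i x) j ≡ val x j

  Regular : X → Set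
  Regular x = ∀ i → i ≤ n → val x i ≢ + 0

record DecPred (X : Set) : Set₁ where
  constructor decPred
  field
    holds  : X → Set
    holds? : ∀ x → Dec (holds x)
open DecPred

infixr 6 _∩_
_∩_ : ∀ {X} → DecPred X → DecPred X → DecPred X
P ∩ Q = decPred (λ x → holds P x × holds Q x) (λ x → holds? P x ×-dec holds? Q x)

∁_ : ∀ {X} → DecPred X → DecPred X
∁ P = decPred (λ x → ¬ holds P x) (λ x → ¬? (holds? P x))

_∙_ : ∀ {X} → DecPred X → (X → X) → DecPred X
P ∙ f = decPred (λ x → holds P (f x)) (λ x → holds? P (f x))

full : ∀ {X} → DecPred X
full = decPred (λ _ → ⊤) (λ _ → yes tt)

module _ {X n} (C : Chain X n) where
  open Chain C

  neg : ℕ → DecPred X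
  neg i = decPred (λ x → val x i ℤ.< + 0) (λ x → val x i ℤ.<? + 0)

  allOf : ∀ {S : ℕ → Set} → ℕ → (∀ a → Dec (S a)) → {R : ℤ → Set} → (∀ v → Dec (R v)) → DecPred X
  allOf {S} N S? {R} R? = decPred (λ x → ∀ {a} → a < N → S a → R (val x a)) λ x → allUpTo? (λ a → S? a →-dec R? (val x a)) N

  ascOn descOn : ∀ {S : ℕ → Set} → ℕ → (∀ a → Dec (S a)) → DecPred X
  ascOn  N S? = allOf N S? (+ 0 ℤ.≤?_)
  descOn N S? = allOf N S? (ℤ._<? + 0)

  asc< desc< : ℕ → DecPred X
  asc< k  = ascOn k (λ _ → yes tt)
  desc< k = descOn k (λ _ → yes tt)

-- What the counting argument uses of a weighted orbit. The firing laws express that a node with a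
-- negative entry can be made the first letter of a reduced word, at the cost of its weight s, t or
-- u. `gf-asc` says that the base, of weight 0, alone has no descent; `gf-desc` says that no element
-- of the infinite group descends everywhere.
record Count {X n} (C : Chain X n) (s t u : Series) : Set₁ where
  open Chain C
  field
    gf      : DecPred X → Series
    gf-cong : ∀ P Q → (∀ x → Regular x → holds P x → holds Q x) → (∀ x → Regular x → holds Q x → holds P x) → gf P ≋ gf Q
    split   : ∀ P Q → gf P ≋ gf (P ∩ Q) ⊕ gf (P ∩ ∁ Q)
    fire₀   : ∀ P → (∀ x → holds P x → holds (neg C 0) x) → gf P ≋ s ⊗ gf (P ∙ act 0)
    fire    : ∀ i P → 1 ≤ i → i < n → (∀ x → holds P x → holds (neg C i) x) → gf P ≋ t ⊗ gf (P ∙ act i)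
    fireₙ   : ∀ P → (∀ x → holds P x → holds (neg C n) x) → gf P ≋ u ⊗ gf (P ∙ act n)
    gf-asc  : gf (asc< C (suc n)) ≋ 1ˢ
    gf-desc : gf (desc< C (suc n)) ≋ 0ˢ

[_]⟨_⟩ : ℕ → Series → Series
[ zero ]⟨ t ⟩  = 0ˢ
[ suc j ]⟨ t ⟩ = 1ˢ ⊕ t ⊗ [ j ]⟨ t ⟩

-- The cosets of B_j in B_(j+1): [j + 1] counts the representatives avoiding the letter 0, and s tʲ
-- [j + 1] counts those that use it once.
typeB-factor : Series → Series → ℕ → Series
typeB-factor s t j = (1ˢ ⊕ s ⊗ t ^ˢ j) ⊗ [ suc j ]⟨ t ⟩

-- The Poincaré series of the finite group of type B with parameters s, t.
typeB : Series → Series → ℕ → Series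
typeB s t zero    = 1ˢ
typeB s t (suc j) = typeB s t j ⊗ typeB-factor s t j

-- The monomial of the longest element of type B.
longestB : Series → Series → ℕ → Series
longestB s t zero    = 1ˢ
longestB s t (suc j) = (s ⊗ t ^ˢ j ⊗ t ^ˢ j) ⊗ longestB s t j

[]-suc : ∀ t j → [ suc j ]⟨ t ⟩ ≋ [ j ]⟨ t ⟩ ⊕ t ^ˢ j
[]-suc t zero    = solve 1 (λ t → con (+ 1) :+ t :* con (+ 0) := con (+ 0) :+ con (+ 1)) (λ _ → refl) t
[]-suc t (suc j) = ˢ.trans (ˢ.+-congˡ (ˢ.*-congˡ ([]-suc t j)))
  (solve 3 (λ t a b → con (+ 1) :+ t :* (a :+ b) := (con (+ 1) :+ t :* a) :+ t :* b) (λ _ → refl) t _ _)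

nonneg+ : ∀ {a b} → + 0 ℤ.≤ a → + 0 ℤ.≤ b → + 0 ℤ.≤ a ℤ.+ b
nonneg+ = ℤ.+-mono-≤

module Coordinates {X n} (C : Chain X n) where
  open Chain C

  far< : ∀ i j x → i ≤ n → j ≤ n → suc j < i → val (act i x) j ≡ val x j
  far< i j x i≤n j≤n l = far i j x i≤n j≤n (≢-sym (<⇒≢ (<⇒≤ l))) (≢-sym (<⇒≢ (<-trans (<⇒≤ l) ≤-refl))) (<⇒≢ l)

  far> : ∀ i j x → i ≤ n → j ≤ n → suc i < j → val (act i x) j ≡ val x j
  far> i j x i≤n j≤n l = far i j x i≤n j≤n (<⇒≢ (<⇒≤ l)) (<⇒≢ l) (≢-sym (<⇒≢ (<-trans (<⇒≤ l) ≤-refl)))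

  -- In the coordinates ξ the game acts by signed permutations: firing i swaps ξ i and ξ (suc i),
  -- and firing 0 changes the sign of ξ 1.
  ξ : X → ℕ → ℤ
  ξ x zero    = + 0
  ξ x (suc i) = ξ x i ℤ.+ val x i

  ξ-low : ∀ b x i → suc b ≤ n → i ≤ b → ξ (act (suc b) x) i ≡ ξ x i
  ξ-low b x zero    l i≤b = refl
  ξ-low b x (suc i) l i<b = cong₂ ℤ._+_ (ξ-low b x i l (<⇒≤ i<b))
    (far< (suc b) i x l (≤-trans (<⇒≤ i<b) (<⇒≤ l)) (s≤s i<b))

  ξ-swap₁ : ∀ b x → suc b < n → ξ (act (suc b) x) (suc b) ≡ ξ x (suc (suc b))
  ξ-swap₁ b x l rewrite ξ-low b x b (<⇒≤ l) ≤-refl | down b x l = sym (ℤ.+-assoc (ξ x b) (val x b) (val x (suc b)))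

  ξ-swap₂ : ∀ b x → suc b < n → ξ (act (suc b) x) (suc (suc b)) ≡ ξ x (suc b)
  ξ-swap₂ b x l rewrite ξ-swap₁ b x l | self (suc b) x (<⇒≤ l) = lem (ξ x (suc b)) (val x (suc b))
    where lem : ∀ p q → (p ℤ.+ q) ℤ.+ ℤ.- q ≡ p
          lem = ℤ-Solver.solve-∀

  ξ-high : ∀ b x → suc b < n → ∀ m → suc (suc (suc b)) + m ≤ n → ξ (act (suc b) x) (suc (suc (suc b)) + m) ≡ ξ x (suc (suc (suc b)) + m)
  ξ-high b x l zero h rewrite +-identityʳ b | ξ-swap₂ b x l | up (suc b) x (s≤s z≤n) l = lem (ξ x (suc b)) (val x (suc b)) (val x (suc (suc b)))
    where lem : ∀ p q r → p ℤ.+ (r ℤ.+ q) ≡ (p ℤ.+ q) ℤ.+ r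
          lem = ℤ-Solver.solve-∀
  ξ-high b x l (suc m) h rewrite +-suc b m = cong₂ ℤ._+_ (ξ-high b x l m (<⇒≤ h))
    (far> (suc b) _ x (<⇒≤ l) (<⇒≤ h) (s≤s (s≤s (s≤s (m≤m+n b m)))))

  ξ-swap-other : ∀ b x → suc b < n → ∀ i → i ≤ n → i ≢ suc b → i ≢ suc (suc b) → ξ (act (suc b) x) i ≡ ξ x i
  ξ-swap-other b x l i i≤n i≢1+b i≢2+b with i ℕ.≤? b
  ... | yes i≤b = ξ-low b x i (<⇒≤ l) i≤b
  ... | no i≰b with m≤n⇒∃[o]m+o≡n (≤∧≢⇒< (≤∧≢⇒< (≰⇒> i≰b) (≢-sym i≢1+b)) (≢-sym i≢2+b))
  ... | m , refl = ξ-high b x l m i≤n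

  ξ-flip : ∀ x → 0 < n → ξ (act 0 x) 1 ≡ ℤ.- ξ x 1
  ξ-flip x l rewrite self 0 x z≤n = lem (val x 0)
    where lem : ∀ p → + 0 ℤ.+ ℤ.- p ≡ ℤ.- (+ 0 ℤ.+ p)
          lem = ℤ-Solver.solve-∀

  ξ-flip-other : ∀ x → 0 < n → ∀ m → suc (suc m) ≤ n → ξ (act 0 x) (suc (suc m)) ≡ ξ x (suc (suc m))
  ξ-flip-other x l zero h rewrite self 0 x z≤n | up₀ x l = lem (val x 0) (val x 1)
    where lem : ∀ p q → (+ 0 ℤ.+ ℤ.- p) ℤ.+ (q ℤ.+ + 2 ℤ.* p) ≡ (+ 0 ℤ.+ p) ℤ.+ q
          lem = ℤ-Solver.solve-∀
  ξ-flip-other x l (suc m) h = cong₂ ℤ._+_ (ξ-flip-other x l m (<⇒≤ h)) (far> 0 _ x z≤n (<⇒≤ h) (s≤s (s≤s z≤n)))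

module Lower {X n s t u} {C : Chain X n} (G : Count C s t u) where
  open Chain C
  open Count G
  open Coordinates C

  -- Says that `E` is a union of cosets of the parabolic subgroup on the nodes below k. Carrying
  -- such an `E` along lets a condition on the other side of node k survive the count on this side.
  record Stable (k : ℕ) (E : DecPred X) : Set where
    field
      push : ∀ i x → i < k → holds E x → holds E (act i x)
      pull : ∀ i x → i < k → holds E (act i x) → holds E x
  open Stable

  neg-act : ∀ i x → i ≤ n → Regular x → + 0 ℤ.≤ val x i → val (act i x) i ℤ.< + 0
  neg-act i x i≤n reg p = subst (ℤ._< + 0) (sym (self i x i≤n)) (ℤ.neg-mono-< (ℤ.≤∧≢⇒< p (λ z → reg i i≤n (sym z))))

  act-neg : ∀ i x → i ≤ n → val (act i x) i ℤ.< + 0 → + 0 ℤ.≤ val x i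
  act-neg i x i≤n p = subst (+ 0 ℤ.≤_) (trans (cong ℤ.-_ (self i x i≤n)) (ℤ.neg-involutive _)) (ℤ.<⇒≤ (ℤ.neg-mono-< p))

  weight : ℕ → Series
  weight zero    = s
  weight (suc _) = t

  fire< : ∀ i P → i < n → (∀ x → holds P x → holds (neg C i) x) → gf P ≋ weight i ⊗ gf (P ∙ act i)
  fire< zero    P l = fire₀ P
  fire< (suc i) P l = fire (suc i) P (s≤s z≤n) l

  -- Sorting one new entry into an increasing sequence of type B: on its way down the values at
  -- i and i + 1 add up to a nonnegative number, and after the change of sign on its way up as well.
  module Insert (j : ℕ) (j<n : j < n) (E : DecPred X) (st : Stable (suc j) E) where

    AscExcept : ℕ → X → Set
    AscExcept k x = ∀ {a} → a < suc j → a ≢ k → + 0 ℤ.≤ val x a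

    SumAt : ℕ → X → Set
    SumAt i x = i < j → + 0 ℤ.≤ val x i ℤ.+ val x (suc i)

    ascExcept? : ∀ k i x → Dec (AscExcept k x × SumAt i x)
    ascExcept? k i x = allUpTo? (λ a → ¬? (a ℕ.≟ k) →-dec (+ 0 ℤ.≤? val x a)) (suc j)
                 ×-dec ((i ℕ.<? j) →-dec (+ 0 ℤ.≤? val x i ℤ.+ val x (suc i)))

    -- In both, ξ (i + 1) is the entry on its way, and the sequence 0, ξ 1, ..., ξ (j + 1) without
    -- it is weakly increasing. In `Down i` it may lie below its left neighbour, in `Up i` above its
    -- right one. `Down j` amounts to ascent below j, and `Up j` to ascent below j + 1.
    Down Up : ℕ → DecPred X
    Down i   = decPred _ (ascExcept? i i)
    Up i     = decPred _ (ascExcept? (suc i) i)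

    S : Series
    S = gf (asc< C (suc j) ∩ E)

    complete-asc : ∀ {k x} → AscExcept k x → + 0 ℤ.≤ val x k → holds (asc< C (suc j)) x
    complete-asc {k} d p {a} l _ with a ℕ.≟ k
    ... | yes refl = p
    ... | no a≢k   = d l a≢k

    -- If the entry at i is nonnegative, the sequence is already sorted and contributes `S`. If it
    -- is negative, firing i moves the new entry one place on (or changes its sign), and `Q`
    -- describes the outcome.
    insert-step : ∀ i k → i < suc j → (Q : DecPred X) →
      (∀ x → + 0 ℤ.≤ val x i → AscExcept i (act i x) → SumAt k (act i x) → holds Q x) →
      (∀ x → holds Q x → + 0 ℤ.≤ val x i × AscExcept i (act i x) × SumAt k (act i x)) →
      gf (decPred _ (ascExcept? i k) ∩ E) ≋ weight i ⊗ gf (Q ∩ E) ⊕ S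
    insert-step i k i<1+j Q to from = ˢ.trans (split (P ∩ E) (neg C i)) (ˢ.+-cong
      (ˢ.trans (fire< i ((P ∩ E) ∩ neg C i) i<n (λ _ → proj₂)) (ˢ.*-congˡ (gf-cong _ _
        (λ { x _ (((d , d′) , e) , v<0) → to x (act-neg i x (<⇒≤ i<n) v<0) d d′ , pull st i x i<1+j e })
        (λ { x reg (q , e) → (proj₂ (from x q) , push st i x i<1+j e) , neg-act i x (<⇒≤ i<n) reg (proj₁ (from x q)) }))))
      (gf-cong _ _
        (λ { x _ (((d , _) , e) , v≮0) → (λ {a} → complete-asc d (ℤ.≮⇒≥ v≮0) {a}) , e })
        (λ { x _ (d , e) → (((λ l _ → d l tt) , λ k<j → nonneg+ (d (m<n⇒m<1+n k<j) tt) (d (s≤s k<j) tt)) , e) , ℤ.≤⇒≯ (d i<1+j tt) })))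
      where
      P : DecPred X
      P = decPred _ (ascExcept? i k)
      i<n : i < n
      i<n = ≤-trans i<1+j j<n

    module Node (i : ℕ) (i<j : i < j) (x : X) where
      private
        1+i<n : suc i < n
        1+i<n = ≤-<-trans i<j j<n
        1+i≤n : suc i ≤ n
        1+i≤n = <⇒≤ 1+i<n
      y : X
      y = act (suc i) x
      below : val y i ≡ val x i ℤ.+ val x (suc i)
      below = down i x 1+i<n
      above : val y (suc (suc i)) ≡ val x (suc i) ℤ.+ val x (suc (suc i))
      above = trans (up (suc i) x (s≤s z≤n) 1+i<n) (ℤ.+-comm (val x (suc (suc i))) _)
      sum-below : val y i ℤ.+ val y (suc i) ≡ val x i
      sum-below rewrite below | self (suc i) x 1+i≤n = lem (val x i) (val x (suc i))
        where lem : ∀ p q → (p ℤ.+ q) ℤ.+ ℤ.- q ≡ p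
              lem = ℤ-Solver.solve-∀
      sum-above : val y (suc i) ℤ.+ val y (suc (suc i)) ≡ val x (suc (suc i))
      sum-above rewrite above | self (suc i) x 1+i≤n = lem (val x (suc i)) (val x (suc (suc i)))
        where lem : ∀ p q → ℤ.- p ℤ.+ (p ℤ.+ q) ≡ q
              lem = ℤ-Solver.solve-∀
      other : ∀ {a} → a < suc j → a ≢ i → a ≢ suc i → a ≢ suc (suc i) → val y a ≡ val x a
      other {a} l a≢i a≢1+i a≢2+i = far (suc i) a x 1+i≤n (≤-trans (≤-pred l) (<⇒≤ j<n)) (≢-sym a≢1+i) (≢-sym a≢2+i) (λ e → a≢i (suc-injective e))

    i≢1+i : ∀ {i} → i ≢ suc i
    i≢1+i = ≢-sym 1+n≢n

    Down-step : ∀ i → i < j → gf (Down (suc i) ∩ E) ≋ t ⊗ gf (Down i ∩ E) ⊕ S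
    Down-step i i<j = insert-step (suc i) (suc i) (s≤s i<j) (Down i)
        (λ x p d d′ → (λ {a} → to x p d d′ {a}) , λ _ → subst (+ 0 ℤ.≤_) (Node.below i i<j x) (d (m<n⇒m<1+n i<j) i≢1+i))
        (λ { x (d , d′) → d (s≤s i<j) 1+n≢n , (λ {a} → from x d d′ {a}) , λ l → subst (+ 0 ℤ.≤_) (sym (Node.sum-above i i<j x)) (d (s≤s l) (≢-sym (<⇒≢ (s≤s (n≤1+n i))))) })
      where
      to : ∀ x → + 0 ℤ.≤ val x (suc i) → AscExcept (suc i) (act (suc i) x) → SumAt (suc i) (act (suc i) x) → AscExcept i x
      to x p d d′ {a} l a≢i with a ℕ.≟ suc i | a ℕ.≟ suc (suc i)
      ... | yes refl | _        = p
      ... | no _     | yes refl = subst (+ 0 ℤ.≤_) (Node.sum-above i i<j x) (d′ (≤-pred l))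
      ... | no a≢1+i | no a≢2+i = subst (+ 0 ℤ.≤_) (Node.other i i<j x l a≢i a≢1+i a≢2+i) (d l a≢1+i)
      from : ∀ x → AscExcept i x → SumAt i x → AscExcept (suc i) (act (suc i) x)
      from x d d′ {a} l a≢1+i with a ℕ.≟ i | a ℕ.≟ suc (suc i)
      ... | yes refl | _        = subst (+ 0 ℤ.≤_) (sym (Node.below i i<j x)) (d′ i<j)
      ... | no _     | yes refl = subst (+ 0 ℤ.≤_) (sym (Node.above i i<j x)) (nonneg+ (d (s≤s i<j) 1+n≢n) (d l (≢-sym (<⇒≢ (s≤s (n≤1+n i))))))
      ... | no a≢i   | no a≢2+i = subst (+ 0 ℤ.≤_) (sym (Node.other i i<j x l a≢i a≢1+i a≢2+i)) (d l a≢i)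

    Up-step : ∀ i → i < j → gf (Up i ∩ E) ≋ t ⊗ gf (Up (suc i) ∩ E) ⊕ S
    Up-step i i<j = insert-step (suc i) i (s≤s i<j) (Up (suc i))
        (λ x p d d′ → (λ {a} → to x p d d′ {a}) , λ l → subst (+ 0 ℤ.≤_) (Node.above i i<j x) (d (s≤s l) 1+n≢n))
        (λ { x (d , d′) → d (s≤s i<j) i≢1+i , (λ {a} → from x d d′ {a}) , λ _ → subst (+ 0 ℤ.≤_) (sym (Node.sum-below i i<j x)) (low x d) })
      where
      low : ∀ x → AscExcept (suc (suc i)) x → + 0 ℤ.≤ val x i
      low x d = d (m<n⇒m<1+n i<j) (<⇒≢ (s≤s (n≤1+n i)))
      to : ∀ x → + 0 ℤ.≤ val x (suc i) → AscExcept (suc i) (act (suc i) x) → SumAt i (act (suc i) x) → AscExcept (suc (suc i)) x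
      to x p d d′ {a} l a≢2+i with a ℕ.≟ suc i | a ℕ.≟ i
      ... | yes refl | _        = p
      ... | no _     | yes refl = subst (+ 0 ℤ.≤_) (Node.sum-below i i<j x) (d′ i<j)
      ... | no a≢1+i | no a≢i   = subst (+ 0 ℤ.≤_) (Node.other i i<j x l a≢i a≢1+i a≢2+i) (d l a≢1+i)
      from : ∀ x → AscExcept (suc (suc i)) x → SumAt (suc i) x → AscExcept (suc i) (act (suc i) x)
      from x d d′ {a} l a≢1+i with a ℕ.≟ i | a ℕ.≟ suc (suc i)
      ... | yes refl | _        = subst (+ 0 ℤ.≤_) (sym (Node.below i i<j x)) (nonneg+ (low x d) (d (s≤s i<j) i≢1+i))
      ... | no _     | yes refl = subst (+ 0 ℤ.≤_) (sym (Node.above i i<j x)) (d′ (≤-pred l))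
      ... | no a≢i   | no a≢2+i = subst (+ 0 ℤ.≤_) (sym (Node.other i i<j x l a≢i a≢1+i a≢2+i)) (d l a≢2+i)

    Down₀-step : gf (Down 0 ∩ E) ≋ s ⊗ gf (Up 0 ∩ E) ⊕ S
    Down₀-step = insert-step 0 0 (s≤s z≤n) (Up 0)
        (λ x p d d′ → (λ {a} → to x p d {a}) , λ l → subst (+ 0 ℤ.≤_) (sum-act x) (d′ l))
        (λ { x (d , d′) → d (s≤s z≤n) (λ ()) , (λ {a} → from x d d′ {a}) , λ l → subst (+ 0 ℤ.≤_) (sym (sum-act x)) (d′ l) })
      where
      0<n : 0 < n
      0<n = ≤-<-trans z≤n j<n
      sum-act : ∀ x → val (act 0 x) 0 ℤ.+ val (act 0 x) 1 ≡ val x 0 ℤ.+ val x 1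
      sum-act x rewrite self 0 x z≤n | up₀ x 0<n = lem (val x 0) (val x 1)
        where lem : ∀ p q → ℤ.- p ℤ.+ (q ℤ.+ + 2 ℤ.* p) ≡ p ℤ.+ q
              lem = ℤ-Solver.solve-∀
      val-act₁ : ∀ x → val (act 0 x) 1 ≡ (val x 0 ℤ.+ val x 1) ℤ.+ val x 0
      val-act₁ x = trans (up₀ x 0<n) (lem (val x 0) (val x 1))
        where lem : ∀ p q → q ℤ.+ + 2 ℤ.* p ≡ (p ℤ.+ q) ℤ.+ p
              lem = ℤ-Solver.solve-∀
      far′ : ∀ x {a} → a < suc j → a ≢ 0 → a ≢ 1 → val (act 0 x) a ≡ val x a
      far′ x l a≢0 a≢1 = far 0 _ x z≤n (≤-trans (≤-pred l) (<⇒≤ j<n)) (≢-sym a≢0) (≢-sym a≢1) (λ ())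
      to : ∀ x → + 0 ℤ.≤ val x 0 → AscExcept 0 (act 0 x) → AscExcept 1 x
      to x p d {a} l a≢1 with a ℕ.≟ 0
      ... | yes refl = p
      ... | no a≢0   = subst (+ 0 ℤ.≤_) (far′ x l a≢0 a≢1) (d l a≢0)
      from : ∀ x → AscExcept 1 x → SumAt 0 x → AscExcept 0 (act 0 x)
      from x d d′ {a} l a≢0 with a ℕ.≟ 1
      ... | yes refl = subst (+ 0 ℤ.≤_) (sym (val-act₁ x)) (nonneg+ (d′ (≤-pred l)) (d (s≤s z≤n) (λ ())))
      ... | no a≢1   = subst (+ 0 ℤ.≤_) (sym (far′ x l a≢0 a≢1)) (d l a≢1)

    gf-Up : ∀ m i → i + m ≡ j → gf (Up i ∩ E) ≋ [ suc m ]⟨ t ⟩ ⊗ S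
    gf-Up zero i e = ˢ.trans (gf-cong (Up i ∩ E) (asc< C (suc j) ∩ E) (λ { x _ ((d , _) , e′) → (λ {a} l _ → d l (λ a≡1+i → <⇒≢ l (trans a≡1+i (cong suc i≡j)))) , e′ })
                                          (λ { x _ (d , e′) → ((λ l _ → d l tt) , λ i<j → ⊥-elim (<⇒≢ i<j i≡j)) , e′ }))
      (solve 2 (λ t a → a := (con (+ 1) :+ t :* con (+ 0)) :* a) (λ _ → refl) t S)
      where i≡j : i ≡ j
            i≡j = trans (sym (+-identityʳ i)) e
    gf-Up (suc m) i e = begin
      gf (Up i ∩ E)                       ≈⟨ Up-step i (m+n≤o⇒m≤o (suc i) (≤-reflexive e′)) ⟩
      t ⊗ gf (Up (suc i) ∩ E) ⊕ S         ≈⟨ ˢ.+-congʳ (ˢ.*-congˡ (gf-Up m (suc i) e′)) ⟩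
      t ⊗ ([ suc m ]⟨ t ⟩ ⊗ S) ⊕ S        ≈⟨ solve 3 (λ t b a → t :* (b :* a) :+ a := (con (+ 1) :+ t :* b) :* a) (λ _ → refl) t _ S ⟩
      [ suc (suc m) ]⟨ t ⟩ ⊗ S            ∎
      where
      open ≋-Reasoning
      e′ : suc i + m ≡ j
      e′ = trans (sym (+-suc i m)) e

    gf-Down : ∀ i → i ≤ j → gf (Down i ∩ E) ≋ [ i ]⟨ t ⟩ ⊗ S ⊕ t ^ˢ i ⊗ (S ⊕ s ⊗ ([ suc j ]⟨ t ⟩ ⊗ S))
    gf-Down zero l = begin
      gf (Down 0 ∩ E)                            ≈⟨ Down₀-step ⟩
      s ⊗ gf (Up 0 ∩ E) ⊕ S                      ≈⟨ ˢ.+-congʳ (ˢ.*-congˡ (gf-Up j 0 refl)) ⟩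
      s ⊗ ([ suc j ]⟨ t ⟩ ⊗ S) ⊕ S               ≈⟨ solve 2 (λ b a → b :+ a := con (+ 0) :* a :+ con (+ 1) :* (a :+ b)) (λ _ → refl) _ S ⟩
      0ˢ ⊗ S ⊕ 1ˢ ⊗ (S ⊕ s ⊗ ([ suc j ]⟨ t ⟩ ⊗ S)) ∎
      where open ≋-Reasoning
    gf-Down (suc i) l = begin
      gf (Down (suc i) ∩ E)                      ≈⟨ Down-step i l ⟩
      t ⊗ gf (Down i ∩ E) ⊕ S                    ≈⟨ ˢ.+-congʳ (ˢ.*-congˡ (gf-Down i (<⇒≤ l))) ⟩
      t ⊗ ([ i ]⟨ t ⟩ ⊗ S ⊕ t ^ˢ i ⊗ (S ⊕ s ⊗ ([ suc j ]⟨ t ⟩ ⊗ S))) ⊕ S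
        ≈⟨ solve 5 (λ t b a p q → t :* (b :* a :+ p :* q) :+ a := (con (+ 1) :+ t :* b) :* a :+ (t :* p) :* q) (λ _ → refl) t _ S _ _ ⟩
      [ suc i ]⟨ t ⟩ ⊗ S ⊕ t ^ˢ suc i ⊗ (S ⊕ s ⊗ ([ suc j ]⟨ t ⟩ ⊗ S)) ∎
      where open ≋-Reasoning


  -- The first j coordinates are sorted and the next one is arbitrary. Its insertion ends on the way
  -- down, with total weight [j], at the bottom, with tʲ, or after the change of sign, with s tʲ
  -- [j + 1].
  gf-asc-suc : ∀ j → j < n → ∀ E → Stable (suc j) E →
    gf (asc< C j ∩ E) ≋ ((1ˢ ⊕ s ⊗ t ^ˢ j) ⊗ [ suc j ]⟨ t ⟩) ⊗ gf (asc< C (suc j) ∩ E)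
  gf-asc-suc j j<n E st = begin
    gf (asc< C j ∩ E)  ≈⟨ gf-cong _ _ (λ { x _ (p , e) → ((λ {a} l a≢j → p (≤∧≢⇒< (≤-pred l) a≢j) tt) , (λ l → ⊥-elim (<-irrefl refl l))) , e })
                                    (λ { x _ ((p , _) , e) → (λ l _ → p (m<n⇒m<1+n l) (<⇒≢ l)) , e }) ⟩
    gf (Down j ∩ E)    ≈⟨ gf-Down j ≤-refl ⟩
    [ j ]⟨ t ⟩ ⊗ A ⊕ t ^ˢ j ⊗ (A ⊕ s ⊗ ([ suc j ]⟨ t ⟩ ⊗ A))
      ≈⟨ solve 5 (λ b a p s c → b :* a :+ p :* (a :+ s :* (c :* a)) := (b :+ p) :* a :+ s :* p :* c :* a) (λ _ → refl) [ j ]⟨ t ⟩ A (t ^ˢ j) s [ suc j ]⟨ t ⟩ ⟩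
    ([ j ]⟨ t ⟩ ⊕ t ^ˢ j) ⊗ A ⊕ s ⊗ t ^ˢ j ⊗ [ suc j ]⟨ t ⟩ ⊗ A
      ≈⟨ ˢ.+-congʳ (ˢ.*-congʳ (ˢ.sym ([]-suc t j))) ⟩
    [ suc j ]⟨ t ⟩ ⊗ A ⊕ s ⊗ t ^ˢ j ⊗ [ suc j ]⟨ t ⟩ ⊗ A
      ≈⟨ solve 4 (λ b a p s → b :* a :+ s :* p :* b :* a := ((con (+ 1) :+ s :* p) :* b) :* a) (λ _ → refl) [ suc j ]⟨ t ⟩ A (t ^ˢ j) s ⟩
    ((1ˢ ⊕ s ⊗ t ^ˢ j) ⊗ [ suc j ]⟨ t ⟩) ⊗ A ∎
    where
    open ≋-Reasoning
    open Insert j j<n E st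
    A : Series
    A = S

  -- The factorisation of a group by a parabolic subgroup of type B, obtained by sorting in one
  -- coordinate at a time; the representatives are the positions ascending at all nodes below k.
  gf-asc< : ∀ k → k ≤ n → ∀ E → Stable k E → gf E ≋ typeB s t k ⊗ gf (asc< C k ∩ E)
  gf-asc< zero    k≤n E st = ˢ.trans (gf-cong _ _ (λ _ _ e → (λ ()) , e) (λ _ _ → proj₂)) (ˢ.sym (ˢ.*-identityˡ _))
  gf-asc< (suc k) k<n E st = begin
    gf E                                              ≈⟨ gf-asc< k (<⇒≤ k<n) E (record { push = λ i x l → push st i x (m<n⇒m<1+n l) ; pull = λ i x l → pull st i x (m<n⇒m<1+n l) }) ⟩
    typeB s t k ⊗ gf (asc< C k ∩ E)                   ≈⟨ ˢ.*-congˡ (gf-asc-suc k k<n E st) ⟩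
    typeB s t k ⊗ (typeB-factor s t k ⊗ gf (asc< C (suc k) ∩ E)) ≈⟨ ˢ.sym (ˢ.*-assoc _ _ _) ⟩
    typeB s t (suc k) ⊗ gf (asc< C (suc k) ∩ E)       ∎
    where open ≋-Reasoning

  -- The reflection p ... 1 0 1 ... p, which changes the sign of the coordinate p + 1 alone and has
  -- weight s t²ᵖ.
  negate : ℕ → X → X
  negate zero    x = act 0 x
  negate (suc p) x = act (suc p) (negate p (act (suc p) x))

  ξ-negate : ∀ p x → p < n → ξ (negate p x) (suc p) ≡ ℤ.- ξ x (suc p)
  ξ-negate-other : ∀ p x → p < n → ∀ i → i ≤ n → i ≢ suc p → ξ (negate p x) i ≡ ξ x i

  ξ-negate zero    x l = ξ-flip x l
  ξ-negate (suc p) x l = trans (ξ-swap₂ p _ l) (trans (ξ-negate p _ (<⇒≤ l)) (cong ℤ.-_ (ξ-swap₁ p x l)))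

  ξ-negate-other zero    x l zero          i≤n i≢1 = refl
  ξ-negate-other zero    x l (suc zero)    i≤n i≢1 = ⊥-elim (i≢1 refl)
  ξ-negate-other zero    x l (suc (suc m)) i≤n i≢1 = ξ-flip-other x l m i≤n
  ξ-negate-other (suc p) x l i i≤n i≢2+p with i ℕ.≟ suc p
  ... | yes refl = trans (ξ-swap₁ p _ l) (trans (ξ-negate-other p _ (<⇒≤ l) (suc (suc p)) l (λ e → 1+n≢n (suc-injective e))) (ξ-swap₂ p x l))
  ... | no i≢1+p = trans (ξ-swap-other p _ l i i≤n i≢1+p i≢2+p) (trans (ξ-negate-other p _ (<⇒≤ l) i i≤n i≢1+p) (ξ-swap-other p x l i i≤n i≢1+p i≢2+p))

  -- Every letter of the word for negate descends on P.
  gf-negate : ∀ p → p < n → ∀ P → (∀ x → holds P x → ∀ i → i ≤ p → ξ x (suc p) ℤ.< ξ x i × ξ x (suc p) ℤ.< ℤ.- ξ x i) →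
    gf P ≋ (s ⊗ t ^ˢ p ⊗ t ^ˢ p) ⊗ gf (P ∙ negate p)
  gf-negate zero l P low = ˢ.trans (fire₀ P (λ x h → subst (ℤ._< + 0) (ℤ.+-identityˡ _) (proj₁ (low x h 0 z≤n))))
    (solve 2 (λ s a → s :* a := (s :* con (+ 1) :* con (+ 1)) :* a) (λ _ → refl) s _)
  gf-negate (suc p) l P low = begin
    gf P                                      ≈⟨ fire (suc p) P (s≤s z≤n) l (λ x h → descent x (proj₁ (low x h (suc p) ≤-refl))) ⟩
    t ⊗ gf P₁                                 ≈⟨ ˢ.*-congˡ (gf-negate p (<⇒≤ l) P₁ low₁) ⟩
    t ⊗ ((s ⊗ t ^ˢ p ⊗ t ^ˢ p) ⊗ gf P₂)       ≈⟨ ˢ.*-congˡ (ˢ.*-congˡ (fire (suc p) P₂ (s≤s z≤n) l low₂)) ⟩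
    t ⊗ ((s ⊗ t ^ˢ p ⊗ t ^ˢ p) ⊗ (t ⊗ gf (P ∙ negate (suc p))))
      ≈⟨ solve 4 (λ t s a g → t :* ((s :* a :* a) :* (t :* g)) := (s :* (t :* a) :* (t :* a)) :* g) (λ _ → refl) t s (t ^ˢ p) _ ⟩
    (s ⊗ t ^ˢ suc p ⊗ t ^ˢ suc p) ⊗ gf (P ∙ negate (suc p)) ∎
    where
    open ≋-Reasoning
    P₁ P₂ : DecPred X
    P₁ = P ∙ act (suc p)
    P₂ = P₁ ∙ negate p
    descent : ∀ x → ξ x (suc (suc p)) ℤ.< ξ x (suc p) → val x (suc p) ℤ.< + 0
    descent x h = subst₂ ℤ._<_ (lem (ξ x (suc p)) _) (ℤ.+-inverseʳ (ξ x (suc p))) (ℤ.+-monoˡ-< (ℤ.- ξ x (suc p)) h)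
      where lem : ∀ a b → (a ℤ.+ b) ℤ.+ ℤ.- a ≡ b
            lem = ℤ-Solver.solve-∀
    low₁ : ∀ x → holds P₁ x → ∀ i → i ≤ p → ξ x (suc p) ℤ.< ξ x i × ξ x (suc p) ℤ.< ℤ.- ξ x i
    low₁ x h i i≤p with low _ h i (≤-trans i≤p (n≤1+n p))
    ... | a , b = subst₂ ℤ._<_ (ξ-swap₂ p x l) (ξ-low p x i (<⇒≤ l) i≤p) a
                , subst₂ ℤ._<_ (ξ-swap₂ p x l) (cong ℤ.-_ (ξ-low p x i (<⇒≤ l) i≤p)) b
    low₂ : ∀ x → holds P₂ x → val x (suc p) ℤ.< + 0
    low₂ x h = descent x (ℤ.neg-cancel-< (subst₂ ℤ._<_
      (trans (ξ-swap₂ p _ l) (ξ-negate p x (<⇒≤ l)))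
      (cong ℤ.-_ (trans (ξ-swap₁ p _ l) (ξ-negate-other p x (<⇒≤ l) (suc (suc p)) l (λ e → 1+n≢n (suc-injective e)))))
      (proj₂ (low _ h (suc p) ≤-refl))))

  flips : ℕ → ℕ → X → X
  flips zero    j x = x
  flips (suc d) j x = flips d (suc j) (negate j x)

  ξ-flips-low : ∀ d j x → d + j ≤ n → ∀ i → i ≤ j → ξ (flips d j x) i ≡ ξ x i
  ξ-flips-low zero    j x l i i≤j = refl
  ξ-flips-low (suc d) j x l i i≤j = trans (ξ-flips-low d (suc j) _ (subst (_≤ n) (sym (+-suc d j)) l) i (m≤n⇒m≤1+n i≤j))
    (ξ-negate-other j x j<n i (≤-trans i≤j (<⇒≤ j<n)) (<⇒≢ (s≤s i≤j)))
    where j<n : j < n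
          j<n = ≤-trans (s≤s (m≤n+m j d)) l

  ξ-flips : ∀ d j x → d + j ≤ n → ∀ i → j < i → i ≤ d + j → ξ (flips d j x) i ≡ ℤ.- ξ x i
  ξ-flips zero    j x l i j<i i≤j = ⊥-elim (<⇒≱ j<i i≤j)
  ξ-flips (suc d) j x l i j<i i≤d+j with i ℕ.≟ suc j
  ... | yes refl = trans (ξ-flips-low d (suc j) _ (subst (_≤ n) (sym (+-suc d j)) l) i ≤-refl) (ξ-negate j x (≤-trans (s≤s (m≤n+m j d)) l))
  ... | no i≢1+j = trans (ξ-flips d (suc j) _ (subst (_≤ n) (sym (+-suc d j)) l) i (≤∧≢⇒< j<i (≢-sym i≢1+j)) (subst (i ≤_) (sym (+-suc d j)) i≤d+j))
    (cong ℤ.-_ (ξ-negate-other j x (≤-trans (s≤s (m≤n+m j d)) l) i (≤-trans i≤d+j l) i≢1+j))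

  module _ {k E} (st : Stable k E) where
    negate-push : ∀ p x → p < k → holds E x → holds E (negate p x)
    negate-push zero    x l e = push st 0 x l e
    negate-push (suc p) x l e = push st (suc p) _ l (negate-push p _ (<⇒≤ l) (push st (suc p) x l e))

    negate-pull : ∀ p x → p < k → holds E (negate p x) → holds E x
    negate-pull zero    x l e = pull st 0 x l e
    negate-pull (suc p) x l e = pull st (suc p) x l (negate-pull p _ (<⇒≤ l) (pull st (suc p) _ l e))

    flips-push : ∀ d j x → d + j ≤ k → holds E x → holds E (flips d j x)
    flips-push zero    j x l e = e
    flips-push (suc d) j x l e = flips-push d (suc j) _ (subst (_≤ k) (sym (+-suc d j)) l) (negate-push j x (≤-trans (s≤s (m≤n+m j d)) l) e)

    flips-pull : ∀ d j x → d + j ≤ k → holds E (flips d j x) → holds E x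
    flips-pull zero    j x l e = e
    flips-pull (suc d) j x l e = negate-pull j x (≤-trans (s≤s (m≤n+m j d)) l) (flips-pull d (suc j) _ (subst (_≤ k) (sym (+-suc d j)) l) e)

  ξ-decreasing : ∀ k x → holds (desc< C k) x → ∀ i j → i < j → j ≤ k → ξ x j ℤ.< ξ x i
  ξ-decreasing k x h i (suc j) i<1+j j<k with i ℕ.≟ j
  ... | yes refl = subst (ξ x i ℤ.+ val x i ℤ.<_) (ℤ.+-identityʳ _) (ℤ.+-monoʳ-< (ξ x i) (h j<k tt))
  ... | no i≢j = ℤ.<-trans (subst (ξ x j ℤ.+ val x j ℤ.<_) (ℤ.+-identityʳ _) (ℤ.+-monoʳ-< (ξ x j) (h j<k tt)))
                           (ξ-decreasing k x h i j (≤∧≢⇒< (≤-pred i<1+j) i≢j) (<⇒≤ j<k))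

  ξ-nonpos : ∀ k x → holds (desc< C k) x → ∀ i → i ≤ k → ξ x i ℤ.≤ + 0
  ξ-nonpos k x h zero    l = ℤ.≤-refl
  ξ-nonpos k x h (suc i) l = ℤ.<⇒≤ (ξ-decreasing k x h 0 (suc i) (s≤s z≤n) l)

  -- The longest element of type B negates all coordinates.
  gf-desc< : ∀ k → k ≤ n → ∀ E → Stable k E → gf (desc< C k ∩ E) ≋ longestB s t k ⊗ gf (asc< C k ∩ E)
  gf-desc< k k≤n E st = ˢ.trans (go k 0 (+-identityʳ k)) (ˢ.*-congˡ (gf-cong _ _
      (λ { x reg (h , e) → (λ {a} a<k _ → ℤ.≮⇒≥ λ v<0 → ℤ.<-asym (h a<k tt) (subst (+ 0 ℤ.<_) (sym (val-flips x a a<k)) (ℤ.neg-mono-< v<0))) , flips-pull st k 0 x (≤-reflexive (+-identityʳ k)) e })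
      (λ { x reg (h , e) → (λ {a} a<k _ → subst (ℤ._< + 0) (sym (val-flips x a a<k)) (ℤ.neg-mono-< (ℤ.≤∧≢⇒< (h a<k tt) (λ z → reg a (≤-trans (<⇒≤ a<k) k≤n) (sym z)))))
                         , flips-push st k 0 x (≤-reflexive (+-identityʳ k)) e })))
    where
    P : DecPred X
    P = desc< C k ∩ E
    ξ-flipped : ∀ x i → i ≤ k → ξ (flips k 0 x) i ≡ ℤ.- ξ x i
    ξ-flipped x zero    l = refl
    ξ-flipped x (suc i) l = ξ-flips k 0 x (subst (_≤ n) (sym (+-identityʳ k)) k≤n) (suc i) (s≤s z≤n) (subst (suc i ≤_) (sym (+-identityʳ k)) l)
    val-flips : ∀ x a → a < k → val (flips k 0 x) a ≡ ℤ.- val x a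
    val-flips x a a<k = trans (lem (ξ (flips k 0 x) a) (val (flips k 0 x) a)) (trans (cong₂ ℤ._-_ (ξ-flipped x (suc a) a<k) (ξ-flipped x a (<⇒≤ a<k))) (lem′ (ξ x a) (val x a)))
      where lem : ∀ p q → q ≡ (p ℤ.+ q) ℤ.- p
            lem = ℤ-Solver.solve-∀
            lem′ : ∀ p q → (ℤ.- (p ℤ.+ q)) ℤ.- (ℤ.- p) ≡ ℤ.- q
            lem′ = ℤ-Solver.solve-∀
    -- The top coordinate goes first. The coordinates up to j + 1 are then still decreasing and at
    -- most 0, so ξ (j + 1) lies below every ± ξ i with i ≤ j, as `gf-negate` requires.
    go : ∀ j d → j + d ≡ k → gf (P ∙ flips d j) ≋ longestB s t j ⊗ gf (P ∙ flips k 0)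
    go zero    d refl = ˢ.sym (ˢ.*-identityˡ _)
    go (suc j) d e = ˢ.trans (gf-negate j j<n (P ∙ flips d (suc j)) low)
        (ˢ.trans (ˢ.*-congˡ (go j (suc d) (trans (+-suc j d) e))) (ˢ.sym (ˢ.*-assoc _ _ _)))
      where
      d+1+j : d + suc j ≡ k
      d+1+j = trans (+-comm d (suc j)) e
      1+j≤k : suc j ≤ k
      1+j≤k = m+n≤o⇒m≤o (suc j) (≤-reflexive e)
      j<n : j < n
      j<n = ≤-trans 1+j≤k k≤n
      low : ∀ x → holds (P ∙ flips d (suc j)) x → ∀ i → i ≤ j → ξ x (suc j) ℤ.< ξ x i × ξ x (suc j) ℤ.< ℤ.- ξ x i
      low x (h , _) i i≤j = subst₂ ℤ._<_ (same (suc j) ≤-refl) (same i (m≤n⇒m≤1+n i≤j)) (ξ-decreasing k _ h i (suc j) (s≤s i≤j) 1+j≤k)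
                          , ℤ.<-≤-trans (subst (ℤ._< + 0) (same (suc j) ≤-refl) (ξ-decreasing k _ h 0 (suc j) (s≤s z≤n) 1+j≤k))
                                        (ℤ.neg-mono-≤ (subst (ℤ._≤ + 0) (same i (m≤n⇒m≤1+n i≤j)) (ξ-nonpos k _ h i (≤-trans i≤j (<⇒≤ 1+j≤k)))))
        where
        same : ∀ i → i ≤ suc j → ξ (flips d (suc j) x) i ≡ ξ x i
        same = ξ-flips-low d (suc j) x (subst (_≤ n) (sym d+1+j) k≤n)

-- A q-Vandermonde summation

sign : ℕ → Series
sign zero    = 1ˢ
sign (suc k) = ⊖ sign k

sign² : ∀ k → sign k ⊗ sign k ≋ 1ˢ
sign² zero    = ˢ.*-identityˡ 1ˢ
sign² (suc k) = ˢ.trans (solve 1 (λ a → (:- a) :* (:- a) := a :* a) (λ _ → refl) (sign k)) (sign² k)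

^ˢ-+ : ∀ x m n → x ^ˢ (m + n) ≋ x ^ˢ m ⊗ x ^ˢ n
^ˢ-+ x zero    n = ˢ.sym (ˢ.*-identityˡ _)
^ˢ-+ x (suc m) n = ˢ.trans (ˢ.*-congˡ (^ˢ-+ x m n)) (ˢ.sym (ˢ.*-assoc _ _ _))

diag : ℕ → (ℕ → ℕ → Series) → Series
diag zero    g = g 0 0
diag (suc n) g = g 0 (suc n) ⊕ diag n (λ k m → g (suc k) m)

diag-cong : ∀ n {g h} → (∀ k m → k + m ≡ n → g k m ≋ h k m) → diag n g ≋ diag n h
diag-cong zero    e = e 0 0 refl
diag-cong (suc n) e = ˢ.+-cong (e 0 (suc n) refl) (diag-cong n λ k m p → e (suc k) m (cong suc p))

diag-last : ∀ n g → diag (suc n) g ≋ diag n (λ k m → g k (suc m)) ⊕ g (suc n) 0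
diag-last zero    g = ˢ.refl
diag-last (suc n) g = ˢ.trans (ˢ.+-congˡ (diag-last n (λ k m → g (suc k) m))) (ˢ.sym (ˢ.+-assoc _ _ _))

diag-⊕ : ∀ n g h → diag n (λ k m → g k m ⊕ h k m) ≋ diag n g ⊕ diag n h
diag-⊕ zero    g h = ˢ.refl
diag-⊕ (suc n) g h = ˢ.trans (ˢ.+-congˡ (diag-⊕ n _ _))
  (solve 4 (λ a b c d → (a :+ b) :+ (c :+ d) := (a :+ c) :+ (b :+ d)) (λ _ → refl) (g 0 (suc n)) (h 0 (suc n)) _ _)

diag-⊗ : ∀ n c g → diag n (λ k m → c ⊗ g k m) ≋ c ⊗ diag n g
diag-⊗ zero    c g = ˢ.refl
diag-⊗ (suc n) c g = ˢ.trans (ˢ.+-congˡ (diag-⊗ n c _)) (ˢ.sym (ˢ.distribˡ c _ _))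

diag-telescope : ∀ n (p : ℕ → Series) → diag n (λ k _ → sign k ⊗ (p k ⊕ p (suc k))) ≋ p 0 ⊕ sign n ⊗ p (suc n)
diag-telescope zero    p = solve 2 (λ a b → con (+ 1) :* (a :+ b) := a :+ con (+ 1) :* b) (λ _ → refl) (p 0) (p 1)
diag-telescope (suc n) p = ˢ.trans (diag-last n (λ k _ → sign k ⊗ (p k ⊕ p (suc k)))) (ˢ.trans (ˢ.+-congʳ (diag-telescope n p))
  (solve 4 (λ a s b c → (a :+ s :* b) :+ (:- s) :* (b :+ c) := a :+ (:- s) :* c) (λ _ → refl) (p 0) (sign n) (p (suc n)) (p (suc (suc n)))))

-- The sum of the q-binomial coefficients [n k] times f k (n - k), by Pascal's rule.
binomialSum : Series → ℕ → (ℕ → ℕ → Series) → Series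
binomialSum t zero    f = f 0 0
binomialSum t (suc n) f = binomialSum t n (λ k m → f k (suc m) ⊕ t ^ˢ m ⊗ f (suc k) m)

qfact : Series → ℕ → Series
qfact t zero    = 1ˢ
qfact t (suc k) = qfact t k ⊗ [ suc k ]⟨ t ⟩

-- The q-Pochhammer symbol (-z; t)_m.
X : Series → Series → ℕ → Series
X z t zero    = 1ˢ
X z t (suc m) = X z t m ⊗ (1ˢ ⊕ z ⊗ t ^ˢ m)

-- D s u t n = (1 - s u tⁿ⁻¹)(1 - s u tⁿ) ⋯ (1 - s u t²ⁿ⁻²)
D : Series → Series → Series → ℕ → Series
D s u t zero    = 1ˢ
D s u t (suc n) = (1ˢ ⊝ s ⊗ u ⊗ t ^ˢ n) ⊗ D (s ⊗ t) (u ⊗ t) t n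

module _ (t : Series) where

  binomialSum-cong : ∀ n {f g} → (∀ k m → k + m ≡ n → f k m ≋ g k m) → binomialSum t n f ≋ binomialSum t n g
  binomialSum-cong zero    e = e 0 0 refl
  binomialSum-cong (suc n) e = binomialSum-cong n λ k m p →
    ˢ.+-cong (e k (suc m) (trans (+-suc k m) (cong suc p))) (ˢ.*-congˡ (e (suc k) m (cong suc p)))

  binomialSum-⊗ : ∀ n c f → binomialSum t n (λ k m → c ⊗ f k m) ≋ c ⊗ binomialSum t n f
  binomialSum-⊗ zero    c f = ˢ.refl
  binomialSum-⊗ (suc n) c f = ˢ.trans (binomialSum-cong n λ k m _ →
    solve 4 (λ c a p b → c :* a :+ p :* (c :* b) := c :* (a :+ p :* b)) (λ _ → refl) c (f k (suc m)) (t ^ˢ m) (f (suc k) m))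
    (binomialSum-⊗ n c _)

  []-+ : ∀ m k → [ m ]⟨ t ⟩ ⊕ t ^ˢ m ⊗ [ k ]⟨ t ⟩ ≋ [ m + k ]⟨ t ⟩
  []-+ zero    k = solve 1 (λ a → con (+ 0) :+ con (+ 1) :* a := a) (λ _ → refl) [ k ]⟨ t ⟩
  []-+ (suc m) k = ˢ.trans (solve 4 (λ t a p b → (con (+ 1) :+ t :* a) :+ (t :* p) :* b := con (+ 1) :+ t :* (a :+ p :* b)) (λ _ → refl) t [ m ]⟨ t ⟩ (t ^ˢ m) [ k ]⟨ t ⟩)
    (ˢ.+-congˡ (ˢ.*-congˡ ([]-+ m k)))

  -- The identity [n k] [k]! [m]! = [n]! under the summation sign and without division. A Pascal
  -- step contributes [m] + tᵐ [k] = [k + m], which is the same for all summands.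
  binomialSum-qfact : ∀ n g → binomialSum t n (λ k m → (qfact t k ⊗ qfact t m) ⊗ g k m) ≋ qfact t n ⊗ diag n g
  binomialSum-qfact zero    g = ˢ.*-congʳ (ˢ.*-identityˡ 1ˢ)
  binomialSum-qfact (suc n) g = begin
    binomialSum t n (λ k m → (qfact t k ⊗ qfact t (suc m)) ⊗ g k (suc m) ⊕ t ^ˢ m ⊗ ((qfact t (suc k) ⊗ qfact t m) ⊗ g (suc k) m))
      ≈⟨ binomialSum-cong n (λ k m _ → solve 7 (λ a b c d x y p →
           (a :* (b :* c)) :* x :+ p :* (((a :* d) :* b) :* y) := (a :* b) :* (c :* x :+ (p :* d) :* y)) (λ _ → refl)
           (qfact t k) (qfact t m) [ suc m ]⟨ t ⟩ [ suc k ]⟨ t ⟩ (g k (suc m)) (g (suc k) m) (t ^ˢ m)) ⟩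
    binomialSum t n (λ k m → (qfact t k ⊗ qfact t m) ⊗ ([ suc m ]⟨ t ⟩ ⊗ g k (suc m) ⊕ t ^ˢ m ⊗ [ suc k ]⟨ t ⟩ ⊗ g (suc k) m))
      ≈⟨ binomialSum-qfact n _ ⟩
    qfact t n ⊗ diag n (λ k m → [ suc m ]⟨ t ⟩ ⊗ g k (suc m) ⊕ t ^ˢ m ⊗ [ suc k ]⟨ t ⟩ ⊗ g (suc k) m)
      ≈⟨ ˢ.*-congˡ (diag-⊕ n _ _) ⟩
    qfact t n ⊗ (diag n (λ k m → [ suc m ]⟨ t ⟩ ⊗ g k (suc m)) ⊕ diag n (λ k m → t ^ˢ m ⊗ [ suc k ]⟨ t ⟩ ⊗ g (suc k) m))
      ≈⟨ ˢ.*-congˡ (ˢ.+-cong (ˢ.sym (ˢ.trans (diag-last n (λ k m → [ m ]⟨ t ⟩ ⊗ g k m)) (absorbʳ _ _)))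
                             (ˢ.sym (absorbˡ _ _ (t ^ˢ suc n)))) ⟩
    qfact t n ⊗ (diag (suc n) (λ k m → [ m ]⟨ t ⟩ ⊗ g k m) ⊕ diag (suc n) (λ k m → t ^ˢ m ⊗ [ k ]⟨ t ⟩ ⊗ g k m))
      ≈⟨ ˢ.*-congˡ (ˢ.sym (diag-⊕ (suc n) (λ k m → [ m ]⟨ t ⟩ ⊗ g k m) (λ k m → t ^ˢ m ⊗ [ k ]⟨ t ⟩ ⊗ g k m))) ⟩
    qfact t n ⊗ diag (suc n) (λ k m → [ m ]⟨ t ⟩ ⊗ g k m ⊕ t ^ˢ m ⊗ [ k ]⟨ t ⟩ ⊗ g k m)
      ≈⟨ ˢ.*-congˡ (ˢ.trans (diag-cong (suc n) λ k m e → ˢ.trans (ˢ.sym (ˢ.distribʳ (g k m) _ _))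
           (ˢ.*-congʳ (ˢ.trans ([]-+ m k) (ˢ.reflexive (cong [_]⟨ t ⟩ (trans (+-comm m k) e)))))) (diag-⊗ (suc n) [ suc n ]⟨ t ⟩ g)) ⟩
    qfact t n ⊗ ([ suc n ]⟨ t ⟩ ⊗ diag (suc n) g)
      ≈⟨ ˢ.sym (ˢ.*-assoc _ _ _) ⟩
    qfact t (suc n) ⊗ diag (suc n) g ∎
    where
    open ≋-Reasoning
    absorbʳ : ∀ a b → a ⊕ 0ˢ ⊗ b ≋ a
    absorbʳ = solve 2 (λ a b → a :+ con (+ 0) :* b := a) (λ _ → refl)
    absorbˡ : ∀ b a p → p ⊗ 0ˢ ⊗ b ⊕ a ≋ a
    absorbˡ = solve 3 (λ b a p → p :* con (+ 0) :* b :+ a := a) (λ _ → refl)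

  ^ˢ-cong : ∀ {x y} n → x ≋ y → x ^ˢ n ≋ y ^ˢ n
  ^ˢ-cong zero    e = ˢ.refl
  ^ˢ-cong (suc n) e = ˢ.*-cong e (^ˢ-cong n e)

  X-cong : ∀ {z w} m → z ≋ w → X z t m ≋ X w t m
  X-cong zero    e = ˢ.refl
  X-cong (suc m) e = ˢ.*-cong (X-cong m e) (ˢ.+-congˡ (ˢ.*-congʳ e))

  X-head : ∀ z m → X z t (suc m) ≋ (1ˢ ⊕ z) ⊗ X (z ⊗ t) t m
  X-head z zero    = solve 1 (λ z → con (+ 1) :* (con (+ 1) :+ z :* con (+ 1)) := (con (+ 1) :+ z) :* con (+ 1)) (λ _ → refl) z
  X-head z (suc m) = ˢ.trans (ˢ.*-congʳ (X-head z m))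
    (solve 4 (λ z t a p → ((con (+ 1) :+ z) :* a) :* (con (+ 1) :+ z :* (t :* p)) := (con (+ 1) :+ z) :* (a :* (con (+ 1) :+ (z :* t) :* p))) (λ _ → refl) z t (X (z ⊗ t) t m) (t ^ˢ m))

  X-+ : ∀ z k m → X z t (k + m) ≋ X z t k ⊗ X (z ⊗ t ^ˢ k) t m
  X-+ z k zero    rewrite +-identityʳ k = ˢ.sym (ˢ.*-identityʳ _)
  X-+ z k (suc m) rewrite +-suc k m = ˢ.trans (ˢ.*-cong (X-+ z k m) (ˢ.+-congˡ (ˢ.trans (ˢ.*-congˡ (^ˢ-+ t k m)) (ˢ.sym (ˢ.*-assoc _ _ _))))) (ˢ.*-assoc _ _ _)

  longestB-shift : ∀ u m → longestB (u ⊗ t) t m ≋ t ^ˢ m ⊗ longestB u t m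
  longestB-shift u zero    = ˢ.sym (ˢ.*-identityˡ _)
  longestB-shift u (suc m) = ˢ.trans (ˢ.*-congˡ (longestB-shift u m))
    (solve 4 (λ u t p l → ((u :* t) :* p :* p) :* (p :* l) := (t :* p) :* ((u :* p :* p) :* l)) (λ _ → refl) u t (t ^ˢ m) (longestB u t m))

  typeB-X : ∀ s k → typeB s t k ≋ X s t k ⊗ qfact t k
  typeB-X s zero    = ˢ.sym (ˢ.*-identityˡ _)
  typeB-X s (suc k) = ˢ.trans (ˢ.*-congʳ (typeB-X s k))
    (solve 4 (λ a b c d → (a :* b) :* (c :* d) := (a :* c) :* (b :* d)) (λ _ → refl) (X s t k) (qfact t k) _ _)

  -- The summand of the alternating sum after multiplication by (-s; t)_n (-u; t)_n with n = k + m: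
  -- the denominators X s t k and X u t m cancel, which leaves the upper parts of both symbols. The
  -- factorials [k]! and [m]! are left to the binomial coefficient.
  term : Series → Series → ℕ → ℕ → Series
  term s u k m = sign k ⊗ longestB u t m ⊗ (X (s ⊗ t ^ˢ k) t m ⊗ X (u ⊗ t ^ˢ m) t k)

  -- The heart of the summation. With p = tᵏ and r = tᵐ, the identity u r² (1 + s p) - r (1 + u r) =
  -- - r (1 - s u p r) makes a Pascal step return the same kind of sum for (s t, u t) and n - 1. The
  -- factor produced depends on k + m only, so it leaves the sum.
  term-step : ∀ s u k m → term s u k (suc m) ⊕ t ^ˢ m ⊗ term s u (suc k) m ≋ ⊖ (1ˢ ⊝ s ⊗ u ⊗ t ^ˢ (k + m)) ⊗ term (s ⊗ t) (u ⊗ t) k m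
  term-step s u k m = begin
    sign k ⊗ longestB u t (suc m) ⊗ (X (s ⊗ t ^ˢ k) t (suc m) ⊗ X (u ⊗ t ^ˢ suc m) t k)
      ⊕ t ^ˢ m ⊗ (⊖ sign k ⊗ longestB u t m ⊗ (X (s ⊗ t ^ˢ suc k) t m ⊗ X (u ⊗ t ^ˢ m) t (suc k)))
      ≈⟨ ˢ.+-cong (ˢ.*-congˡ (ˢ.*-cong (ˢ.trans (X-head _ m) (ˢ.*-congˡ (X-cong m (shift s k)))) (X-cong k (shift′ u m))))
                  (ˢ.*-congˡ (ˢ.*-congˡ (ˢ.*-cong (X-cong m (shift′ s k)) (ˢ.trans (X-head _ k) (ˢ.*-congˡ (X-cong k (shift u m))))))) ⟩
    sign k ⊗ longestB u t (suc m) ⊗ (((1ˢ ⊕ s ⊗ t ^ˢ k) ⊗ Xs) ⊗ Xu)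
      ⊕ t ^ˢ m ⊗ (⊖ sign k ⊗ longestB u t m ⊗ (Xs ⊗ ((1ˢ ⊕ u ⊗ t ^ˢ m) ⊗ Xu)))
      ≈⟨ solve 8 (λ σ u l s p q a b →
           σ :* ((u :* q :* q) :* l) :* (((con (+ 1) :+ s :* p) :* a) :* b) :+ q :* ((:- σ) :* l :* (a :* ((con (+ 1) :+ u :* q) :* b)))
           := (:- (con (+ 1) :- s :* u :* (p :* q))) :* (σ :* (q :* l) :* (a :* b))) (λ _ → refl)
           (sign k) u (longestB u t m) s (t ^ˢ k) (t ^ˢ m) Xs Xu ⟩
    ⊖ (1ˢ ⊝ s ⊗ u ⊗ (t ^ˢ k ⊗ t ^ˢ m)) ⊗ (sign k ⊗ (t ^ˢ m ⊗ longestB u t m) ⊗ (Xs ⊗ Xu))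
      ≈⟨ ˢ.*-cong (ˢ.-‿cong (ˢ.+-congˡ (ˢ.-‿cong (ˢ.*-congˡ (ˢ.sym (^ˢ-+ t k m)))))) (ˢ.*-congʳ (ˢ.*-congˡ (ˢ.sym (longestB-shift u m)))) ⟩
    ⊖ (1ˢ ⊝ s ⊗ u ⊗ t ^ˢ (k + m)) ⊗ term (s ⊗ t) (u ⊗ t) k m ∎
    where
    open ≋-Reasoning
    Xs Xu : Series
    Xs = X ((s ⊗ t) ⊗ t ^ˢ k) t m
    Xu = X ((u ⊗ t) ⊗ t ^ˢ m) t k
    shift : ∀ z k → (z ⊗ t ^ˢ k) ⊗ t ≋ (z ⊗ t) ⊗ t ^ˢ k
    shift z k = solve 3 (λ z t p → (z :* p) :* t := (z :* t) :* p) (λ _ → refl) z t (t ^ˢ k)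
    shift′ : ∀ z k → z ⊗ (t ⊗ t ^ˢ k) ≋ (z ⊗ t) ⊗ t ^ˢ k
    shift′ z k = ˢ.sym (ˢ.*-assoc _ _ _)

  binomialSum-term : ∀ n s u → binomialSum t n (term s u) ≋ sign n ⊗ D s u t n
  binomialSum-term zero    s u = solve 0 (con (+ 1) :* con (+ 1) :* (con (+ 1) :* con (+ 1)) := con (+ 1) :* con (+ 1)) (λ _ → refl)
  binomialSum-term (suc n) s u = begin
    binomialSum t n (λ k m → term s u k (suc m) ⊕ t ^ˢ m ⊗ term s u (suc k) m)
      ≈⟨ binomialSum-cong n (λ k m e → ˢ.trans (term-step s u k m) (ˢ.*-congʳ (ˢ.reflexive (cong (λ i → ⊖ (1ˢ ⊝ s ⊗ u ⊗ t ^ˢ i)) e)))) ⟩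
    binomialSum t n (λ k m → ⊖ (1ˢ ⊝ s ⊗ u ⊗ t ^ˢ n) ⊗ term (s ⊗ t) (u ⊗ t) k m)
      ≈⟨ binomialSum-⊗ n _ _ ⟩
    ⊖ (1ˢ ⊝ s ⊗ u ⊗ t ^ˢ n) ⊗ binomialSum t n (term (s ⊗ t) (u ⊗ t))
      ≈⟨ ˢ.*-congˡ (binomialSum-term n (s ⊗ t) (u ⊗ t)) ⟩
    ⊖ (1ˢ ⊝ s ⊗ u ⊗ t ^ˢ n) ⊗ (sign n ⊗ D (s ⊗ t) (u ⊗ t) t n)
      ≈⟨ solve 3 (λ a σ d → (:- a) :* (σ :* d) := (:- σ) :* (a :* d)) (λ _ → refl) (1ˢ ⊝ s ⊗ u ⊗ t ^ˢ n) (sign n) _ ⟩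
    ⊖ sign n ⊗ ((1ˢ ⊝ s ⊗ u ⊗ t ^ˢ n) ⊗ D (s ⊗ t) (u ⊗ t) t n) ∎
    where open ≋-Reasoning

-- The Poincaré series of type C̃

module _ {Pos : Set} {n : ℕ} where

  private
    ∸-suc : ∀ {i} → i < n → n ∸ i ≡ suc (n ∸ suc i)
    ∸-suc {i} i<n = +-∸-assoc 1 i<n

    ∸-inj : ∀ {i j} → i ≤ n → j ≤ n → n ∸ i ≡ n ∸ j → i ≡ j
    ∸-inj i≤n j≤n e = trans (sym (m∸[m∸n]≡n i≤n)) (trans (cong (n ∸_) e) (m∸[m∸n]≡n j≤n))

  -- Reversal exchanges s and u, so that what is proved for the nodes below k also serves for those
  -- above k.
  mirror : Chain Pos n → Chain Pos n
  mirror C = record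
    { val   = λ x i → val x (n ∸ i)
    ; act   = λ i → act (n ∸ i)
    ; self  = λ i x i≤n → self (n ∸ i) x (m∸n≤m n i)
    ; up₀   = λ x l → trans (cong (λ k → val (act k x) (n ∸ 1)) (∸-suc l)) (trans (downₙ (n ∸ 1) x (sym (∸-suc l))) (cong (λ k → val x (n ∸ 1) ℤ.+ + 2 ℤ.* val x k) (sym (∸-suc l))))
    ; up    = λ i x 1≤i i<n → trans (cong (λ k → val (act k x) (n ∸ suc i)) (∸-suc i<n))
                (trans (down (n ∸ suc i) x (subst (_< n) (∸-suc i<n) (∸-monoʳ-< 1≤i (<⇒≤ i<n)))) (cong (λ k → val x (n ∸ suc i) ℤ.+ val x k) (sym (∸-suc i<n))))
    ; down  = λ i x i<n → trans (cong (val (act (n ∸ suc i) x)) (∸-suc (<⇒≤ i<n)))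
                (trans (up (n ∸ suc i) x (m<n⇒0<n∸m i<n) (∸-monoʳ-< (s≤s z≤n) (<⇒≤ i<n))) (cong (λ k → val x k ℤ.+ val x (n ∸ suc i)) (sym (∸-suc (<⇒≤ i<n)))))
    ; downₙ = last
    ; far   = λ i j x i≤n j≤n i≢j 1+i≢j 1+j≢i → far (n ∸ i) (n ∸ j) x (m∸n≤m n i) (m∸n≤m n j) (λ e → i≢j (∸-inj i≤n j≤n e))
                (λ e → 1+j≢i (apart j≤n i≤n e)) (λ e → 1+i≢j (apart i≤n j≤n e))
    }
    where
    open Chain C
    last : ∀ i x → suc i ≡ n → val (act (n ∸ suc i) x) (n ∸ i) ≡ val x (n ∸ i) ℤ.+ + 2 ℤ.* val x (n ∸ suc i)
    last i x refl rewrite n∸n≡0 i | m+n∸n≡m 1 i = up₀ x (s≤s z≤n)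
    apart : ∀ {i j} → i ≤ n → j ≤ n → suc (n ∸ j) ≡ n ∸ i → suc i ≡ j
    apart {i} {j} i≤n j≤n e = ∸-inj i<n j≤n (suc-injective (trans (sym (∸-suc i<n)) (sym e)))
      where i<n : i < n
            i<n = ≤∧≢⇒< i≤n λ { refl → 1+n≢0 (trans e (n∸n≡0 i)) }

  mirror-count : ∀ {C s t u} → Count C s t u → Count (mirror C) u t s
  mirror-count {C} {s} {t} {u} G = record
    { gf      = gf
    ; gf-cong = λ P Q f g → gf-cong P Q (λ x r → f x (mirrored r)) (λ x r → g x (mirrored r))
    ; split   = split
    ; fire₀   = fireₙ
    ; fire    = λ i P 1≤i i<n → fire (n ∸ i) P (m<n⇒0<n∸m i<n) (∸-monoʳ-< 1≤i (<⇒≤ i<n))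
    ; fireₙ   = subst (λ k → ∀ P → (∀ x → holds P x → holds (neg C k) x) → gf P ≋ s ⊗ gf (P ∙ Chain.act C k)) (sym (n∸n≡0 n)) fire₀
    ; gf-asc  = ˢ.trans (gf-cong (asc< (mirror C) (suc n)) (asc< C (suc n)) (λ x _ h {a} → unmirrored {+ 0 ℤ.≤_} x h {a}) (λ x _ h {a} l → h (s≤s (m∸n≤m n a)))) gf-asc
    ; gf-desc = ˢ.trans (gf-cong (desc< (mirror C) (suc n)) (desc< C (suc n)) (λ x _ h {a} → unmirrored {ℤ._< + 0} x h {a}) (λ x _ h {a} l → h (s≤s (m∸n≤m n a)))) gf-desc
    }
    where
    open Count G
    mirrored : ∀ {x} → Chain.Regular C x → Chain.Regular (mirror C) x
    mirrored r i i≤n = r (n ∸ i) (m∸n≤m n i)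
    unmirrored : ∀ {R : ℤ → Set} x → (∀ {a} → a < suc n → ⊤ → R (Chain.val C x (n ∸ a))) → ∀ {a} → a < suc n → ⊤ → R (Chain.val C x a)
    unmirrored {R} x h {a} l _ = subst (λ k → R (Chain.val C x k)) (m∸[m∸n]≡n (≤-pred l)) (h (s≤s (m∸n≤m n a)) tt)

-- The alternating sum over k of the elements ascending below k and descending above k telescopes;
-- each summand is a monomial multiple of the quotient by the parabolic subgroup omitting node k.
module Total {Pos n s t u} {C : Chain Pos n} (G : Count C s t u) where
  open Chain C
  open Count G
  open Coordinates C using (far<)

  below-above : ℕ → DecPred Pos
  below-above k = asc< C k ∩ descOn C (suc n) (k ℕ.<?_)

  -- Its generating function is the P k of the overview.
  below-from : ℕ → DecPred Pos
  below-from k = asc< C k ∩ descOn C (suc n) (k ℕ.≤?_)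

  gf-below-above : ∀ k → k ≤ n → gf (below-above k) ≋ gf (below-from k) ⊕ gf (below-from (suc k))
  gf-below-above k k≤n = ˢ.trans (split _ (neg C k)) (ˢ.+-cong
    (gf-cong _ _ (λ { x _ ((p , q) , v<0) → p , λ {a} l k≤a → from x q v<0 l k≤a })
                 (λ { x _ (p , q) → (p , λ {a} l k<a → q l (<⇒≤ k<a)) , q (s≤s k≤n) ≤-refl }))
    (gf-cong _ _ (λ { x _ ((p , q) , v≮0) → (λ {a} l _ → upto x p v≮0 l) , q })
                 (λ { x _ (p , q) → ((λ {a} l _ → p (m<n⇒m<1+n l) tt) , q) , ℤ.≤⇒≯ (p ≤-refl tt) })))
    where
    from : ∀ x → (∀ {a} → a < suc n → k < a → val x a ℤ.< + 0) → val x k ℤ.< + 0 → ∀ {a} → a < suc n → k ≤ a → val x a ℤ.< + 0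
    from x q v<0 {a} l k≤a with k ℕ.≟ a
    ... | yes refl = v<0
    ... | no k≢a   = q l (≤∧≢⇒< k≤a k≢a)
    upto : ∀ x → (∀ {a} → a < k → ⊤ → + 0 ℤ.≤ val x a) → ¬ (val x k ℤ.< + 0) → ∀ {a} → a < suc k → + 0 ℤ.≤ val x a
    upto x p v≮0 {a} l with a ℕ.≟ k
    ... | yes refl = ℤ.≮⇒≥ v≮0
    ... | no a≢k   = p (≤∧≢⇒< (≤-pred l) a≢k) tt

  gf-below-from-0 : gf (below-from 0) ≋ 0ˢ
  gf-below-from-0 = ˢ.trans (gf-cong _ _ (λ { x _ (_ , q) l _ → q l z≤n }) (λ { x _ q → (λ ()) , λ {a} l _ → q l tt })) gf-desc

  gf-below-from-all : gf (below-from (suc n)) ≋ 1ˢ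
  gf-below-from-all = ˢ.trans (gf-cong _ _ (λ { x _ (p , _) → p }) (λ { x _ p → p , λ {a} l n<a → ⊥-elim (<⇒≱ n<a (≤-pred l)) })) gf-asc

  alternating : diag n (λ k _ → sign k ⊗ gf (below-above k)) ≋ sign n
  alternating = begin
    diag n (λ k _ → sign k ⊗ gf (below-above k))
      ≈⟨ diag-cong n (λ k m e → ˢ.*-congˡ (gf-below-above k (m+n≤o⇒m≤o k (≤-reflexive e)))) ⟩
    diag n (λ k _ → sign k ⊗ (gf (below-from k) ⊕ gf (below-from (suc k))))
      ≈⟨ diag-telescope n (λ k → gf (below-from k)) ⟩
    gf (below-from 0) ⊕ sign n ⊗ gf (below-from (suc n))
      ≈⟨ ˢ.+-cong gf-below-from-0 (ˢ.*-congˡ gf-below-from-all) ⟩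
    0ˢ ⊕ sign n ⊗ 1ˢ
      ≈⟨ solve 1 (λ a → con (+ 0) :+ a :* con (+ 1) := a) (λ _ → refl) (sign n) ⟩
    sign n ∎
    where open ≋-Reasoning

  module ↑ = Lower (mirror-count G)
  module ↓ = Lower G

  -- The longest element of the upper subgroup turns the descents above k into ascents. What remains
  -- ascends at every node but k, and such positions represent the cosets of the product of the two
  -- parabolic subgroups. The condition below k is stable under the upper nodes, which have no
  -- neighbour below k.
  gf-parabolic : ∀ k m → k + m ≡ n → (typeB s t k ⊗ typeB u t m) ⊗ gf (below-above k) ≋ longestB u t m ⊗ gf full
  gf-parabolic k m e = begin
    (typeB s t k ⊗ typeB u t m) ⊗ gf (below-above k)
      ≈⟨ ˢ.*-congˡ (gf-cong _ _ (λ { x _ (p , q) → (λ {a} l _ → q (s≤s (m∸n≤m n a)) (k<n∸ l)) , p })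
                                (λ { x _ (q , p) → p , λ {a} l k<a → above x q l k<a })) ⟩
    (typeB s t k ⊗ typeB u t m) ⊗ gf (desc< (mirror C) m ∩ asc< C k)
      ≈⟨ ˢ.*-congˡ (↑.gf-desc< m m≤n (asc< C k) stable) ⟩
    (typeB s t k ⊗ typeB u t m) ⊗ (longestB u t m ⊗ Y)
      ≈⟨ solve 4 (λ a b l y → (a :* b) :* (l :* y) := l :* (a :* (b :* y))) (λ _ → refl) (typeB s t k) (typeB u t m) (longestB u t m) Y ⟩
    longestB u t m ⊗ (typeB s t k ⊗ (typeB u t m ⊗ Y))
      ≈⟨ ˢ.*-congˡ (ˢ.*-congˡ (ˢ.sym (↑.gf-asc< m m≤n (asc< C k) stable))) ⟩
    longestB u t m ⊗ (typeB s t k ⊗ gf (asc< C k))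
      ≈⟨ ˢ.*-congˡ (ˢ.*-congˡ (gf-cong _ _ (λ _ _ p → p , tt) (λ _ _ → proj₁))) ⟩
    longestB u t m ⊗ (typeB s t k ⊗ gf (asc< C k ∩ full))
      ≈⟨ ˢ.*-congˡ (ˢ.sym (↓.gf-asc< k k≤n full (record { push = λ _ _ _ _ → tt ; pull = λ _ _ _ _ → tt }))) ⟩
    longestB u t m ⊗ gf full ∎
    where
    open ≋-Reasoning
    k≤n : k ≤ n
    k≤n = m+n≤o⇒m≤o k (≤-reflexive e)
    m≤n : m ≤ n
    m≤n = m+n≤o⇒n≤o k (≤-reflexive e)
    n∸m : n ∸ m ≡ k
    n∸m = trans (cong (_∸ m) (sym e)) (m+n∸n≡m k m)
    k<n∸ : ∀ {i} → i < m → k < n ∸ i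
    k<n∸ {i} l = subst (_< n ∸ i) n∸m (∸-monoʳ-< l m≤n)
    Y : Series
    Y = gf (asc< (mirror C) m ∩ asc< C k)
    above : ∀ x → (∀ {a} → a < m → ⊤ → val x (n ∸ a) ℤ.< + 0) → ∀ {a} → a < suc n → k < a → val x a ℤ.< + 0
    above x q {a} l k<a = subst (λ j → val x j ℤ.< + 0) (m∸[m∸n]≡n (≤-pred l)) (q n∸a<m tt)
      where n∸a<m : n ∸ a < m
            n∸a<m = subst (n ∸ a <_) (trans (cong (_∸ k) (sym e)) (m+n∸m≡n k m)) (∸-monoʳ-< k<a (≤-pred l))
    stable : ↑.Stable m (asc< C k)
    stable = record
      { push = λ i x l h {a} a<k _ → subst (+ 0 ℤ.≤_) (sym (same i x l a<k)) (h a<k tt)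
      ; pull = λ i x l h {a} a<k _ → subst (+ 0 ℤ.≤_) (same i x l a<k) (h a<k tt) }
      where
      same : ∀ i x → i < m → ∀ {a} → a < k → val (act (n ∸ i) x) a ≡ val x a
      same i x l a<k = far< (n ∸ i) _ x (m∸n≤m n i) (≤-trans (<⇒≤ a<k) k≤n) (≤-<-trans a<k (k<n∸ l))

  -- Multiplied by [n]! (-s; t)_n (-u; t)_n, each summand of `alternating` becomes `gf full` times
  -- `term` with its binomial coefficient, and `binomialSum-term` evaluates the sum. The two signs,
  -- from `alternating` and from the summation, multiply to 1.
  total : gf full ⊗ D s u t n ≋ qfact t n ⊗ (X s t n ⊗ X u t n)
  total = begin
    gf full ⊗ D s u t n
      ≈⟨ ˢ.sym (ˢ.*-identityˡ _) ⟩
    1ˢ ⊗ (gf full ⊗ D s u t n)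
      ≈⟨ ˢ.*-congʳ (ˢ.sym (sign² n)) ⟩
    sign n ⊗ sign n ⊗ (gf full ⊗ D s u t n)
      ≈⟨ solve 3 (λ σ g d → σ :* σ :* (g :* d) := σ :* (g :* (σ :* d))) (λ _ → refl) (sign n) (gf full) (D s u t n) ⟩
    sign n ⊗ (gf full ⊗ (sign n ⊗ D s u t n))
      ≈⟨ ˢ.*-congˡ (ˢ.*-congˡ (ˢ.sym (binomialSum-term t n s u))) ⟩
    sign n ⊗ (gf full ⊗ binomialSum t n (term t s u))
      ≈⟨ ˢ.*-congˡ (ˢ.sym (binomialSum-⊗ t n (gf full) (term t s u))) ⟩
    sign n ⊗ binomialSum t n (λ k m → gf full ⊗ term t s u k m)
      ≈⟨ ˢ.*-congˡ (binomialSum-cong t n (λ k m e → ˢ.sym (scaled k m e))) ⟩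
    sign n ⊗ binomialSum t n (λ k m → (qfact t k ⊗ qfact t m) ⊗ (Xs⊗Xu ⊗ (sign k ⊗ gf (below-above k))))
      ≈⟨ ˢ.*-congˡ (binomialSum-qfact t n _) ⟩
    sign n ⊗ (qfact t n ⊗ diag n (λ k _ → Xs⊗Xu ⊗ (sign k ⊗ gf (below-above k))))
      ≈⟨ ˢ.*-congˡ (ˢ.*-congˡ (ˢ.trans (diag-⊗ n Xs⊗Xu (λ k _ → sign k ⊗ gf (below-above k))) (ˢ.*-congˡ alternating))) ⟩
    sign n ⊗ (qfact t n ⊗ (Xs⊗Xu ⊗ sign n))
      ≈⟨ solve 3 (λ σ f x → σ :* (f :* (x :* σ)) := σ :* σ :* (f :* x)) (λ _ → refl) (sign n) (qfact t n) Xs⊗Xu ⟩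
    sign n ⊗ sign n ⊗ (qfact t n ⊗ Xs⊗Xu)
      ≈⟨ ˢ.trans (ˢ.*-congʳ (sign² n)) (ˢ.*-identityˡ _) ⟩
    qfact t n ⊗ Xs⊗Xu ∎
    where
    open ≋-Reasoning
    Xs⊗Xu : Series
    Xs⊗Xu = X s t n ⊗ X u t n
    scaled : ∀ k m → k + m ≡ n → (qfact t k ⊗ qfact t m) ⊗ (Xs⊗Xu ⊗ (sign k ⊗ gf (below-above k))) ≋ gf full ⊗ term t s u k m
    scaled k m e = begin
      (qfact t k ⊗ qfact t m) ⊗ (Xs⊗Xu ⊗ (sign k ⊗ gf (below-above k)))
        ≈⟨ ˢ.*-congˡ (ˢ.*-congʳ (ˢ.*-cong (ˢ.trans (ˢ.reflexive (cong (X s t) (sym e))) (X-+ t s k m))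
                                           (ˢ.trans (ˢ.reflexive (cong (X u t) (sym (trans (+-comm m k) e)))) (X-+ t u m k)))) ⟩
      (qfact t k ⊗ qfact t m) ⊗ (((X s t k ⊗ X′) ⊗ (X u t m ⊗ X″)) ⊗ (sign k ⊗ gf (below-above k)))
        ≈⟨ solve 8 (λ a b x x′ y y″ σ g → (a :* b) :* (((x :* x′) :* (y :* y″)) :* (σ :* g)) := (((x :* a) :* (y :* b)) :* g) :* (σ :* (x′ :* y″))) (λ _ → refl)
             (qfact t k) (qfact t m) (X s t k) X′ (X u t m) X″ (sign k) (gf (below-above k)) ⟩
      (((X s t k ⊗ qfact t k) ⊗ (X u t m ⊗ qfact t m)) ⊗ gf (below-above k)) ⊗ (sign k ⊗ (X′ ⊗ X″))
        ≈⟨ ˢ.*-congʳ (ˢ.trans (ˢ.*-congʳ (ˢ.*-cong (ˢ.sym (typeB-X t s k)) (ˢ.sym (typeB-X t u m)))) (gf-parabolic k m e)) ⟩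
      (longestB u t m ⊗ gf full) ⊗ (sign k ⊗ (X′ ⊗ X″))
        ≈⟨ solve 4 (λ l g σ x → (l :* g) :* (σ :* x) := g :* (σ :* l :* x)) (λ _ → refl) (longestB u t m) (gf full) (sign k) (X′ ⊗ X″) ⟩
      gf full ⊗ term t s u k m ∎
      where
      X′ X″ : Series
      X′ = X (s ⊗ t ^ˢ k) t m
      X″ = X (u ⊗ t ^ˢ m) t k

-- Coxeter groups and the numbers game

∷-cong : ∀ {k} {M : CoxMatrix k} i {u v} → M ⊢ u ≈ v → M ⊢ (i ∷ u) ≈ (i ∷ v)
∷-cong i (≈-step u v r)  = ≈-step (i ∷ u) v r
∷-cong i ≈-refl          = ≈-refl
∷-cong i (≈-sym p)       = ≈-sym (∷-cong i p)
∷-cong i (≈-trans p q)   = ≈-trans (∷-cong i p) (∷-cong i q)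

++-congˡ : ∀ {k} {M : CoxMatrix k} w {u v} → M ⊢ u ≈ v → M ⊢ (w ++ u) ≈ (w ++ v)
++-congˡ []      p = p
++-congˡ (i ∷ w) p = ∷-cong i (++-congˡ w p)

data Rank2 (m : ℕ) (a b : ℤ) : Set where
  order2  : m ≡ 2 → a ≡ + 0 → b ≡ + 0 → Rank2 m a b
  order3  : m ≡ 3 → a ≡ + 1 → b ≡ + 1 → Rank2 m a b
  order4  : m ≡ 4 → a ≡ + 1 → b ≡ + 2 → Rank2 m a b
  order4′ : m ≡ 4 → a ≡ + 2 → b ≡ + 1 → Rank2 m a b

-- Mozes's numbers game: firing node i of a position x adds A i j * val x i to the value at j.
record GameData {k} (M : CoxMatrix k) (X : Set) : Set₁ where
  field
    A       : Fin k → Fin k → ℤ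
    A-diag  : ∀ i → A i i ≡ -[1+ 1 ]
    M-diag  : ∀ i → M i i ≡ 1
    M-sym   : ∀ i j → M i j ≡ M j i
    rank2   : ∀ i j → i ≢ j → Rank2 (M i j) (A i j) (A j i)
    wt      : Fin k → ℕ
    wt-pos  : ∀ i → 1 ≤ wt i
    -- Generators joined by an odd bond are conjugate; equal weights make both sides of their braid
    -- relation weigh the same.
    wt-odd  : ∀ i j → M i j ≡ 3 → wt i ≡ wt j
    val     : X → Fin k → ℤ
    val-inj : ∀ x y → (∀ j → val x j ≡ val y j) → x ≡ y
    act     : Fin k → X → X
    val-act : ∀ i x j → val (act i x) j ≡ val x j ℤ.+ A i j ℤ.* val x i
    -- Any positive vector may serve; the game on D̃ will start from the unfolded base of B̃.
    base     : X
    base-pos : ∀ i → + 0 ℤ.< val base i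

module Play {k} {M : CoxMatrix k} {X : Set} (D : GameData M X) where
  open GameData D

  Neg : Fin k → X → Set
  Neg i x = val x i ℤ.< + 0

  wtʷ : Word k → ℕ
  wtʷ u = sum (map wt u)

  pos : Word k → X
  pos []      = base
  pos (i ∷ u) = act i (pos u)

  play : Word k → X → X
  play []      x = x
  play (i ∷ u) x = play u (act i x)

  data Descends : Word k → X → Set where
    []  : ∀ {x} → Descends [] x
    _∷_ : ∀ {i u x} → Neg i x → Descends u (act i x) → Descends (i ∷ u) x

  -- A play through negative entries down to the base. Read as a word, `u` is then a reduced
  -- expression of the element whose position is `x`.
  record Reduced (u : Word k) (x : X) : Set where
    constructor _!_
    field
      descends : Descends u x
      ends     : play u x ≡ base

  val-act-self : ∀ i x → val (act i x) i ≡ ℤ.- val x i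
  val-act-self i x rewrite val-act i x i | A-diag i = lem (val x i)
    where lem : ∀ p → p ℤ.+ -[1+ 1 ] ℤ.* p ≡ ℤ.- p
          lem = ℤ-Solver.solve-∀

  act-invol : ∀ i x → act i (act i x) ≡ x
  act-invol i x = val-inj _ _ λ j → trans (val-act i (act i x) j)
      (trans (cong₂ (λ p q → p ℤ.+ A i j ℤ.* q) (val-act i x j) (val-act-self i x)) (lem (val x j) (A i j) (val x i)))
    where lem : ∀ v a p → (v ℤ.+ a ℤ.* p) ℤ.+ a ℤ.* (ℤ.- p) ≡ v
          lem = ℤ-Solver.solve-∀

  braid₂ : ∀ i j → A i j ≡ + 0 → A j i ≡ + 0 → ∀ x → play (alt i j 2) x ≡ play (alt j i 2) x
  braid₂ i j a b x = val-inj _ _ go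
    where
    lem : ∀ v α β p q → (v ℤ.+ α ℤ.* p) ℤ.+ β ℤ.* (q ℤ.+ + 0 ℤ.* p) ≡ (v ℤ.+ β ℤ.* q) ℤ.+ α ℤ.* (p ℤ.+ + 0 ℤ.* q)
    lem = ℤ-Solver.solve-∀
    go : ∀ l → val (act j (act i x)) l ≡ val (act i (act j x)) l
    go l rewrite val-act j (act i x) l | val-act i (act j x) l
               | val-act i x l | val-act j x l | val-act i x j | val-act j x i | a | b = lem (val x l) (A i l) (A j l) (val x i) (val x j)

  val-iji : ∀ i j (a : A i j ≡ + 1) (b : A j i ≡ + 1) x → val (act j (act i x)) i ≡ val x j
  val-iji i j a b x rewrite val-act j (act i x) i | val-act-self i x | val-act i x j | a | b = lem (val x i) (val x j)
    where lem : ∀ p q → ℤ.- p ℤ.+ + 1 ℤ.* (q ℤ.+ + 1 ℤ.* p) ≡ q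
          lem = ℤ-Solver.solve-∀

  braid₃ : ∀ i j → A i j ≡ + 1 → A j i ≡ + 1 → ∀ x → play (alt i j 3) x ≡ play (alt j i 3) x
  braid₃ i j a b x = val-inj _ _ go
    where
    lem : ∀ v α β p q → ((v ℤ.+ α ℤ.* p) ℤ.+ β ℤ.* (q ℤ.+ + 1 ℤ.* p)) ℤ.+ α ℤ.* q ≡ ((v ℤ.+ β ℤ.* q) ℤ.+ α ℤ.* (p ℤ.+ + 1 ℤ.* q)) ℤ.+ β ℤ.* p
    lem = ℤ-Solver.solve-∀
    go : ∀ l → val (act i (act j (act i x))) l ≡ val (act j (act i (act j x))) l
    go l rewrite val-act i (act j (act i x)) l | val-act j (act i (act j x)) l
               | val-iji i j a b x | val-iji j i b a x
               | val-act j (act i x) l | val-act i (act j x) l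
               | val-act i x l | val-act j x l | val-act i x j | val-act j x i | a | b = lem (val x l) (A i l) (A j l) (val x i) (val x j)

  val-ij₄ : ∀ i j (b : A i j ℤ.* A j i ≡ + 2) x → val (act j (act i x)) i ≡ val x i ℤ.+ A j i ℤ.* val x j
  val-ij₄ i j ab x rewrite val-act j (act i x) i | val-act-self i x | val-act i x j =
      trans (lem (val x i) (val x j) (A i j) (A j i)) (trans (cong (λ c → ℤ.- val x i ℤ.+ A j i ℤ.* val x j ℤ.+ c ℤ.* val x i) ab) (lem′ (val x i) (A j i ℤ.* val x j)))
    where lem : ∀ p q a b → ℤ.- p ℤ.+ b ℤ.* (q ℤ.+ a ℤ.* p) ≡ ℤ.- p ℤ.+ b ℤ.* q ℤ.+ a ℤ.* b ℤ.* p
          lem = ℤ-Solver.solve-∀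
          lem′ : ∀ p r → ℤ.- p ℤ.+ r ℤ.+ + 2 ℤ.* p ≡ p ℤ.+ r
          lem′ = ℤ-Solver.solve-∀

  val-iji₄ : ∀ i j (b : A i j ℤ.* A j i ≡ + 2) x → val (act i (act j (act i x))) j ≡ val x j
  val-iji₄ i j ab x rewrite val-act i (act j (act i x)) j | val-act-self j (act i x) | val-ij₄ i j ab x | val-act i x j =
      trans (lem (val x i) (val x j) (A i j) (A j i)) (trans (cong (λ c → ℤ.- val x j ℤ.+ c ℤ.* val x j) ab) (lem′ (val x j)))
    where lem : ∀ p q a b → ℤ.- (q ℤ.+ a ℤ.* p) ℤ.+ a ℤ.* (p ℤ.+ b ℤ.* q) ≡ ℤ.- q ℤ.+ a ℤ.* b ℤ.* q
          lem = ℤ-Solver.solve-∀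
          lem′ : ∀ q → ℤ.- q ℤ.+ + 2 ℤ.* q ≡ q
          lem′ = ℤ-Solver.solve-∀

  braid₄ : ∀ i j → A i j ℤ.* A j i ≡ + 2 → ∀ x → play (alt i j 4) x ≡ play (alt j i 4) x
  braid₄ i j ab x = val-inj _ _ go
    where
    ba : A j i ℤ.* A i j ≡ + 2
    ba = trans (ℤ.*-comm (A j i) (A i j)) ab
    lem : ∀ v α β p q a b →
      (((v ℤ.+ α ℤ.* p) ℤ.+ β ℤ.* (q ℤ.+ a ℤ.* p)) ℤ.+ α ℤ.* (p ℤ.+ b ℤ.* q)) ℤ.+ β ℤ.* q ≡
      (((v ℤ.+ β ℤ.* q) ℤ.+ α ℤ.* (p ℤ.+ b ℤ.* q)) ℤ.+ β ℤ.* (q ℤ.+ a ℤ.* p)) ℤ.+ α ℤ.* p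
    lem = ℤ-Solver.solve-∀
    go : ∀ l → val (act j (act i (act j (act i x)))) l ≡ val (act i (act j (act i (act j x)))) l
    go l rewrite val-act j (act i (act j (act i x))) l | val-act i (act j (act i (act j x))) l
               | val-iji₄ i j ab x | val-iji₄ j i ba x
               | val-act i (act j (act i x)) l | val-act j (act i (act j x)) l
               | val-ij₄ i j ab x | val-ij₄ j i ba x
               | val-act j (act i x) l | val-act i (act j x) l
               | val-act i x l | val-act j x l | val-act i x j | val-act j x i = lem (val x l) (A i l) (A j l) (val x i) (val x j) (A i j) (A j i)

  braid-play : ∀ i j x → play (alt i j (M i j)) x ≡ play (alt j i (M i j)) x
  braid-play i j x with i Fin.≟ j
  ... | yes refl = refl
  ... | no i≢j with rank2 i j i≢j
  ... | order2  m a b rewrite m = braid₂ i j a b x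
  ... | order3  m a b rewrite m = braid₃ i j a b x
  ... | order4  m a b rewrite m = braid₄ i j (cong₂ ℤ._*_ a b) x
  ... | order4′ m a b rewrite m = braid₄ i j (cong₂ ℤ._*_ a b) x

  private
    neg+* : ∀ {p q a} n → a ≡ + n → p ℤ.< + 0 → q ℤ.< + 0 → p ℤ.+ a ℤ.* q ℤ.< + 0
    neg+* {p} {q} n refl p< q< = ℤ.+-mono-<-≤ p< (ℤ.≤-trans (ℤ.*-monoˡ-≤-nonNeg (+ n) (ℤ.<⇒≤ q<)) (ℤ.≤-reflexive (ℤ.*-zeroʳ (+ n))))

  descends-alt₄ : ∀ i j m n → A i j ≡ + m → A j i ≡ + n → A i j ℤ.* A j i ≡ + 2 →
    ∀ x → Neg i x → Neg j x → Descends (alt i j 4) x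
  descends-alt₄ i j m n a b ab x p q =
    p ∷ subst (ℤ._< + 0) (sym (val-act i x j)) (neg+* m a q p)
      ∷ subst (ℤ._< + 0) (sym (val-ij₄ i j ab x)) (neg+* n b p q)
      ∷ subst (ℤ._< + 0) (sym (val-iji₄ i j ab x)) q ∷ []

  -- Every entry met on the way is a combination of the two negative entries with nonnegative
  -- coefficients, not both zero.
  descends-alt : ∀ i j → i ≢ j → ∀ x → Neg i x → Neg j x → Descends (alt i j (M i j)) x
  descends-alt i j i≢j x p q with rank2 i j i≢j
  ... | order2  m a b rewrite m = p ∷ subst (ℤ._< + 0) (sym (val-act i x j)) (neg+* 0 a q p) ∷ []
  ... | order3  m a b rewrite m = p ∷ subst (ℤ._< + 0) (sym (val-act i x j)) (neg+* 1 a q p)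
                                    ∷ subst (ℤ._< + 0) (sym (val-iji i j a b x)) q ∷ []
  ... | order4  m a b rewrite m = descends-alt₄ i j 1 2 a b (cong₂ ℤ._*_ a b) x p q
  ... | order4′ m a b rewrite m = descends-alt₄ i j 2 1 a b (cong₂ ℤ._*_ a b) x p q

  wtʷ-alt : ∀ i j → i ≢ j → wtʷ (alt i j (M i j)) ≡ wtʷ (alt j i (M i j))
  wtʷ-alt i j i≢j with rank2 i j i≢j
  ... | order2  m _ _ rewrite m = lem (wt i) (wt j)
    where lem : ∀ a b → a + (b + 0) ≡ b + (a + 0)
          lem a b rewrite +-identityʳ a | +-identityʳ b = +-comm a b
  ... | order3  m _ _ rewrite m | wt-odd i j m = refl
  ... | order4  m _ _ rewrite m = lem (wt i) (wt j)
    where lem : ∀ a b → a + (b + (a + (b + 0))) ≡ b + (a + (b + (a + 0)))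
          lem a b rewrite +-identityʳ a | +-identityʳ b | sym (+-assoc a b (a + b)) | sym (+-assoc b a (b + a)) | +-comm a b = refl
  ... | order4′ m _ _ rewrite m = lem (wt i) (wt j)
    where lem : ∀ a b → a + (b + (a + (b + 0))) ≡ b + (a + (b + (a + 0)))
          lem a b rewrite +-identityʳ a | +-identityʳ b | sym (+-assoc a b (a + b)) | sym (+-assoc b a (b + a)) | +-comm a b = refl

  length-alt : ∀ (i j : Fin k) m → length (alt i j m) ≡ m
  length-alt i j zero    = refl
  length-alt i j (suc m) = cong suc (length-alt j i m)

  M≢0 : ∀ i j → i ≢ j → ∃ λ m → M i j ≡ suc m
  M≢0 i j i≢j with rank2 i j i≢j
  ... | order2  m _ _ = _ , m
  ... | order3  m _ _ = _ , m
  ... | order4  m _ _ = _ , m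
  ... | order4′ m _ _ = _ , m

  wtʷ-++ : ∀ u v → wtʷ (u ++ v) ≡ wtʷ u + wtʷ v
  wtʷ-++ []      v = refl
  wtʷ-++ (i ∷ u) v = trans (cong (_+_ (wt i)) (wtʷ-++ u v)) (sym (+-assoc (wt i) (wtʷ u) (wtʷ v)))

  reduced-++ : ∀ p {u x} → Descends p x → Reduced u (play p x) → Reduced (p ++ u) x
  reduced-++ []      []      r = r
  reduced-++ (i ∷ p) (n ∷ d) r with reduced-++ p d r
  ... | d′ ! e = (n ∷ d′) ! e

  record StartingWith (p u : Word k) (x : X) : Set where
    constructor starting
    field
      rest    : Word k
      reduced : Reduced rest (play p x)
      equiv   : M ⊢ u ≈ (p ++ rest)
      weight  : wtʷ u ≡ wtʷ (p ++ rest)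
      len     : length u ≡ length (p ++ rest)

  -- If i and j both descend then the play may go through either side of their dihedral orbit,
  -- so any descent can be made the first move without changing the weight.
  exchange : ∀ n u {x} → length u ≤ n → Reduced u x → ∀ j → Neg j x → StartingWith (j ∷ []) u x
  follow : ∀ n u {x} → length u ≤ n → Reduced u x → ∀ p → Descends p x → StartingWith p u x

  follow n u l r [] [] = starting u r ≈-refl refl refl
  follow n u l r (j ∷ p) (nj ∷ d) with exchange n u l r j nj
  ... | starting u₁ r₁ e₁ w₁ l₁ with follow n u₁ (≤-trans (n≤1+n _) (subst (_≤ n) l₁ l)) r₁ p d
  ... | starting u₂ r₂ e₂ w₂ l₂ =
    starting u₂ r₂ (≈-trans e₁ (∷-cong j e₂)) (trans w₁ (cong (_+_ (wt j)) w₂)) (trans l₁ (cong suc l₂))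

  exchange n [] l (_ ! refl) j nj = ⊥-elim (ℤ.<-asym (base-pos j) nj)
  exchange (suc n) (i ∷ u) {x} (s≤s l) ((ni ∷ d) ! e) j nj with i Fin.≟ j
  ... | yes refl = starting u (d ! e) ≈-refl refl refl
  ... | no i≢j with M≢0 i j i≢j
  ... | m , M≡ with descends-alt i j i≢j x ni nj
                  | descends-alt j i (λ q → i≢j (sym q)) x nj ni
                  | braid-play i j x | wtʷ-alt i j i≢j | CoxRel.braid {M = M} i j
  ... | dᵢ | dⱼ | same | same-wt | rel rewrite M-sym j i | M≡ with dᵢ | dⱼ
  -- The rest of the i side of the dihedral orbit is `alt j i m`. The play `u` is shorter, so by
  -- induction it can be rerouted along that side; by `braid-play` the side starting with j ends at
  -- the same position, from which `u₁` finishes both.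
  ... | _ ∷ dᵢ′ | _ ∷ dⱼ′ with follow n u l (d ! e) (alt j i m) dᵢ′
  ... | starting u₁ r₁ e₁ w₁ l₁ =
    starting (alt i j m ++ u₁) (reduced-++ (alt i j m) dⱼ′ (subst (Reduced u₁) same r₁))
      (≈-trans (∷-cong i e₁) (≈-step [] u₁ rel))
      (trans (cong (_+_ (wt i)) w₁) (trans (sym (lem (alt i j (suc m)))) (trans (cong (λ w → w + wtʷ u₁) same-wt) (lem (alt j i (suc m))))))
      (trans (cong suc l₁) (cong suc (trans (List.length-++ (alt j i m)) (trans (cong (λ w → w + length u₁) (trans (length-alt j i m) (sym (length-alt i j m)))) (sym (List.length-++ (alt i j m)))))))
    where lem : ∀ p → wtʷ p + wtʷ u₁ ≡ wtʷ (p ++ u₁)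
          lem p = sym (wtʷ-++ p u₁)

  -- A zero would travel to the base. If the play starts with j, then after j, j i or j i j, for
  -- order 2, 3 or 4, there is again a zero at i or j, and by `follow` the remaining play is
  -- shorter. The base has no zero.
  val≢0 : ∀ n u {x} → length u ≤ n → Reduced u x → ∀ i → val x i ≢ + 0
  val≢0 n [] l (_ ! refl) i z = ℤ.<-irrefl (sym z) (base-pos i)
  val≢0 (suc n) (j ∷ u) {x} (s≤s l) r@((nj ∷ _) ! _) i z with j Fin.≟ i
  ... | yes refl = ℤ.<-irrefl z nj
  ... | no j≢i = by-rank (rank2 j i j≢i)
    where
    along : ∀ p → Descends (j ∷ p) x → ∀ l → val (play (j ∷ p) x) l ≢ + 0
    along p d with follow (suc n) (j ∷ u) (s≤s l) r (j ∷ p) d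
    ... | starting u₁ r₁ _ _ l₁ = val≢0 n u₁ (≤-trans (m≤n+m _ (length p)) (≤-trans (≤-reflexive (trans (sym (List.length-++ p)) (suc-injective (sym l₁)))) l)) r₁
    first : val (act j x) i ≡ A j i ℤ.* val x j
    first = trans (val-act j x i) (trans (cong (ℤ._+ (A j i ℤ.* val x j)) z) (ℤ.+-identityˡ _))
    by-rank₄ : ∀ c → A j i ≡ + suc c → A j i ℤ.* A i j ≡ + 2 → ⊥
    by-rank₄ c a ab = along (i ∷ j ∷ [])
      (nj ∷ subst (ℤ._< + 0) (sym (trans first (cong (ℤ._* val x j) a))) (ℤ.<-≤-trans (ℤ.*-monoˡ-<-pos (+ suc c) nj) (ℤ.≤-reflexive (ℤ.*-zeroʳ (+ suc c))))
          ∷ subst (ℤ._< + 0) (sym (trans (val-ij₄ j i ab x) (trans (cong (λ v → val x j ℤ.+ A i j ℤ.* v) z) (trans (cong (λ v → val x j ℤ.+ v) (ℤ.*-zeroʳ (A i j))) (ℤ.+-identityʳ _))))) nj ∷ [])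
      i (trans (val-iji₄ j i ab x) z)
    by-rank : Rank2 (M j i) (A j i) (A i j) → ⊥
    by-rank (order2  m a b) = along [] (nj ∷ []) i (trans first (cong (ℤ._* val x j) a))
    by-rank (order3  m a b) = along (i ∷ [])
      (nj ∷ subst (ℤ._< + 0) (sym (trans first (trans (cong (ℤ._* val x j) a) (ℤ.*-identityˡ _)))) nj ∷ [])
      j (trans (val-iji j i a b x) z)
    by-rank (order4  m a b) = by-rank₄ 0 a (cong₂ ℤ._*_ a b)
    by-rank (order4′ m a b) = by-rank₄ 1 a (cong₂ ℤ._*_ a b)

  pos-play : ∀ u x → play u x ≡ base → pos u ≡ x
  pos-play []      x e = sym e
  pos-play (i ∷ u) x e = trans (cong (act i) (pos-play u (act i x) e)) (act-invol i x)

  reduced⇒pos : ∀ {u x} → Reduced u x → pos u ≡ x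
  reduced⇒pos {u} {x} (_ ! e) = pos-play u x e

  -- Strong convergence: `exchange` makes the first letter of one play the first letter of the
  -- other, and the remainders agree by induction.
  reduced-unique : ∀ u v {x} → Reduced u x → Reduced v x → M ⊢ u ≈ v × wtʷ u ≡ wtʷ v
  reduced-unique [] []      r s = ≈-refl , refl
  reduced-unique [] (j ∷ v) (_ ! refl) ((nj ∷ _) ! _) = ⊥-elim (ℤ.<-asym (base-pos j) nj)
  reduced-unique (i ∷ u) v ((ni ∷ d) ! e) s with exchange (length v) v ≤-refl s i ni
  ... | starting v₁ s₁ e₁ w₁ _ with reduced-unique u v₁ (d ! e) s₁
  ... | e₂ , w₂ = ≈-trans (∷-cong i e₂) (≈-sym e₁) , trans (cong (_+_ (wt i)) w₂) (sym w₁)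

  -- By `val≢0` there are two cases. If the entry at i is negative, `exchange` brings i to the front
  -- of the play, where it cancels; if it is positive, i prolongs the play.
  reduced-cons : ∀ i u x → Reduced u x → ∃ λ v → Reduced v (act i x) × M ⊢ v ≈ (i ∷ u) × wtʷ v ≤ wt i + wtʷ u
  reduced-cons i u x r@(d ! e) with ℤ.<-cmp (val x i) (+ 0)
  ... | tri≈ _ z _ = ⊥-elim (val≢0 (length u) u ≤-refl r i z)
  ... | tri< n _ _ with exchange (length u) u ≤-refl r i n
  ... | starting v s e₁ w₁ _ = v , s , ≈-trans (≈-sym (≈-step [] v (invol i))) (∷-cong i (≈-sym e₁))
                             , ≤-trans (m≤n+m (wtʷ v) (wt i)) (≤-trans (≤-reflexive (sym w₁)) (m≤n+m (wtʷ u) (wt i)))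
  reduced-cons i u x r@(d ! e) | tri> _ _ p =
    i ∷ u , ((subst (ℤ._< + 0) (sym (val-act-self i x)) (ℤ.neg-mono-< p) ∷ subst (Descends u) (sym (act-invol i x)) d)
             ! trans (cong (play u) (act-invol i x)) e) , ≈-refl , ≤-refl

  reduced-exists : ∀ w → ∃ λ u → Reduced u (pos w) × M ⊢ u ≈ w × wtʷ u ≤ wtʷ w
  reduced-exists [] = [] , ([] ! refl) , ≈-refl , z≤n
  reduced-exists (i ∷ w) with reduced-exists w
  ... | u , r , e , l with reduced-cons i u (pos w) r
  ... | v , s , e′ , l′ = v , s , ≈-trans e′ (∷-cong i e) , ≤-trans l′ (+-monoʳ-≤ (wt i) l)

  posFrom : Word k → X → X
  posFrom []      x = x
  posFrom (i ∷ u) x = act i (posFrom u x)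

  posFrom-++ : ∀ u v → pos (u ++ v) ≡ posFrom u (pos v)
  posFrom-++ []      v = refl
  posFrom-++ (i ∷ u) v = cong (act i) (posFrom-++ u v)

  posFrom-play : ∀ u x → posFrom u (play u x) ≡ x
  posFrom-play []      x = refl
  posFrom-play (i ∷ u) x = trans (cong (act i) (posFrom-play u (act i x))) (act-invol i x)

  play-posFrom : ∀ u x → play u (posFrom u x) ≡ x
  play-posFrom []      x = refl
  play-posFrom (i ∷ u) x = trans (cong (play u) (act-invol i (posFrom u x))) (play-posFrom u x)

  posFrom-rel : ∀ {l r} → CoxRel M l r → ∀ x → posFrom l x ≡ posFrom r x
  posFrom-rel (invol i)   x = act-invol i x
  posFrom-rel (braid i j) x = trans (cong (posFrom p) (trans (sym (play-posFrom q x)) (sym (braid-play i j _)))) (posFrom-play p _)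
    where p = alt i j (M i j)
          q = alt j i (M i j)

  pos-resp : ∀ {u v} → M ⊢ u ≈ v → pos u ≡ pos v
  pos-resp (≈-step u v {l} {r} rel) = trans (posFrom-++ u (l ++ v)) (trans (cong (posFrom u)
      (trans (posFrom-++ l v) (trans (posFrom-rel rel (pos v)) (sym (posFrom-++ r v))))) (sym (posFrom-++ u (r ++ v))))
  pos-resp ≈-refl        = refl
  pos-resp (≈-sym p)     = sym (pos-resp p)
  pos-resp (≈-trans p q) = trans (pos-resp p) (pos-resp q)

  -- Both words are equivalent to reduced plays from their common position, and `reduced-unique`
  -- identifies these. Together with `pos-resp` this allows positions to be counted in place of
  -- group elements.
  pos-faithful : ∀ u v → pos u ≡ pos v → M ⊢ u ≈ v
  pos-faithful u v e with reduced-exists u | reduced-exists v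
  ... | u′ , r , p , _ | v′ , s , q , _ =
    ≈-trans (≈-sym p) (≈-trans (proj₁ (reduced-unique u′ v′ (subst (Reduced u′) e r) s)) q)

  pos-regular : ∀ w i → val (pos w) i ≢ + 0
  pos-regular w with reduced-exists w
  ... | u , r , _ = val≢0 (length u) u ≤-refl r

  reduced⇒HasLength : (∀ i → wt i ≡ 1) → ∀ {u w} → Reduced u (pos w) → HasLength M w (length u)
  reduced⇒HasLength wt≡1 {u} {w} r = (u , pos-faithful u w (reduced⇒pos r) , refl) , λ v e → least v e
    where
    wtʷ≡length : ∀ v → wtʷ v ≡ length v
    wtʷ≡length []      = refl
    wtʷ≡length (i ∷ v) = cong₂ _+_ (wt≡1 i) (wtʷ≡length v)
    least : ∀ v → M ⊢ v ≈ w → length u ≤ length v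
    least v e with reduced-exists v
    ... | v′ , s , _ , l = subst₂ _≤_ (trans (sym (proj₂ (reduced-unique u v′ r (subst (Reduced v′) (pos-resp e) s)))) (wtʷ≡length u)) (wtʷ≡length v) l

-- Enumeration of the elements of a given weight

HasLength-unique : ∀ {k} {M : CoxMatrix k} {w m n} → HasLength M w m → HasLength M w n → m ≡ n
HasLength-unique ((u , e , refl) , l) ((v , f , refl) , l′) = ≤-antisym (l v f) (l′ u e)

same-length : ∀ {A : Set} {xs ys : List A} (f : A → A) → (∀ x → f (f x) ≡ x) → Unique xs → Unique ys →
  (∀ {x} → x ∈ xs → f x ∈ ys) → (∀ {y} → y ∈ ys → f y ∈ xs) → length xs ≡ length ys
same-length {xs = xs} {ys} f f² ux uy to from = trans (sym (List.length-map f xs)) (↭-length (∼bag⇒↭ (unique∧set⇒bag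
    (Unique.map⁺ (λ {x} {y} e → trans (sym (f² x)) (trans (cong f e) (f² y))) ux) uy (mk⇔ into onto))))
  where
  into : ∀ {z} → z ∈ map f xs → z ∈ ys
  into z∈ with ∈-map⁻ f z∈
  ... | x , x∈ , refl = to x∈
  onto : ∀ {z} → z ∈ ys → z ∈ map f xs
  onto {z} z∈ = subst (_∈ map f xs) (f² z) (∈-map⁺ f (from z∈))

filter-split : ∀ {A : Set} {P Q : A → Set} (P? : ∀ x → Dec (P x)) (Q? : ∀ x → Dec (Q x)) xs →
  length (filter P? xs) ≡ length (filter (λ x → P? x ×-dec Q? x) xs) + length (filter (λ x → P? x ×-dec ¬? (Q? x)) xs)
filter-split P? Q? [] = refl
filter-split P? Q? (x ∷ xs) with P? x | Q? x
... | no _  | yes _ = filter-split P? Q? xs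
... | no _  | no _  = filter-split P? Q? xs
... | yes _ | yes _ = cong suc (filter-split P? Q? xs)
... | yes _ | no _  = trans (cong suc (filter-split P? Q? xs)) (sym (+-suc _ _))

words : ∀ k → ℕ → List (Word k)
words k zero    = [] ∷ []
words k (suc n) = [] ∷ cartesianProductWith _∷_ (allFin k) (words k n)

∈-words : ∀ {k} n (u : Word k) → length u ≤ n → u ∈ words k n
∈-words zero    []      l       = here refl
∈-words (suc n) []      l       = here refl
∈-words (suc n) (i ∷ u) (s≤s l) = there (∈-cartesianProductWith⁺ _∷_ (∈-allFin i) (∈-words n u l))

module Enumerate {k} {M : CoxMatrix k} {X : Set} (D : GameData M X) (_≟_ : DecidableEquality X) where
  open GameData D
  open Play D

  descends? : ∀ u x → Dec (Descends u x)
  descends? []      x = yes []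
  descends? (i ∷ u) x = map′ (λ { (n , d) → n ∷ d }) (λ { (n ∷ d) → n , d }) ((val x i ℤ.<? + 0) ×-dec descends? u (act i x))

  reduced? : ∀ u x → Dec (Reduced u x)
  reduced? u x = map′ (λ { (d , e) → d ! e }) (λ { (d ! e) → d , e }) (descends? u x ×-dec (play u x ≟ base))

  length≤wtʷ : ∀ u → length u ≤ wtʷ u
  length≤wtʷ []      = z≤n
  length≤wtʷ (i ∷ u) = +-mono-≤ (wt-pos i) (length≤wtʷ u)

  ofWeight? : ∀ m u → Dec (Reduced u (pos u) × wtʷ u ≡ m)
  ofWeight? m u = reduced? u (pos u) ×-dec (wtʷ u ℕ.≟ m)

  -- Every generator weighs at least 1, so a word of weight m has at most m letters and finitely
  -- many candidates suffice. Repetitions are removed by comparing positions.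
  enum : ℕ → List X
  enum m = deduplicate _≟_ (map pos (filter (ofWeight? m) (words k m)))

  Weighs : ℕ → X → Set
  Weighs m x = ∃ λ u → Reduced u x × wtʷ u ≡ m

  enum-unique : ∀ m → Unique (enum m)
  enum-unique m = deduplicate-! _≟_ _

  ∈-enum⁺ : ∀ {m x} → Weighs m x → x ∈ enum m
  ∈-enum⁺ {m} {x} (u , r , w) = ∈-deduplicate⁺ _≟_ (subst (_∈ map pos _) (reduced⇒pos r)
    (∈-map⁺ pos (∈-filter⁺ (ofWeight? m) (∈-words m u (≤-trans (length≤wtʷ u) (≤-reflexive w))) (subst (Reduced u) (sym (reduced⇒pos r)) r , w))))

  ∈-enum⁻ : ∀ {m x} → x ∈ enum m → Weighs m x
  ∈-enum⁻ {m} x∈ with ∈-map⁻ pos (∈-deduplicate⁻ _≟_ _ x∈)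
  ... | u , u∈ , refl = u , proj₂ (∈-filter⁻ (ofWeight? m) {xs = words k m} u∈)

  count : DecPred X → ℕ → ℕ
  count P m = length (filter (holds? P) (enum m))

  private
    members : DecPred X → ℕ → List X
    members P m = filter (holds? P) (enum m)

    members-unique : ∀ P m → Unique (members P m)
    members-unique P m = Unique.filter⁺ (holds? P) (enum-unique m)

    ∈-members⁺ : ∀ P m {x} → Weighs m x → holds P x → x ∈ members P m
    ∈-members⁺ P m w p = ∈-filter⁺ (holds? P) (∈-enum⁺ w) p

    ∈-members⁻ : ∀ P m {x} → x ∈ members P m → Weighs m x × holds P x
    ∈-members⁻ P m x∈ with ∈-filter⁻ (holds? P) {xs = enum m} x∈
    ... | e , p = ∈-enum⁻ e , p

  count-cong : ∀ P Q m → (∀ w → holds P (pos w) → holds Q (pos w)) → (∀ w → holds Q (pos w) → holds P (pos w)) → count P m ≡ count Q m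
  count-cong P Q m f g = same-length (λ x → x) (λ _ → refl) (members-unique P m) (members-unique Q m) (transfer P Q f) (transfer Q P g)
    where
    transfer : ∀ P Q → (∀ w → holds P (pos w) → holds Q (pos w)) → ∀ {x} → x ∈ members P m → x ∈ members Q m
    transfer P Q f x∈ with ∈-members⁻ P m x∈
    ... | (u , r , w) , p = ∈-members⁺ Q m (u , r , w) (subst (holds Q) (reduced⇒pos r) (f u (subst (holds P) (sym (reduced⇒pos r)) p)))

  count-split : ∀ P Q m → count P m ≡ count (P ∩ Q) m + count (P ∩ ∁ Q) m
  count-split P Q m = filter-split (holds? P) (holds? Q) (enum m)

  weigh-act : ∀ i {m x} → Neg i x → Weighs m x → ∃ λ m′ → m ≡ wt i + m′ × Weighs m′ (act i x)
  weigh-act i n (u , r , refl) with exchange (length u) u ≤-refl r i n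
  ... | starting v s _ w _ = wtʷ v , w , v , s , refl

  -- `act i` is a bijection between the two sets: by `exchange` a play from a position negative at i
  -- may start with i, and conversely i can be put in front of a play.
  count-fire : ∀ i P → (∀ x → holds P x → Neg i x) → ∀ m → count P (wt i + m) ≡ count (P ∙ act i) m
  count-fire i P neg m = same-length (act i) (act-invol i) (members-unique P (wt i + m)) (members-unique (P ∙ act i) m) to from
    where
    to : ∀ {x} → x ∈ members P (wt i + m) → act i x ∈ members (P ∙ act i) m
    to {x} x∈ with ∈-members⁻ P (wt i + m) x∈
    ... | w , p with weigh-act i (neg x p) w
    ... | m′ , e , w′ = ∈-members⁺ (P ∙ act i) m (subst (λ m → Weighs m (act i x)) (sym (+-cancelˡ-≡ (wt i) _ _ e)) w′) (subst (holds P) (sym (act-invol i x)) p)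
    from : ∀ {y} → y ∈ members (P ∙ act i) m → act i y ∈ members P (wt i + m)
    from {y} y∈ with ∈-members⁻ (P ∙ act i) m y∈
    ... | (v , (d ! e) , w) , p = ∈-members⁺ P (wt i + m) (i ∷ v , ((neg _ p ∷ subst (Descends v) (sym (act-invol i y)) d) ! trans (cong (play v) (act-invol i y)) e) , cong (_+_ (wt i)) w) p

  count-empty : ∀ P m → (∀ x → Weighs m x → holds P x → ⊥) → count P m ≡ 0
  count-empty P m e with members P m in eq
  ... | []     = refl
  ... | x ∷ xs with ∈-members⁻ P m {x} (subst (x ∈_) (sym eq) (here refl))
  ... | w , p = ⊥-elim (e x w p)

  count-light : ∀ i P → (∀ x → holds P x → Neg i x) → ∀ m → m < wt i → count P m ≡ 0
  count-light i P neg m m<wt = count-empty P m λ x w p → absurd (weigh-act i (neg x p) w)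
    where absurd : ∀ {x} → ∃ (λ m′ → m ≡ wt i + m′ × Weighs m′ (act i x)) → ⊥
          absurd (m′ , refl , _) = <⇒≱ m<wt (m≤m+n (wt i) m′)

  count-one : ∀ P x → (∀ y → Weighs 0 y → holds P y → y ≡ x) → Weighs 0 x → holds P x → count P 0 ≡ 1
  count-one P x only w p = same-length {ys = x ∷ []} (λ x → x) (λ _ → refl) (members-unique P 0) ([] ∷ [])
    (λ {y} y∈ → here (only y (proj₁ (∈-members⁻ P 0 y∈)) (proj₂ (∈-members⁻ P 0 y∈)))) (λ { (here refl) → ∈-members⁺ P 0 w p })

  all-pos⇒base : ∀ u {x} → Reduced u x → (∀ i → ¬ Neg i x) → x ≡ base
  all-pos⇒base []      (_ ! e)       _ = e
  all-pos⇒base (i ∷ u) ((n ∷ _) ! _) p = ⊥-elim (p i n)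

  weighs-base : Weighs 0 base
  weighs-base = [] , ([] ! refl) , refl

  base-weight : ∀ {m} → Weighs m base → m ≡ 0
  base-weight ([] , _ , refl) = refl
  base-weight (i ∷ u , ((n ∷ _) ! _) , _) = ⊥-elim (ℤ.<-asym (base-pos i) n)

  -- `L` is kept abstract because the length to be counted is measured in another group, on the
  -- image of the word under a folding.
  module _ (L : Word k → ℕ → Set) (L⇔weight : ∀ {u w m} → Reduced u (pos w) → (L w m → wtʷ u ≡ m) × (wtʷ u ≡ m → L w m)) where

    countsTo : ∀ m → CountsTo M (λ w → L w m) (length (enum m))
    countsTo m = record
      { elems    = reps (enum m) reduced
      ; size     = size (enum m) reduced
      ; sound    = sound (enum m) reduced
      ; distinct = distinct (enum m) reduced (enum-unique m)
      ; complete = complete }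
      where
      reduced : All (Weighs m) (enum m)
      reduced = All.tabulate ∈-enum⁻
      reps : ∀ xs → All (Weighs m) xs → List (Word k)
      reps []       []             = []
      reps (x ∷ xs) ((u , _) ∷ ws) = u ∷ reps xs ws
      size : ∀ xs ws → length (reps xs ws) ≡ length xs
      size []       []       = refl
      size (x ∷ xs) (_ ∷ ws) = cong suc (size xs ws)
      sound : ∀ xs ws → All (λ w → L w m) (reps xs ws)
      sound []       []                 = []
      sound (x ∷ xs) ((u , r , w) ∷ ws) = proj₂ (L⇔weight (subst (Reduced u) (sym (reduced⇒pos r)) r)) w ∷ sound xs ws
      apart : ∀ {x u} xs ws → Reduced u x → All (x ≢_) xs → All (λ v → ¬ (M ⊢ u ≈ v)) (reps xs ws)
      apart []       []                 r []       = []
      apart (y ∷ xs) ((v , s , _) ∷ ws) r (n ∷ ns) = (λ e → n (trans (sym (reduced⇒pos r)) (trans (pos-resp e) (reduced⇒pos s)))) ∷ apart xs ws r ns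
      distinct : ∀ xs ws → Unique xs → AllPairs (λ u v → ¬ (M ⊢ u ≈ v)) (reps xs ws)
      distinct []       []                 []       = []
      distinct (x ∷ xs) ((u , r , _) ∷ ws) (n ∷ ns) = apart xs ws r n ∷ distinct xs ws ns
      find : ∀ {x w} xs ws → pos w ≡ x → x ∈ xs → Any (λ u → M ⊢ w ≈ u) (reps xs ws)
      find {w = w} (x ∷ xs) ((u , r , _) ∷ ws) e (here refl) = here (pos-faithful w u (trans e (sym (reduced⇒pos r))))
      find (x ∷ xs) (_ ∷ ws) e (there x∈) = there (find xs ws e x∈)
      complete : ∀ w → L w m → Any (λ u → M ⊢ w ≈ u) (reps (enum m) reduced)
      complete w l with reduced-exists w
      ... | u , r , _ = find (enum m) reduced refl (∈-enum⁺ (u , r , proj₁ (L⇔weight r) l))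

-- Type C̃

at : ∀ {k} → Vec ℤ k → ℕ → ℤ
at []      _       = + 0
at (x ∷ v) zero    = x
at (x ∷ v) (suc i) = at v i

build : ∀ k → (ℕ → ℤ) → Vec ℤ k
build zero    f = []
build (suc k) f = f 0 ∷ build k (λ i → f (suc i))

at-build : ∀ k f {i} → i < k → at (build k f) i ≡ f i
at-build (suc k) f {zero}  l       = refl
at-build (suc k) f {suc i} (s≤s l) = at-build k (λ i → f (suc i)) l

at-ext : ∀ {k} (v w : Vec ℤ k) → (∀ {i} → i < k → at v i ≡ at w i) → v ≡ w
at-ext []      []      e = refl
at-ext (x ∷ v) (y ∷ w) e = cong₂ _∷_ (e (s≤s z≤n)) (at-ext v w (λ l → e (s≤s l)))

_≟ᵛ_ : ∀ {k} → DecidableEquality (Vec ℤ k)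
_≟ᵛ_ = Vec.≡-dec ℤ._≟_

private
  bond : ℕ → ℕ → ℤ
  bond e i with e ℕ.≟ i
  ... | yes _ = + 2
  ... | no _  = + 1

-- The row belongs to the fired node: an end node, 0 or n, adds twice its value to its neighbour, an
-- inner node adds its value once.
cartan : ℕ → ℕ → ℕ → ℤ
cartan n i j with i ℕ.≟ j
... | yes _ = -[1+ 1 ]
... | no _ with suc i ℕ.≟ j
... | yes _ = bond 0 i
... | no _ with suc j ℕ.≟ i
... | yes _ = bond n i
... | no _  = + 0

cartan-self : ∀ n i → cartan n i i ≡ -[1+ 1 ]
cartan-self n i with i ℕ.≟ i
... | yes _ = refl
... | no i≢i = ⊥-elim (i≢i refl)

cartan-up : ∀ n i → cartan n i (suc i) ≡ bond 0 i
cartan-up n i with i ℕ.≟ suc i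
... | yes e = ⊥-elim (1+n≢n (sym e))
... | no _ with suc i ℕ.≟ suc i
... | yes _ = refl
... | no n≢ = ⊥-elim (n≢ refl)

cartan-down : ∀ n i → cartan n (suc i) i ≡ bond n (suc i)
cartan-down n i with suc i ℕ.≟ i
... | yes e = ⊥-elim (1+n≢n e)
... | no _ with suc (suc i) ℕ.≟ i
... | yes e = ⊥-elim (<-asym ≤-refl (≤-reflexive e))
... | no _ with suc i ℕ.≟ suc i
... | yes _ = refl
... | no n≢ = ⊥-elim (n≢ refl)

cartan-far : ∀ n i j → i ≢ j → suc i ≢ j → suc j ≢ i → cartan n i j ≡ + 0
cartan-far n i j a b c with i ℕ.≟ j
... | yes e = ⊥-elim (a e)
... | no _ with suc i ℕ.≟ j
... | yes e = ⊥-elim (b e)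
... | no _ with suc j ℕ.≟ i
... | yes e = ⊥-elim (c e)
... | no _ = refl

bond-yes : ∀ i → bond i i ≡ + 2
bond-yes i with i ℕ.≟ i
... | yes _ = refl
... | no i≢i = ⊥-elim (i≢i refl)

bond-no : ∀ {e i} → e ≢ i → bond e i ≡ + 1
bond-no {e} {i} e≢i with e ℕ.≟ i
... | yes p = ⊥-elim (e≢i p)
... | no _  = refl

module Linear (k : ℕ) (A : ℕ → ℕ → ℤ) where

  Pos : Set
  Pos = Vec ℤ k

  opaque
    act : ℕ → Pos → Pos
    act i x = build k (λ j → at x j ℤ.+ A i j ℤ.* at x i)

    at-act : ∀ i x {j} → j < k → at (act i x) j ≡ at x j ℤ.+ A i j ℤ.* at x i
    at-act i x l = at-build k (λ j → at x j ℤ.+ A i j ℤ.* at x i) l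

module Affine-C (n : ℕ) where

  open Linear (suc n) (cartan n) public renaming (act to actᶜ)

  private
    at-act′ : ∀ i x {j c} → j ≤ n → cartan n i j ≡ c → at (actᶜ i x) j ≡ at x j ℤ.+ c ℤ.* at x i
    at-act′ i x {j} l e = trans (at-act i x (s≤s l)) (cong (λ c → at x j ℤ.+ c ℤ.* at x i) e)

  chain : 2 ≤ n → Chain Pos n
  chain 2≤n = record
    { val   = at
    ; act   = actᶜ
    ; self  = λ i x l → trans (at-act′ i x l (cartan-self n i)) (neg-lem (at x i))
    ; up₀   = λ x l → at-act′ 0 x l (cartan-up n 0)
    ; up    = λ i x 1≤i i<n → trans (at-act′ i x i<n (trans (cartan-up n i) (bond-no (<⇒≢ 1≤i)))) (one-lem (at x (suc i)) (at x i))
    ; down  = λ i x i<n → trans (at-act′ (suc i) x (≤-trans (n≤1+n i) (<⇒≤ i<n)) (trans (cartan-down n i) (bond-no (≢-sym (<⇒≢ i<n))))) (one-lem (at x i) (at x (suc i)))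
    ; downₙ = λ { i x refl → at-act′ (suc i) x (n≤1+n i) (trans (cartan-down n i) (bond-yes (suc i))) }
    ; far   = λ i j x i≤n j≤n a b c → trans (at-act′ i x j≤n (cartan-far n i j a b c)) (ℤ.+-identityʳ _)
    }
    where
    neg-lem : ∀ p → p ℤ.+ -[1+ 1 ] ℤ.* p ≡ ℤ.- p
    neg-lem = ℤ-Solver.solve-∀
    one-lem : ∀ p q → p ℤ.+ + 1 ℤ.* q ≡ p ℤ.+ q
    one-lem = ℤ-Solver.solve-∀

  -- The product of the two opposite Cartan entries is 4 cos² (π / m), which determines the order m:
  -- the products 0, 1, 2 and 4 give 2, 3, 4 and, on the diagonal, 1.
  order : ℤ → ℕ
  order (+ 1) = 3
  order (+ 2) = 4
  order (+ 4) = 1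
  order _     = 2

  coxᶜ : CoxMatrix (suc n)
  coxᶜ i j = order (cartan n (toℕ i) (toℕ j) ℤ.* cartan n (toℕ j) (toℕ i))

  Rank2-sym : ∀ {m a b} → Rank2 m a b → Rank2 m b a
  Rank2-sym (order2  m a b) = order2 m b a
  Rank2-sym (order3  m a b) = order3 m b a
  Rank2-sym (order4  m a b) = order4′ m b a
  Rank2-sym (order4′ m a b) = order4 m b a

  rank2ᶜ-suc : 2 ≤ n → ∀ i → Rank2 (order (cartan n i (suc i) ℤ.* cartan n (suc i) i)) (cartan n i (suc i)) (cartan n (suc i) i)
  rank2ᶜ-suc 2≤n i rewrite cartan-up n i | cartan-down n i with 0 ℕ.≟ i | n ℕ.≟ suc i
  ... | yes refl | yes refl = ⊥-elim (<-irrefl refl 2≤n)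
  ... | yes refl | no _  = order4′ refl refl refl
  ... | no _  | yes _ = order4 refl refl refl
  ... | no _  | no _  = order3 refl refl refl

  rank2ᶜ : 2 ≤ n → ∀ i j → i ≢ j → Rank2 (order (cartan n i j ℤ.* cartan n j i)) (cartan n i j) (cartan n j i)
  rank2ᶜ 2≤n i j i≢j = by-cases (suc i ℕ.≟ j) (suc j ℕ.≟ i)
    where
    by-cases : Dec (suc i ≡ j) → Dec (suc j ≡ i) → Rank2 (order (cartan n i j ℤ.* cartan n j i)) (cartan n i j) (cartan n j i)
    by-cases (yes refl) _          = rank2ᶜ-suc 2≤n i
    by-cases (no _)     (yes refl) = subst (λ m → Rank2 (order m) (cartan n (suc j) j) (cartan n j (suc j))) (ℤ.*-comm (cartan n j (suc j)) (cartan n (suc j) j)) (Rank2-sym (rank2ᶜ-suc 2≤n j))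
    by-cases (no a)     (no b)     rewrite cartan-far n i j i≢j a b | cartan-far n j i (≢-sym i≢j) b a = order2 refl refl refl

  gameᶜ : 2 ≤ n → GameData coxᶜ Pos
  gameᶜ 2≤n = record
    { A        = λ i j → cartan n (toℕ i) (toℕ j)
    ; A-diag   = λ i → cartan-self n (toℕ i)
    ; M-diag   = λ i → cong (λ c → order (c ℤ.* c)) (cartan-self n (toℕ i))
    ; M-sym    = λ i j → cong order (ℤ.*-comm (cartan n (toℕ i) (toℕ j)) _)
    ; rank2    = λ i j i≢j → rank2ᶜ 2≤n (toℕ i) (toℕ j) (λ e → i≢j (Fin.toℕ-injective e))
    ; wt       = λ _ → 1
    ; wt-pos   = λ _ → s≤s z≤n
    ; wt-odd   = λ _ _ _ → refl
    ; val      = λ x i → at x (toℕ i)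
    ; val-inj  = λ x y e → at-ext x y (λ {i} l → subst (λ j → at x j ≡ at y j) (Fin.toℕ-fromℕ< l) (e (fromℕ< l)))
    ; act      = λ i → actᶜ (toℕ i)
    ; val-act  = λ i x j → at-act (toℕ i) x (Fin.toℕ<n j)
    ; base     = build (suc n) (λ _ → + 1)
    ; base-pos = λ i → subst (+ 0 ℤ.<_) (sym (at-build (suc n) (λ _ → + 1) (Fin.toℕ<n i))) (ℤ.+<+ (s≤s z≤n))
    }

-- Type B̃

≡ᵇ-refl : ∀ a → (a ≡ᵇ a) ≡ true
≡ᵇ-refl zero    = refl
≡ᵇ-refl (suc a) = ≡ᵇ-refl a

≢⇒≡ᵇ : ∀ {a b} → a ≢ b → (a ≡ᵇ b) ≡ false
≢⇒≡ᵇ {zero}  {zero}  n = ⊥-elim (n refl)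
≢⇒≡ᵇ {zero}  {suc b} n = refl
≢⇒≡ᵇ {suc a} {zero}  n = refl
≢⇒≡ᵇ {suc a} {suc b} n = ≢⇒≡ᵇ (λ e → n (cong suc e))

≤⇒≤ᵇ-true : ∀ {a b} → a ≤ b → (a ≤ᵇ b) ≡ true
≤⇒≤ᵇ-true {a} {b} l with a ≤ᵇ b in eq
... | true  = refl
... | false = ⊥-elim (subst T eq (≤⇒≤ᵇ l))

>⇒≤ᵇ-false : ∀ {a b} → b < a → (a ≤ᵇ b) ≡ false
>⇒≤ᵇ-false {a} {b} l with a ≤ᵇ b in eq
... | true  = ⊥-elim (<⇒≱ l (≤ᵇ⇒≤ a b (subst T (sym eq) tt)))
... | false = refl

entry : (ℕ → ℕ → ℕ) → ℕ → ℕ → ℕ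
entry lab a b = if a ≡ᵇ b then 1 else lab (min a b) (max a b)

entry-self : ∀ lab a → entry lab a a ≡ 1
entry-self lab a rewrite ≡ᵇ-refl a = refl

entry-≢ : ∀ lab {a b} → a ≢ b → entry lab a b ≡ lab (min a b) (max a b)
entry-≢ lab a≢b rewrite ≢⇒≡ᵇ a≢b = refl

entry-< : ∀ lab {a b} → a < b → entry lab a b ≡ lab a b
entry-< lab l rewrite ≢⇒≡ᵇ (<⇒≢ l) | m≤n⇒m⊓n≡m (<⇒≤ l) | m≤n⇒m⊔n≡n (<⇒≤ l) = refl

entry-> : ∀ lab {a b} → b < a → entry lab a b ≡ lab b a
entry-> lab l rewrite ≢⇒≡ᵇ (≢-sym (<⇒≢ l)) | m≥n⇒m⊓n≡n (<⇒≤ l) | m≥n⇒m⊔n≡m (<⇒≤ l) = refl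

entry-sym : ∀ lab a b → entry lab a b ≡ entry lab b a
entry-sym lab a b with <-cmp a b
... | tri< l _ _    = trans (entry-< lab l) (sym (entry-> lab l))
... | tri≈ _ refl _ = refl
... | tri> _ _ l    = trans (entry-> lab l) (sym (entry-< lab l))

module Affine-B (p : ℕ) where

  n n-1 : ℕ
  n   = 3 + p
  n-1 = 2 + p

  open Affine-C n

  2≤n : 2 ≤ n
  2≤n = s≤s (s≤s z≤n)

  gC : GameData coxᶜ Pos
  gC = gameᶜ 2≤n

  ch : Chain Pos n
  ch = chain 2≤n
  open Chain ch using (self; up₀; up; down; downₙ; far)

  -- The element of type C̃ that exchanges the two forked nodes of type B̃.
  τ : Pos → Pos
  τ = actᶜ n

  labB-step : ∀ i → i ≤ p → labB n (suc i) (suc (suc i)) ≡ 3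
  labB-step i l with m≤n⇒m<n∨m≡n l
  ... | inj₁ i<p rewrite ≤⇒≤ᵇ-true i<p | ≡ᵇ-refl i = refl
  ... | inj₂ refl rewrite >⇒≤ᵇ-false {suc i} {i} ≤-refl | ≡ᵇ-refl i = refl

  labB-fork : labB n (suc p) n ≡ 3
  labB-fork rewrite >⇒≤ᵇ-false {suc p} {p} ≤-refl | ≡ᵇ-refl p | ≢⇒≡ᵇ {suc p} {p} 1+n≢n = refl

  labB-tip : labB n (suc (suc p)) n ≡ 2
  labB-tip rewrite >⇒≤ᵇ-false {suc (suc p)} {p} (n≤1+n _) | ≢⇒≡ᵇ {suc p} {p} 1+n≢n = refl

  labB-far : ∀ i j → suc i < j → ¬ (i ≡ suc p × j ≡ n) → labB n i j ≡ 2
  labB-far zero    j l ¬fork rewrite ≢⇒≡ᵇ (≢-sym (<⇒≢ l)) = refl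
  labB-far (suc i) j l ¬fork rewrite ≢⇒≡ᵇ (≢-sym (<⇒≢ l)) | Bool.∧-zeroʳ (suc i ≤ᵇ p) with i ℕ.≟ p
  ... | no i≢p rewrite ≢⇒≡ᵇ i≢p = refl
  ... | yes refl rewrite ≢⇒≡ᵇ (≢-sym (<⇒≢ l)) | ≢⇒≡ᵇ {j} {n} (λ e → ¬fork (refl , e)) = helper (i ≡ᵇ i)
    where helper : ∀ b → (if b ∧ false then 3 else 2) ≡ 2
          helper true  = refl
          helper false = refl

  labB-cases : ∀ i j → (labB n i j ≡ 2) ⊎ (labB n i j ≡ 3 × i ≢ 0) ⊎ (labB n i j ≡ 4 × i ≡ 0)
  labB-cases zero j with j ≡ᵇ 1
  ... | true  = inj₂ (inj₂ (refl , refl))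
  ... | false = inj₁ refl
  labB-cases (suc i) j with ((1 ≤ᵇ suc i) ∧ (suc i ≤ᵇ n ∸ 3) ∧ (j ≡ᵇ suc (suc i))) ∨ ((suc i ≡ᵇ n ∸ 2) ∧ ((j ≡ᵇ n ∸ 1) ∨ (j ≡ᵇ n)))
  ... | true  = inj₂ (inj₁ (refl , λ ()))
  ... | false = inj₁ refl

  -- The first argument is the fired node, the second the order of its product with the other
  -- generator. The bond of order 4 is not symmetric: node 0 passes its value twice, the other end
  -- once, as in `up₀` and `down`.
  cartanᴮ : ℕ → ℕ → ℤ
  cartanᴮ _       1 = -[1+ 1 ]
  cartanᴮ _       3 = + 1
  cartanᴮ zero    4 = + 2
  cartanᴮ (suc _) 4 = + 1
  cartanᴮ _       _ = + 0

  mB : ℕ → ℕ → ℕ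
  mB = entry (labB n)

  rank2ᴮ-< : ∀ i j → i < j → Rank2 (labB n i j) (cartanᴮ i (labB n i j)) (cartanᴮ j (labB n i j))
  rank2ᴮ-< i j l with labB-cases i j
  ... | inj₁ e rewrite e = order2 refl (zero-entry i) (zero-entry j)
    where zero-entry : ∀ i → cartanᴮ i 2 ≡ + 0
          zero-entry zero    = refl
          zero-entry (suc i) = refl
  ... | inj₂ (inj₁ (e , _)) rewrite e = order3 refl (one-entry i) (one-entry j)
    where one-entry : ∀ i → cartanᴮ i 3 ≡ + 1
          one-entry zero    = refl
          one-entry (suc i) = refl
  rank2ᴮ-< zero (suc j) l | inj₂ (inj₂ (e , refl)) rewrite e = order4′ refl refl refl

  rank2ᴮ : ∀ i j → i ≢ j → Rank2 (mB i j) (cartanᴮ i (mB i j)) (cartanᴮ j (mB j i))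
  rank2ᴮ i j i≢j with <-cmp i j
  ... | tri≈ _ e _ = ⊥-elim (i≢j e)
  ... | tri< l _ _ rewrite entry-< (labB n) l | entry-> (labB n) l = rank2ᴮ-< i j l
  ... | tri> _ _ l rewrite entry-> (labB n) l | entry-< (labB n) l = Rank2-sym (rank2ᴮ-< j i l)

  -- Node 0 meets the rest of the graph only in a bond of order 4, so it may carry a weight of its
  -- own.
  odd-positive : ∀ i j → mB i j ≡ 3 → i ≢ 0
  odd-positive zero j e refl with 0 ℕ.≟ j
  ... | yes refl = case e of λ ()
  ... | no 0≢j with labB-cases 0 j | n≢0⇒n>0 (≢-sym 0≢j)
  ... | inj₁ q               | l = case trans (sym e) (trans (entry-< (labB n) l) q) of λ ()
  ... | inj₂ (inj₁ (q , 0≢0)) | l = 0≢0 refl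
  ... | inj₂ (inj₂ (q , _))  | l = case trans (sym e) (trans (entry-< (labB n) l) q) of λ ()

  -- The second tip of the fork is node n - 1 seen through τ: its value is the entry n - 1 of `τ x`.
  -- Thus B̃ sits inside C̃ with its last generator equal to the conjugate of the generator n - 1 by
  -- τ.
  valᴮ : Pos → ℕ → ℤ
  valᴮ x i with i ℕ.≟ n
  ... | yes _ = at x (suc (suc p)) ℤ.+ + 2 ℤ.* at x n
  ... | no _  = at x i

  valᴮ-n : ∀ x → valᴮ x n ≡ at x (suc (suc p)) ℤ.+ + 2 ℤ.* at x n
  valᴮ-n x with n ℕ.≟ n
  ... | yes _ = refl
  ... | no n≢n = ⊥-elim (n≢n refl)

  valᴮ-< : ∀ x {i} → i ≢ n → valᴮ x i ≡ at x i
  valᴮ-< x {i} i≢n with i ℕ.≟ n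
  ... | yes e = ⊥-elim (i≢n e)
  ... | no _  = refl

  actᴮ : ℕ → Pos → Pos
  actᴮ i x with i ℕ.≟ n
  ... | yes _ = τ (actᶜ (suc (suc p)) (τ x))
  ... | no _  = actᶜ i x

  actᴮ-n : ∀ x → actᴮ n x ≡ τ (actᶜ (suc (suc p)) (τ x))
  actᴮ-n x with n ℕ.≟ n
  ... | yes _ = refl
  ... | no n≢n = ⊥-elim (n≢n refl)

  actᴮ-< : ∀ x {i} → i ≢ n → actᴮ i x ≡ actᶜ i x
  actᴮ-< x {i} i≢n with i ℕ.≟ n
  ... | yes e = ⊥-elim (i≢n e)
  ... | no _  = refl

  private
    cartanᴮ-2 : ∀ i → cartanᴮ i 2 ≡ + 0
    cartanᴮ-2 zero    = refl
    cartanᴮ-2 (suc i) = refl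
    cartanᴮ-1 : ∀ i → cartanᴮ i 1 ≡ -[1+ 1 ]
    cartanᴮ-1 zero    = refl
    cartanᴮ-1 (suc i) = refl
    minus-two : ∀ p → ℤ.- p ≡ p ℤ.+ -[1+ 1 ] ℤ.* p
    minus-two = ℤ-Solver.solve-∀
    times-one : ∀ p q → p ℤ.+ q ≡ p ℤ.+ + 1 ℤ.* q
    times-one = ℤ-Solver.solve-∀
    times-zero : ∀ p q → p ≡ p ℤ.+ + 0 ℤ.* q
    times-zero = ℤ-Solver.solve-∀

  at-actᶜ : ∀ i j x → i < n → j < n → at (actᶜ i x) j ≡ at x j ℤ.+ cartanᴮ i (mB i j) ℤ.* at x i
  at-actᶜ i j x i<n j<n with i ℕ.≟ j
  ... | yes refl rewrite entry-self (labB n) i | cartanᴮ-1 i = trans (self i x (<⇒≤ i<n)) (minus-two (at x i))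
  ... | no i≢j = by-cases (suc i ℕ.≟ j) (suc j ℕ.≟ i)
    where
    goal : Set
    goal = at (actᶜ i x) j ≡ at x j ℤ.+ cartanᴮ i (mB i j) ℤ.* at x i
    by-up : ∀ i → suc i < n → at (actᶜ i x) (suc i) ≡ at x (suc i) ℤ.+ cartanᴮ i (mB i (suc i)) ℤ.* at x i
    by-up zero    l = up₀ x (s≤s z≤n)
    by-up (suc i) l rewrite entry-< (labB n) {suc i} {suc (suc i)} ≤-refl | labB-step i (≤-pred (≤-pred (≤-pred l))) =
      trans (up (suc i) x (s≤s z≤n) (<⇒≤ l)) (times-one (at x (suc (suc i))) (at x (suc i)))
    by-down : ∀ j → suc j < n → at (actᶜ (suc j) x) j ≡ at x j ℤ.+ cartanᴮ (suc j) (mB (suc j) j) ℤ.* at x (suc j)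
    by-down zero    l = trans (down zero x l) (times-one (at x 0) (at x 1))
    by-down (suc j) l rewrite entry-> (labB n) {suc (suc j)} {suc j} ≤-refl | labB-step j (≤-pred (≤-pred (≤-pred l))) =
      trans (down (suc j) x l) (times-one (at x (suc j)) (at x (suc (suc j))))
    two : suc i ≢ j → suc j ≢ i → mB i j ≡ 2
    two a b with <-cmp i j
    ... | tri< l _ _ = trans (entry-< (labB n) l) (labB-far i j (≤∧≢⇒< l a) λ { (_ , refl) → <-irrefl refl j<n })
    ... | tri≈ _ e _ = ⊥-elim (i≢j e)
    ... | tri> _ _ l = trans (entry-> (labB n) l) (labB-far j i (≤∧≢⇒< l b) λ { (_ , refl) → <-irrefl refl i<n })
    by-cases : Dec (suc i ≡ j) → Dec (suc j ≡ i) → goal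
    by-cases (yes refl) _          = by-up i j<n
    by-cases (no _)     (yes refl) = by-down j i<n
    by-cases (no a)     (no b)     rewrite two a b | cartanᴮ-2 i = trans (far i j x (<⇒≤ i<n) (<⇒≤ j<n) i≢j a b) (times-zero (at x j) (at x i))

  private
    n-1≤n : n-1 ≤ n
    n-1≤n = n≤1+n n-1

    at-τ-n : ∀ x → at (τ x) n ≡ ℤ.- at x n
    at-τ-n x = self n x ≤-refl
    at-τ-n-1 : ∀ x → at (τ x) n-1 ≡ at x n-1 ℤ.+ + 2 ℤ.* at x n
    at-τ-n-1 x = downₙ n-1 x refl
    at-τ-far : ∀ x {j} → j < n-1 → at (τ x) j ≡ at x j
    at-τ-far x {j} l = far n j x ≤-refl (≤-trans (<⇒≤ l) n-1≤n) (≢-sym (<⇒≢ (≤-trans l n-1≤n))) (≢-sym (<⇒≢ (≤-trans l (≤-trans n-1≤n (n≤1+n n)))))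
      (λ e → <⇒≢ l (suc-injective e))

  valᴮ-act-below : ∀ i x j → i < n → j ≤ n → valᴮ (actᶜ i x) j ≡ valᴮ x j ℤ.+ cartanᴮ i (mB i j) ℤ.* at x i
  valᴮ-act-below i x j i<n j≤n with j ℕ.≟ n
  ... | no j≢n = at-actᶜ i j x i<n (≤∧≢⇒< j≤n j≢n)
  ... | yes refl with m≤n⇒m<n∨m≡n (≤-pred i<n)
  ... | inj₂ refl rewrite self n-1 x n-1≤n | up n-1 x (s≤s z≤n) ≤-refl | entry-< (labB n) {n-1} {n} ≤-refl | labB-tip = lem (at x n-1) (at x n)
    where lem : ∀ a b → ℤ.- a ℤ.+ + 2 ℤ.* (b ℤ.+ a) ≡ (a ℤ.+ + 2 ℤ.* b) ℤ.+ + 0 ℤ.* a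
          lem = ℤ-Solver.solve-∀
  ... | inj₁ i<n-1 with m≤n⇒m<n∨m≡n (≤-pred i<n-1)
  ... | inj₂ refl rewrite up (suc p) x (s≤s z≤n) (s≤s (n≤1+n _)) | far (suc p) n x (<⇒≤ i<n) ≤-refl (<⇒≢ i<n) (<⇒≢ ≤-refl) (≢-sym (<⇒≢ (m<n⇒m<1+n i<n)))
                      | entry-< (labB n) i<n | labB-fork = lem (at x n-1) (at x n) (at x (suc p))
    where lem : ∀ a b c → (a ℤ.+ c) ℤ.+ + 2 ℤ.* b ≡ (a ℤ.+ + 2 ℤ.* b) ℤ.+ + 1 ℤ.* c
          lem = ℤ-Solver.solve-∀
  ... | inj₁ i<1+p rewrite far i n-1 x (<⇒≤ i<n) n-1≤n (<⇒≢ i<n-1) (<⇒≢ (s≤s i<1+p)) (≢-sym (<⇒≢ (m<n⇒m<1+n i<n-1)))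
                      | far i n x (<⇒≤ i<n) ≤-refl (<⇒≢ i<n) (<⇒≢ (s≤s i<n-1)) (≢-sym (<⇒≢ (m<n⇒m<1+n i<n)))
                      | entry-< (labB n) i<n | labB-far i n (s≤s i<n-1) (λ { (refl , _) → <-irrefl refl i<1+p }) | cartanᴮ-2 i = times-zero _ (at x i)

  valᴮ-act-n : ∀ x j → j ≤ n → valᴮ (τ (actᶜ n-1 (τ x))) j ≡ valᴮ x j ℤ.+ cartanᴮ n (mB n j) ℤ.* valᴮ x n
  valᴮ-act-n x j j≤n rewrite valᴮ-n x with j ℕ.≟ n
  ... | yes refl rewrite entry-self (labB n) n | at-τ-n (actᶜ n-1 (τ x)) | at-τ-n-1 (actᶜ n-1 (τ x))
        | self n-1 (τ x) n-1≤n | up n-1 (τ x) (s≤s z≤n) ≤-refl | at-τ-n x | at-τ-n-1 x = lem (at x n-1) (at x n)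
    where lem : ∀ a b → (ℤ.- (a ℤ.+ + 2 ℤ.* b) ℤ.+ + 2 ℤ.* (ℤ.- b ℤ.+ (a ℤ.+ + 2 ℤ.* b))) ℤ.+ + 2 ℤ.* (ℤ.- (ℤ.- b ℤ.+ (a ℤ.+ + 2 ℤ.* b)))
                      ≡ (a ℤ.+ + 2 ℤ.* b) ℤ.+ -[1+ 1 ] ℤ.* (a ℤ.+ + 2 ℤ.* b)
          lem = ℤ-Solver.solve-∀
  ... | no j≢n with m≤n⇒m<n∨m≡n (≤-pred (≤∧≢⇒< j≤n j≢n))
  ... | inj₂ refl rewrite entry-> (labB n) {n} {n-1} ≤-refl | labB-tip | at-τ-n-1 (actᶜ n-1 (τ x))
        | self n-1 (τ x) n-1≤n | up n-1 (τ x) (s≤s z≤n) ≤-refl | at-τ-n x | at-τ-n-1 x = lem (at x n-1) (at x n)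
    where lem : ∀ a b → ℤ.- (a ℤ.+ + 2 ℤ.* b) ℤ.+ + 2 ℤ.* (ℤ.- b ℤ.+ (a ℤ.+ + 2 ℤ.* b)) ≡ a ℤ.+ + 0 ℤ.* (a ℤ.+ + 2 ℤ.* b)
          lem = ℤ-Solver.solve-∀
  ... | inj₁ j<n-1 rewrite at-τ-far (actᶜ n-1 (τ x)) j<n-1 with m≤n⇒m<n∨m≡n (≤-pred j<n-1)
  ... | inj₂ refl rewrite entry-> (labB n) {n} {suc p} (s≤s (n≤1+n _)) | labB-fork | down (suc p) (τ x) ≤-refl
        | at-τ-far x {suc p} ≤-refl | at-τ-n-1 x = times-one (at x (suc p)) (at x n-1 ℤ.+ + 2 ℤ.* at x n)
  ... | inj₁ j<1+p rewrite entry-> (labB n) {n} {j} (≤∧≢⇒< j≤n j≢n) | labB-far j n (s≤s j<n-1) (λ { (refl , _) → <-irrefl refl j<1+p })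
        | far n-1 j (τ x) n-1≤n j≤n (≢-sym (<⇒≢ j<n-1)) (≢-sym (<⇒≢ (m<n⇒m<1+n j<n-1))) (<⇒≢ (s≤s j<1+p))
        | at-τ-far x j<n-1 = times-zero (at x j) (at x n-1 ℤ.+ + 2 ℤ.* at x n)

  valᴮ-act : ∀ i x j → i ≤ n → j ≤ n → valᴮ (actᴮ i x) j ≡ valᴮ x j ℤ.+ cartanᴮ i (mB i j) ℤ.* valᴮ x i
  valᴮ-act i x j i≤n j≤n = by-case (i ℕ.≟ n)
    where
    by-case : Dec (i ≡ n) → valᴮ (actᴮ i x) j ≡ valᴮ x j ℤ.+ cartanᴮ i (mB i j) ℤ.* valᴮ x i
    by-case (yes refl) = trans (cong (λ y → valᴮ y j) (actᴮ-n x)) (valᴮ-act-n x j j≤n)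
    by-case (no i≢n)   = trans (cong (λ y → valᴮ y j) (actᴮ-< x i≢n)) (trans (valᴮ-act-below i x j (≤∧≢⇒< i≤n i≢n) j≤n)
                           (cong (λ v → valᴮ x j ℤ.+ cartanᴮ i (mB i j) ℤ.* v) (sym (valᴮ-< x i≢n))))

  valᴮ-inj : ∀ x y → (∀ {j} → j ≤ n → valᴮ x j ≡ valᴮ y j) → x ≡ y
  valᴮ-inj x y e = at-ext x y λ {i} l → by-case (i ℕ.≟ n) (≤-pred l)
    where
    below : ∀ {i} → i ≤ n → i ≢ n → at x i ≡ at y i
    below i≤n i≢n = trans (sym (valᴮ-< x i≢n)) (trans (e i≤n) (valᴮ-< y i≢n))
    by-case : ∀ {i} → Dec (i ≡ n) → i ≤ n → at x i ≡ at y i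
    by-case (no i≢n)   i≤n = below i≤n i≢n
    -- The values at the two tips differ by twice the entry n, and 2 can be cancelled in ℤ.
    by-case (yes refl) _   = ℤ.*-cancelˡ-≡ (+ 2) (at x n) (at y n) (ℤ+-cancelˡ (at x n-1) _ _
      (trans (sym (valᴮ-n x)) (trans (e ≤-refl) (trans (valᴮ-n y) (cong (λ a → a ℤ.+ + 2 ℤ.* at y n) (sym (below n-1≤n (≢-sym 1+n≢n))))))))

  module Weighted (wt₀ wt₁ : ℕ) (wt₀≥1 : 1 ≤ wt₀) (wt₁≥1 : 1 ≤ wt₁) where

    weight : ℕ → ℕ
    weight zero    = wt₀
    weight (suc _) = wt₁

    gameᴮ : GameData (MB n) Pos
    gameᴮ = record
      { A        = λ i j → cartanᴮ (toℕ i) (mB (toℕ i) (toℕ j))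
      ; A-diag   = λ i → trans (cong (cartanᴮ (toℕ i)) (entry-self (labB n) (toℕ i))) (cartanᴮ-1 (toℕ i))
      ; M-diag   = λ i → entry-self (labB n) (toℕ i)
      ; M-sym    = λ i j → entry-sym (labB n) (toℕ i) (toℕ j)
      ; rank2    = λ i j i≢j → rank2ᴮ (toℕ i) (toℕ j) (λ e → i≢j (Fin.toℕ-injective e))
      ; wt       = λ i → weight (toℕ i)
      ; wt-pos   = λ i → weight-pos (toℕ i)
      ; wt-odd   = λ i j e → weight-odd (odd-positive (toℕ i) (toℕ j) e) (odd-positive (toℕ j) (toℕ i) (trans (entry-sym (labB n) (toℕ j) (toℕ i)) e))
      ; val      = λ x i → valᴮ x (toℕ i)
      ; val-inj  = λ x y e → valᴮ-inj x y (λ {j} l → subst (λ j → valᴮ x j ≡ valᴮ y j) (Fin.toℕ-fromℕ< (s≤s l)) (e (fromℕ< (s≤s l))))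
      ; act      = λ i → actᴮ (toℕ i)
      ; val-act  = λ i x j → valᴮ-act (toℕ i) x (toℕ j) (Fin.toℕ≤pred[n] i) (Fin.toℕ≤pred[n] j)
      ; base     = GameData.base gC
      ; base-pos = λ i → base-pos (toℕ i) (Fin.toℕ≤pred[n] i)
      }
      where
      weight-pos : ∀ i → 1 ≤ weight i
      weight-pos zero    = wt₀≥1
      weight-pos (suc i) = wt₁≥1
      weight-odd : ∀ {i j} → i ≢ 0 → j ≢ 0 → weight i ≡ weight j
      weight-odd {zero}          a b = ⊥-elim (a refl)
      weight-odd {suc i} {zero}  a b = ⊥-elim (b refl)
      weight-odd {suc i} {suc j} a b = refl
      one : ∀ {i} → i ≤ n → at (GameData.base gC) i ≡ + 1
      one l = at-build (suc n) (λ _ → + 1) (s≤s l)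
      base-pos : ∀ i → i ≤ n → + 0 ℤ.< valᴮ (GameData.base gC) i
      base-pos i l with i ℕ.≟ n
      ... | no _  rewrite one l = ℤ.+<+ (s≤s z≤n)
      ... | yes _ rewrite one n-1≤n | one {n} ≤-refl = ℤ.+<+ (s≤s z≤n)

-- Positions of C̃ counted through the orbit of B̃

module Enumerated-B (p wt₀ wt₁ : ℕ) (wt₀≥1 : 1 ≤ wt₀) (wt₁≥1 : 1 ≤ wt₁) where
  open Affine-B p
  open Affine-C n
  open Weighted wt₀ wt₁ wt₀≥1 wt₁≥1
  open Chain ch using (Regular; self; down; downₙ; far)
  open Coordinates ch
  module 𝔹 = Play gameᴮ
  module ℂ = Play gC
  open Enumerate gameᴮ _≟ᵛ_

  nodeᶜ : ∀ {i} → i ≤ n → Fin (suc n)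
  nodeᶜ l = fromℕ< (s≤s l)

  toℕ-nodeᶜ : ∀ {i} (l : i ≤ n) → toℕ (nodeᶜ l) ≡ i
  toℕ-nodeᶜ l = Fin.toℕ-fromℕ< (s≤s l)

  τ-invol : ∀ x → τ (τ x) ≡ x
  τ-invol x = subst (λ i → actᶜ i (actᶜ i x) ≡ x) (toℕ-nodeᶜ ≤-refl) (ℂ.act-invol (nodeᶜ ≤-refl) x)

  τ-comm : ∀ i x → i < n-1 → τ (actᶜ i x) ≡ actᶜ i (τ x)
  τ-comm i x l = subst₂ (λ a b → actᶜ b (actᶜ a x) ≡ actᶜ a (actᶜ b x)) (toℕ-nodeᶜ i≤n) (toℕ-nodeᶜ ≤-refl)
    (ℂ.braid₂ (nodeᶜ i≤n) (nodeᶜ ≤-refl)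
      (trans (cong₂ (cartan n) (toℕ-nodeᶜ i≤n) (toℕ-nodeᶜ ≤-refl)) (cartan-far n i n a b c))
      (trans (cong₂ (cartan n) (toℕ-nodeᶜ ≤-refl) (toℕ-nodeᶜ i≤n)) (cartan-far n n i (≢-sym a) c b)) x)
    where
    i≤n : i ≤ n
    i≤n = ≤-trans (<⇒≤ l) (n≤1+n _)
    a : i ≢ n
    a = <⇒≢ (m<n⇒m<1+n l)
    b : suc i ≢ n
    b = <⇒≢ (s≤s l)
    c : suc n ≢ i
    c = ≢-sym (<⇒≢ (m<n⇒m<1+n (m<n⇒m<1+n l)))

  Orbit : Pos → Set
  Orbit x = ∃ λ w → ℂ.pos w ≡ x

  orbit-act : ∀ i {x} → i ≤ n → Orbit x → Orbit (actᶜ i x)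
  orbit-act i l (w , refl) = nodeᶜ l ∷ w , cong (λ j → actᶜ j (ℂ.pos w)) (toℕ-nodeᶜ l)

  orbit-regular : ∀ {x} → Orbit x → Regular x
  orbit-regular (w , refl) i l = subst (λ j → at (ℂ.pos w) j ≢ + 0) (toℕ-nodeᶜ l) (ℂ.pos-regular w (nodeᶜ l))

  posᴮ-orbit : ∀ w → Orbit (𝔹.pos w)
  posᴮ-orbit []      = [] , refl
  posᴮ-orbit (i ∷ w) with toℕ i ℕ.≟ n
  ... | yes _ = orbit-act n ≤-refl (orbit-act n-1 (n≤1+n _) (orbit-act n ≤-refl (posᴮ-orbit w)))
  ... | no _  = orbit-act (toℕ i) (Fin.toℕ≤pred[n] i) (posᴮ-orbit w)

  -- Each C̃-position lies in the orbit of B̃ or is the image of such a position under τ.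
  gfᶜ : DecPred Pos → Series
  gfᶜ P m = + (count P m + count (P ∙ τ) m)

  gfᶜ-cong : ∀ P Q → (∀ x → Regular x → holds P x → holds Q x) → (∀ x → Regular x → holds Q x → holds P x) → gfᶜ P ≋ gfᶜ Q
  gfᶜ-cong P Q f g m = cong₂ (λ a b → + (a + b))
    (count-cong P Q m (λ w → f _ (orbit-regular (posᴮ-orbit w))) (λ w → g _ (orbit-regular (posᴮ-orbit w))))
    (count-cong (P ∙ τ) (Q ∙ τ) m (λ w → f _ (orbit-regular (orbit-act n ≤-refl (posᴮ-orbit w)))) (λ w → g _ (orbit-regular (orbit-act n ≤-refl (posᴮ-orbit w)))))

  gfᶜ-split : ∀ P Q → gfᶜ P ≋ gfᶜ (P ∩ Q) ⊕ gfᶜ (P ∩ ∁ Q)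
  gfᶜ-split P Q m = trans (cong₂ (λ a b → + (a + b)) (count-split P Q m) (count-split (P ∙ τ) (Q ∙ τ) m))
    (trans (cong +_ (interchange (count (P ∩ Q) m) (count (P ∩ ∁ Q) m) _ _)) (sym (⊕-coeff (gfᶜ (P ∩ Q)) (gfᶜ (P ∩ ∁ Q)) m)))
    where open import Algebra.Properties.CommutativeSemigroup +-commutativeSemigroup using (interchange)

  count-fireᴮ : ∀ i (l : i ≤ n) P → (∀ x → holds P x → valᴮ x i ℤ.< + 0) →
    (∀ m → count P (weight i + m) ≡ count (P ∙ actᴮ i) m) × (∀ m → m < weight i → count P m ≡ 0)
  count-fireᴮ i l P neg = subst (λ j → (∀ m → count P (weight j + m) ≡ count (P ∙ actᴮ j) m) × (∀ m → m < weight j → count P m ≡ 0)) (toℕ-nodeᶜ l)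
    (count-fire (nodeᶜ l) P neg′ , count-light (nodeᶜ l) P neg′)
    where
    neg′ : ∀ x → holds P x → valᴮ x (toℕ (nodeᶜ l)) ℤ.< + 0
    neg′ x h = subst (λ j → valᴮ x j ℤ.< + 0) (sym (toℕ-nodeᶜ l)) (neg x h)

  gfᶜ-fire : ∀ i P w → (∀ m → count P (w + m) ≡ count (P ∙ actᶜ i) m) → (∀ m → m < w → count P m ≡ 0) →
    (∀ m → count (P ∙ τ) (w + m) ≡ count ((P ∙ actᶜ i) ∙ τ) m) → (∀ m → m < w → count (P ∙ τ) m ≡ 0) → gfᶜ P ≋ qˢ ^ˢ w ⊗ gfᶜ (P ∙ actᶜ i)
  gfᶜ-fire i P w a b c d = delayed w (λ m → cong₂ (λ x y → + (x + y)) (a m) (c m)) (λ m l → cong₂ (λ x y → + (x + y)) (b m l) (d m l))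

  count-act-below : ∀ {i} P m → i ≢ n → count (P ∙ actᴮ i) m ≡ count (P ∙ actᶜ i) m
  count-act-below P m i≢n = count-cong _ _ m (λ w → subst (holds P) (actᴮ-< _ i≢n)) (λ w → subst (holds P) (sym (actᴮ-< _ i≢n)))

  gfᶜ-fire-low : ∀ i P → i < n-1 → (∀ x → holds P x → at x i ℤ.< + 0) → gfᶜ P ≋ qˢ ^ˢ weight i ⊗ gfᶜ (P ∙ actᶜ i)
  gfᶜ-fire-low i P l neg = gfᶜ-fire i P (weight i)
      (λ m → trans (proj₁ f m) (count-act-below P m i≢n)) (proj₂ f)
      (λ m → trans (proj₁ g m) (trans (count-act-below (P ∙ τ) m i≢n)
        (count-cong _ _ m (λ w → subst (holds P) (τ-comm i _ l)) (λ w → subst (holds P) (sym (τ-comm i _ l)))))) (proj₂ g)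
    where
    i<n : i < n
    i<n = m<n⇒m<1+n l
    i≢n : i ≢ n
    i≢n = <⇒≢ i<n
    f = count-fireᴮ i (<⇒≤ i<n) P (λ x h → subst (ℤ._< + 0) (sym (valᴮ-< x i≢n)) (neg x h))
    g = count-fireᴮ i (<⇒≤ i<n) (P ∙ τ) (λ x h → subst (ℤ._< + 0) (trans (far< n i x ≤-refl (<⇒≤ i<n) (s≤s l)) (sym (valᴮ-< x i≢n))) (neg (τ x) h))

  -- In the summand behind τ, firing node n - 1 of C̃ is firing the other tip n of B̃, since τ
  -- exchanges the tips. Both tips have the weight `wt₁`, so the two summands acquire the same
  -- factor.
  gfᶜ-fire-fork : ∀ P → (∀ x → holds P x → at x n-1 ℤ.< + 0) → gfᶜ P ≋ qˢ ^ˢ wt₁ ⊗ gfᶜ (P ∙ actᶜ n-1)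
  gfᶜ-fire-fork P neg = gfᶜ-fire n-1 P wt₁
      (λ m → trans (proj₁ f m) (count-act-below P m (≢-sym 1+n≢n))) (proj₂ f)
      (λ m → trans (proj₁ g m) (count-cong _ _ m (λ w → subst (holds P) (forked (𝔹.pos w))) (λ w → subst (holds P) (sym (forked (𝔹.pos w)))))) (proj₂ g)
    where
    f = count-fireᴮ n-1 (n≤1+n _) P (λ x h → subst (ℤ._< + 0) (sym (valᴮ-< x (≢-sym 1+n≢n))) (neg x h))
    g = count-fireᴮ n ≤-refl (P ∙ τ) (λ x h → subst (ℤ._< + 0) (trans (downₙ n-1 x refl) (sym (valᴮ-n x))) (neg (τ x) h))
    forked : ∀ x → τ (actᴮ n x) ≡ actᶜ n-1 (τ x)
    forked x = trans (cong τ (actᴮ-n x)) (τ-invol _)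

  -- Firing node n only exchanges the two summands of `gfᶜ`; this is the reason for u = 1.
  gfᶜ-fire-τ : ∀ P → gfᶜ P ≋ 1ˢ ⊗ gfᶜ (P ∙ τ)
  gfᶜ-fire-τ P m = trans (cong +_ (trans (+-comm (count P m) _) (cong (λ c → count (P ∙ τ) m + c)
      (count-cong P ((P ∙ τ) ∙ τ) m (λ w → subst (holds P) (sym (τ-invol _))) (λ w → subst (holds P) (τ-invol _))))))
    (sym (ˢ.*-identityˡ (gfᶜ (P ∙ τ)) m))

  noᴮ-neg⇒base : ∀ {m x} → Weighs m x → (∀ i → i ≤ n → + 0 ℤ.≤ valᴮ x i) → x ≡ 𝔹.pos []
  noᴮ-neg⇒base (u , r , _) h = all-pos⇒base u r λ i → ℤ.≤⇒≯ (h (toℕ i) (Fin.toℕ≤pred[n] i))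

  at-base : ∀ {i} → i ≤ n → at (𝔹.pos []) i ≡ + 1
  at-base l = at-build (suc n) (λ _ → + 1) (s≤s l)

  private
    ascᶜ descᶜ : DecPred Pos
    ascᶜ  = asc< ch (suc n)
    descᶜ = desc< ch (suc n)

  asc⇒base : ∀ {m x} → Weighs m x → holds ascᶜ x → x ≡ 𝔹.pos []
  asc⇒base {x = x} w h = noᴮ-neg⇒base w nonneg
    where
    nonneg : ∀ i → i ≤ n → + 0 ℤ.≤ valᴮ x i
    nonneg i l with i ℕ.≟ n
    ... | yes _ = nonneg+ (h (s≤s (n≤1+n _)) tt) (ℤ.*-monoˡ-≤-nonNeg (+ 2) (h ≤-refl tt))
    ... | no _  = h (s≤s l) tt

  -- If `τ x` had no negative entry, then neither would any B̃-value of x be negative, so x would be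
  -- the base. But the entry n of τ at the base is -1.
  asc-τ-empty : ∀ m x → Weighs m x → holds (ascᶜ ∙ τ) x → ⊥
  asc-τ-empty m x w h = ℤ.<⇒≱ neg-n (h {n} ≤-refl tt)
    where
    nonneg-n : + 0 ℤ.≤ ℤ.- at x n
    nonneg-n = subst (+ 0 ℤ.≤_) (self n x ≤-refl) (h {n} ≤-refl tt)
    by-case : ∀ i → Dec (i ≡ n) → Dec (i ≡ n-1) → i ≤ n → + 0 ℤ.≤ valᴮ x i
    by-case i (yes refl) _          l = subst (+ 0 ℤ.≤_) (trans (downₙ n-1 x refl) (sym (valᴮ-n x))) (h {n-1} (s≤s (n≤1+n _)) tt)
    by-case i (no i≢n)   (yes refl) l = subst (+ 0 ℤ.≤_) (trans (cong₂ (λ a b → a ℤ.+ + 2 ℤ.* b) (downₙ n-1 x refl) refl) (trans (lem (at x n-1) (at x n)) (sym (valᴮ-< x i≢n))))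
                                             (nonneg+ (h {n-1} (s≤s (n≤1+n _)) tt) (ℤ.*-monoˡ-≤-nonNeg (+ 2) nonneg-n))
      where lem : ∀ a b → (a ℤ.+ + 2 ℤ.* b) ℤ.+ + 2 ℤ.* ℤ.- b ≡ a
            lem = ℤ-Solver.solve-∀
    by-case i (no i≢n)   (no i≢n-1) l = subst (+ 0 ℤ.≤_) (trans (far< n i x ≤-refl l (≤∧≢⇒< (≤∧≢⇒< l i≢n) (λ e → i≢n-1 (suc-injective e)))) (sym (valᴮ-< x i≢n))) (h (s≤s l) tt)
    isBase : x ≡ 𝔹.pos []
    isBase = noᴮ-neg⇒base w (λ i l → by-case i (i ℕ.≟ n) (i ℕ.≟ n-1) l)
    neg-n : at (τ x) n ℤ.< + 0
    neg-n = subst (ℤ._< + 0) (sym (trans (self n x ≤-refl) (cong ℤ.-_ (trans (cong (λ y → at y n) isBase) (at-base ≤-refl))))) ℤ.-<+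

  gfᶜ-asc : gfᶜ ascᶜ ≋ 1ˢ
  gfᶜ-asc zero    = cong₂ (λ a b → + (a + b))
    (count-one ascᶜ (𝔹.pos []) (λ y → asc⇒base) weighs-base (λ {a} l _ → subst (+ 0 ℤ.≤_) (sym (at-base (≤-pred l))) (ℤ.+≤+ z≤n)))
    (count-empty (ascᶜ ∙ τ) 0 (asc-τ-empty 0))
  gfᶜ-asc (suc m) = cong₂ (λ a b → + (a + b))
    (count-empty ascᶜ (suc m) (λ x w h → case base-weight (subst (Weighs (suc m)) (asc⇒base w h) w) of λ ()))
    (count-empty (ascᶜ ∙ τ) (suc m) (asc-τ-empty (suc m)))

  -- The pairing of a position with the null root.
  level : Pos → ℤ
  level x = ξ x (suc n)

  level-act : ∀ i x → i ≤ n → level (actᶜ i x) ≡ level x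
  level-act i x l with m≤n⇒m<n∨m≡n l
  ... | inj₂ refl = trans (cong₂ (λ a b → (a ℤ.+ b) ℤ.+ at (τ x) n) (ξ-low n-1 x n-1 ≤-refl ≤-refl) (downₙ n-1 x refl))
      (trans (cong (λ c → (ξ x n-1 ℤ.+ (at x n-1 ℤ.+ + 2 ℤ.* at x n)) ℤ.+ c) (self n x ≤-refl)) (lem (ξ x n-1) (at x n-1) (at x n)))
    where lem : ∀ p a b → (p ℤ.+ (a ℤ.+ + 2 ℤ.* b)) ℤ.+ ℤ.- b ≡ (p ℤ.+ a) ℤ.+ b
          lem = ℤ-Solver.solve-∀
  level-act zero    x _ | inj₁ _ = cong₂ ℤ._+_ (ξ-flip-other x (s≤s z≤n) (suc p) ≤-refl) (far> 0 n x z≤n ≤-refl (s≤s (s≤s z≤n)))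
  level-act (suc i) x _ | inj₁ 1+i<n with m≤n⇒m<n∨m≡n 1+i<n
  ... | inj₁ 2+i<n = cong₂ ℤ._+_ (ξ-swap-other i x 1+i<n n ≤-refl (≢-sym (<⇒≢ 1+i<n)) (≢-sym (<⇒≢ 2+i<n))) (far> (suc i) n x (<⇒≤ 1+i<n) ≤-refl 2+i<n)
  ... | inj₂ refl  = trans (cong₂ ℤ._+_ (ξ-swap₂ (suc p) x ≤-refl) (Chain.up ch n-1 x (s≤s z≤n) ≤-refl)) (lem (ξ x n-1) (at x n-1) (at x n))
    where lem : ∀ p a b → p ℤ.+ (b ℤ.+ a) ≡ (p ℤ.+ a) ℤ.+ b
          lem = ℤ-Solver.solve-∀

  level-orbit : ∀ {x} → Orbit x → level x ≡ level (𝔹.pos [])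
  level-orbit ([] , refl)    = refl
  level-orbit (i ∷ w , refl) = trans (level-act (toℕ i) (ℂ.pos w) (Fin.toℕ≤pred[n] i)) (level-orbit (w , refl))

  level-base : + 0 ℤ.≤ level (𝔹.pos [])
  level-base = go (suc n) ≤-refl
    where
    go : ∀ i → i ≤ suc n → + 0 ℤ.≤ ξ (𝔹.pos []) i
    go zero    l = ℤ.≤-refl
    go (suc i) l = nonneg+ (go i (<⇒≤ l)) (subst (+ 0 ℤ.≤_) (sym (at-base (≤-pred l))) (ℤ.+≤+ z≤n))

  -- The level is the sum of all entries. It is constant on the orbit and nonnegative at the base,
  -- whereas descent at every node would make it negative.
  desc-empty : ∀ {x} → Orbit x → holds descᶜ x → ⊥
  desc-empty {x} o h = ℤ.<⇒≱ (subst (ℤ._< + 0) (level-orbit o) (ℤ.+-mono-≤-< (go n (n≤1+n _)) (h {n} ≤-refl tt))) level-base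
    where
    go : ∀ i → i ≤ suc n → ξ x i ℤ.≤ + 0
    go zero    l = ℤ.≤-refl
    go (suc i) l = ℤ.+-mono-≤ (go i (<⇒≤ l)) (ℤ.<⇒≤ (h l tt))

  weighs-orbit : ∀ {m x} → Weighs m x → Orbit x
  weighs-orbit (u , r , _) = subst Orbit (𝔹.reduced⇒pos r) (posᴮ-orbit u)

  gfᶜ-desc : gfᶜ descᶜ ≋ 0ˢ
  gfᶜ-desc m = trans (cong₂ (λ a b → + (a + b))
    (count-empty descᶜ m (λ x w → desc-empty (weighs-orbit w)))
    (count-empty (descᶜ ∙ τ) m (λ x w → desc-empty (orbit-act n ≤-refl (weighs-orbit w))))) (zero-coeff m)
    where
    zero-coeff : ∀ m → + 0 ≡ 0ˢ m
    zero-coeff zero    = refl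
    zero-coeff (suc m) = refl

  counting : Count ch (qˢ ^ˢ wt₀) (qˢ ^ˢ wt₁) 1ˢ
  counting = record
    { gf      = gfᶜ
    ; gf-cong = gfᶜ-cong
    ; split   = gfᶜ-split
    ; fire₀   = λ P → gfᶜ-fire-low 0 P (s≤s z≤n)
    ; fire    = fire
    ; fireₙ   = λ P _ → gfᶜ-fire-τ P
    ; gf-asc  = gfᶜ-asc
    ; gf-desc = gfᶜ-desc
    }
    where
    fire : ∀ i P → 1 ≤ i → i < n → (∀ x → holds P x → at x i ℤ.< + 0) → gfᶜ P ≋ qˢ ^ˢ wt₁ ⊗ gfᶜ (P ∙ actᶜ i)
    fire (suc i) P _ l neg with m≤n⇒m<n∨m≡n (≤-pred l)
    ... | inj₁ 1+i<n-1 = gfᶜ-fire-low (suc i) P 1+i<n-1 neg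
    ... | inj₂ refl    = gfᶜ-fire-fork P neg

  size : ℕ → ℕ
  size m = length (enum m)

  gfᶜ-full : gfᶜ full ≋ (λ m → + (size m + size m))
  gfᶜ-full m = cong (λ c → + (c + c)) (cong length (filter-full (enum m)))
    where
    filter-full : ∀ (xs : List Pos) → filter (holds? (full {Pos})) xs ≡ xs
    filter-full []       = refl
    filter-full (x ∷ xs) = cong (x ∷_) (filter-full xs)

  total-size : (λ m → + (size m + size m)) ⊗ D (qˢ ^ˢ wt₀) 1ˢ (qˢ ^ˢ wt₁) n
             ≋ qfact (qˢ ^ˢ wt₁) n ⊗ (X (qˢ ^ˢ wt₀) (qˢ ^ˢ wt₁) n ⊗ X 1ˢ (qˢ ^ˢ wt₁) n)
  total-size = ˢ.trans (ˢ.*-congʳ (ˢ.sym gfᶜ-full)) (Total.total counting)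

-- Foldings

-- Order 4 is sent to 1 as well, so that on the orders of B̃ this describes the graph with its label
-- forgotten, which is what can be compared with D̃.
cartan₁ : ℕ → ℤ
cartan₁ 1 = -[1+ 1 ]
cartan₁ 3 = + 1
cartan₁ 4 = + 1
cartan₁ _ = + 0

module TypeD (N : ℕ) where

  mD : ℕ → ℕ → ℕ
  mD = entry (labD N)

  cartanᴰ : ℕ → ℕ → ℤ
  cartanᴰ a b = cartan₁ (mD a b)

  open Linear (suc N) cartanᴰ public renaming (Pos to Posᴰ; act to actᴰ; at-act to at-actᴰ)

  labD-cases : ∀ a b → (labD N a b ≡ 2) ⊎ (labD N a b ≡ 3)
  labD-cases a b with (((a ≡ᵇ 0) ∨ (a ≡ᵇ 1)) ∧ (b ≡ᵇ 2)) ∨ ((2 ≤ᵇ a) ∧ (a ≤ᵇ N ∸ 3) ∧ (b ≡ᵇ suc a)) ∨ ((a ≡ᵇ N ∸ 2) ∧ ((b ≡ᵇ N ∸ 1) ∨ (b ≡ᵇ N)))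
  ... | true  = inj₂ refl
  ... | false = inj₁ refl

  rank2ᴰ : ∀ a b → a ≢ b → Rank2 (mD a b) (cartanᴰ a b) (cartanᴰ b a)
  rank2ᴰ a b a≢b rewrite entry-sym (labD N) b a | entry-≢ (labD N) a≢b with labD-cases (min a b) (max a b)
  ... | inj₁ e rewrite e = order2 refl refl refl
  ... | inj₂ e rewrite e = order3 refl refl refl

  gameᴰ : (base : Posᴰ) → (∀ i → + 0 ℤ.< at base (toℕ {suc N} i)) → GameData (MD N) Posᴰ
  gameᴰ base base-pos = record
    { A        = λ i j → cartanᴰ (toℕ i) (toℕ j)
    ; A-diag   = λ i → cong cartan₁ (entry-self (labD N) (toℕ i))
    ; M-diag   = λ i → entry-self (labD N) (toℕ i)
    ; M-sym    = λ i j → entry-sym (labD N) (toℕ i) (toℕ j)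
    ; rank2    = λ i j i≢j → rank2ᴰ (toℕ i) (toℕ j) (λ e → i≢j (Fin.toℕ-injective e))
    ; wt       = λ _ → 1
    ; wt-pos   = λ _ → s≤s z≤n
    ; wt-odd   = λ _ _ _ → refl
    ; val      = λ x i → at x (toℕ i)
    ; val-inj  = λ x y e → at-ext x y (λ l → subst (λ j → at x j ≡ at y j) (Fin.toℕ-fromℕ< l) (e (fromℕ< l)))
    ; act      = λ i → actᴰ (toℕ i)
    ; val-act  = λ i x j → at-actᴰ (toℕ i) x (Fin.toℕ<n j)
    ; base     = base
    ; base-pos = base-pos
    }

module Folding (p N : ℕ) (f κ : ℕ → ℕ) where
  open Affine-B p
  open Affine-C n using (Pos)
  open TypeD N

  B : ℕ → ℕ → ℤ
  B i j = cartanᴮ i (mB i j)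

  -- A symmetric position of D̃: constant on the fibres of `f` up to the factors κ. These factors
  -- absorb the asymmetry of the bond of order 4 where a fibre consists of the middle node alone.
  unfold : Pos → Posᴰ
  unfold x = build (suc N) (λ s → + κ s ℤ.* valᴮ x (f s))

  at-unfold : ∀ x {s} → s ≤ N → at (unfold x) s ≡ + κ s ℤ.* valᴮ x (f s)
  at-unfold x l = at-build (suc N) (λ s → + κ s ℤ.* valᴮ x (f s)) (s≤s l)

  -- The three shapes of the longest element of a fibre of the folding, with the condition that
  -- firing it is compatible with unfold.
  data Letter (i : ℕ) : Word (suc N) → ℕ → Set where
    single : ∀ g → f (toℕ g) ≡ i → (∀ s → s ≤ N → cartanᴰ (toℕ g) s ℤ.* + κ (toℕ g) ≡ + κ s ℤ.* B i (f s)) → Letter i (g ∷ []) 1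
    pair   : ∀ g h → f (toℕ g) ≡ i → f (toℕ h) ≡ i → κ (toℕ g) ≡ 1 → κ (toℕ h) ≡ 1 → cartanᴰ (toℕ g) (toℕ h) ≡ + 0 →
             (∀ s → s ≤ N → cartanᴰ (toℕ g) s ℤ.+ cartanᴰ (toℕ h) s ≡ + κ s ℤ.* B i (f s)) → Letter i (g ∷ h ∷ []) 2
    triple : ∀ g h → f (toℕ g) ≡ i → f (toℕ h) ≡ i → κ (toℕ g) ≡ 1 → κ (toℕ h) ≡ 1 → cartanᴰ (toℕ g) (toℕ h) ≡ + 1 → cartanᴰ (toℕ h) (toℕ g) ≡ + 1 →
             (∀ s → s ≤ N → + 2 ℤ.* (cartanᴰ (toℕ g) s ℤ.+ cartanᴰ (toℕ h) s) ≡ + κ s ℤ.* B i (f s)) → Letter i (g ∷ h ∷ g ∷ []) 3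

  module Folded (f≤n : ∀ {s} → s ≤ N → f s ≤ n) (κ>0 : ∀ s → 1 ≤ κ s)
                (wt₀ wt₁ : ℕ) (wt₀≥1 : 1 ≤ wt₀) (wt₁≥1 : 1 ≤ wt₁) (φ : Fin (suc n) → Word (suc N))
                (letters : ∀ i → Letter (toℕ i) (φ i) (Weighted.weight wt₀ wt₁ wt₀≥1 wt₁≥1 (toℕ i))) where
    open Weighted wt₀ wt₁ wt₀≥1 wt₁≥1

    private
      κ-neg : ∀ s {v} → v ℤ.< + 0 → + κ s ℤ.* v ℤ.< + 0
      κ-neg s {v} v<0 with κ s | κ>0 s
      ... | suc k | _ = ℤ.<-≤-trans (ℤ.*-monoˡ-<-pos (+ suc k) v<0) (ℤ.≤-reflexive (ℤ.*-zeroʳ (+ suc k)))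
      κ-pos : ∀ s {v} → + 0 ℤ.< v → + 0 ℤ.< + κ s ℤ.* v
      κ-pos s {v} v>0 with κ s | κ>0 s
      ... | suc k | _ = ℤ.≤-<-trans (ℤ.≤-reflexive (sym (ℤ.*-zeroʳ (+ suc k)))) (ℤ.*-monoˡ-<-pos (+ suc k) v>0)

    baseᴮ : Pos
    baseᴮ = GameData.base gameᴮ

    baseᴮ-pos : ∀ {i} → i ≤ n → + 0 ℤ.< valᴮ baseᴮ i
    baseᴮ-pos l = subst (λ j → + 0 ℤ.< valᴮ baseᴮ j) (Fin.toℕ-fromℕ< (s≤s l)) (GameData.base-pos gameᴮ (fromℕ< (s≤s l)))

    gD : GameData (MD N) Posᴰ
    gD = gameᴰ (unfold baseᴮ) λ i → subst (+ 0 ℤ.<_) (sym (at-unfold baseᴮ (Fin.toℕ≤pred[n] i))) (κ-pos (toℕ i) (baseᴮ-pos (f≤n (Fin.toℕ≤pred[n] i))))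

    module 𝔹 = Play gameᴮ
    module 𝔻 = Play gD
    open 𝔻 using ([]; _∷_; _!_)

    at-unit : ∀ x {i} (g : Fin (suc N)) → f (toℕ g) ≡ i → κ (toℕ g) ≡ 1 → at (unfold x) (toℕ g) ≡ valᴮ x i
    at-unit x g refl κ≡1 = trans (at-unfold x (Fin.toℕ≤pred[n] g)) (trans (cong (λ k → + k ℤ.* valᴮ x (f (toℕ g))) κ≡1) (ℤ.*-identityˡ _))

    at-unfold-act : ∀ x {i s} → i ≤ n → s ≤ N → at (unfold (actᴮ i x)) s ≡ at (unfold x) s ℤ.+ + κ s ℤ.* B i (f s) ℤ.* valᴮ x i
    at-unfold-act x {i} {s} i≤n s≤N = trans (at-unfold (actᴮ i x) s≤N) (trans (cong (ℤ._*_ (+ κ s)) (valᴮ-act i x (f s) i≤n (f≤n s≤N)))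
      (trans (lem (+ κ s) (valᴮ x (f s)) (B i (f s)) (valᴮ x i)) (cong (λ a → a ℤ.+ + κ s ℤ.* B i (f s) ℤ.* valᴮ x i) (sym (at-unfold x s≤N)))))
      where lem : ∀ k v b w → k ℤ.* (v ℤ.+ b ℤ.* w) ≡ k ℤ.* v ℤ.+ k ℤ.* b ℤ.* w
            lem = ℤ-Solver.solve-∀

    play-letter : ∀ {i w m} x → i ≤ n → Letter i w m → 𝔻.play w (unfold x) ≡ unfold (actᴮ i x)
    play-letter {i} x i≤n (single g refl cond) = at-ext _ _ λ {s} l →
      trans (at-actᴰ (toℕ g) (unfold x) l) (trans (cong (λ a → at (unfold x) s ℤ.+ cartanᴰ (toℕ g) s ℤ.* a) (at-unfold x (Fin.toℕ≤pred[n] g)))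
      (trans (cong (λ a → at (unfold x) s ℤ.+ a) (trans (sym (ℤ.*-assoc (cartanᴰ (toℕ g) s) (+ κ (toℕ g)) (valᴮ x i))) (cong (λ a → a ℤ.* valᴮ x i) (cond s (≤-pred l)))))
             (sym (at-unfold-act x i≤n (≤-pred l)))))
    play-letter {i} x i≤n (pair g h fg fh κg κh gh cond) = at-ext _ _ λ {s} l →
      trans (at-actᴰ (toℕ h) _ l) (trans (cong₂ (λ a b → a ℤ.+ cartanᴰ (toℕ h) s ℤ.* b) (at-actᴰ (toℕ g) (unfold x) l) (at-actᴰ (toℕ g) (unfold x) (Fin.toℕ<n h)))
      (trans (cong₂ (λ a b → (at (unfold x) s ℤ.+ cartanᴰ (toℕ g) s ℤ.* a) ℤ.+ cartanᴰ (toℕ h) s ℤ.* (b ℤ.+ cartanᴰ (toℕ g) (toℕ h) ℤ.* a)) (at-unit x g fg κg) (at-unit x h fh κh))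
      (trans (cong (λ c → (at (unfold x) s ℤ.+ cartanᴰ (toℕ g) s ℤ.* valᴮ x i) ℤ.+ cartanᴰ (toℕ h) s ℤ.* (valᴮ x i ℤ.+ c ℤ.* valᴮ x i)) gh)
      (trans (lem (at (unfold x) s) (cartanᴰ (toℕ g) s) (cartanᴰ (toℕ h) s) (valᴮ x i))
      (trans (cong (λ c → at (unfold x) s ℤ.+ c ℤ.* valᴮ x i) (cond s (≤-pred l)))
             (sym (at-unfold-act x i≤n (≤-pred l))))))))
      where lem : ∀ u a b v → (u ℤ.+ a ℤ.* v) ℤ.+ b ℤ.* (v ℤ.+ + 0 ℤ.* v) ≡ u ℤ.+ (a ℤ.+ b) ℤ.* v
            lem = ℤ-Solver.solve-∀
    -- The entries fired are v, 2 v and v, where v is the B̃-value at i, so that g and h each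
    -- contribute 2 v in total.
    play-letter {i} x i≤n (triple g h fg fh κg κh gh hg cond) = at-ext _ _ λ {s} l →
      trans (at-actᴰ (toℕ g) _ l)
      (trans (cong₂ (λ a b → a ℤ.+ cartanᴰ (toℕ g) s ℤ.* b)
          (trans (at-actᴰ (toℕ h) _ l) (cong₂ (λ a b → a ℤ.+ cartanᴰ (toℕ h) s ℤ.* b) (at-actᴰ (toℕ g) (unfold x) l) (at-act-h x)))
          (at-act-g x))
      (trans (cong (λ a → ((at (unfold x) s ℤ.+ cartanᴰ (toℕ g) s ℤ.* a) ℤ.+ cartanᴰ (toℕ h) s ℤ.* (valᴮ x i ℤ.+ valᴮ x i)) ℤ.+ cartanᴰ (toℕ g) s ℤ.* valᴮ x i) (at-unit x g fg κg))
      (trans (lem (at (unfold x) s) (cartanᴰ (toℕ g) s) (cartanᴰ (toℕ h) s) (valᴮ x i))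
      (trans (cong (λ c → at (unfold x) s ℤ.+ c ℤ.* valᴮ x i) (cond s (≤-pred l)))
             (sym (at-unfold-act x i≤n (≤-pred l)))))))
      where
      lem : ∀ u a b v → ((u ℤ.+ a ℤ.* v) ℤ.+ b ℤ.* (v ℤ.+ v)) ℤ.+ a ℤ.* v ≡ u ℤ.+ (+ 2 ℤ.* (a ℤ.+ b)) ℤ.* v
      lem = ℤ-Solver.solve-∀
      at-act-h : ∀ x → at (actᴰ (toℕ g) (unfold x)) (toℕ h) ≡ valᴮ x i ℤ.+ valᴮ x i
      at-act-h x = trans (at-actᴰ (toℕ g) (unfold x) (Fin.toℕ<n h)) (cong₂ ℤ._+_ (at-unit x h fh κh) (trans (cong₂ ℤ._*_ gh (at-unit x g fg κg)) (ℤ.*-identityˡ _)))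
      at-act-g : ∀ x → at (actᴰ (toℕ h) (actᴰ (toℕ g) (unfold x))) (toℕ g) ≡ valᴮ x i
      at-act-g x = trans (𝔻.val-iji g h gh hg (unfold x)) (at-unit x h fh κh)

    descends-letter : ∀ {i w m} x → valᴮ x i ℤ.< + 0 → Letter i w m → 𝔻.Descends w (unfold x)
    descends-letter x v<0 (single g refl cond) = subst (ℤ._< + 0) (sym (at-unfold x (Fin.toℕ≤pred[n] g))) (κ-neg (toℕ g) v<0) ∷ []
    descends-letter {i} x v<0 (pair g h fg fh κg κh gh cond) =
      subst (ℤ._< + 0) (sym (at-unit x g fg κg)) v<0
      ∷ subst (ℤ._< + 0) (sym (trans (at-actᴰ (toℕ g) (unfold x) (Fin.toℕ<n h)) (trans (cong₂ (λ a c → a ℤ.+ c ℤ.* at (unfold x) (toℕ g)) (at-unit x h fh κh) gh) (ℤ.+-identityʳ _)))) v<0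
      ∷ []
    descends-letter {i} x v<0 (triple g h fg fh κg κh gh hg cond) =
      subst (ℤ._< + 0) (sym (at-unit x g fg κg)) v<0
      ∷ subst (ℤ._< + 0) (sym (trans (at-actᴰ (toℕ g) (unfold x) (Fin.toℕ<n h)) (cong₂ ℤ._+_ (at-unit x h fh κh) (trans (cong₂ ℤ._*_ gh (at-unit x g fg κg)) (ℤ.*-identityˡ _))))) (ℤ.+-mono-< v<0 v<0)
      ∷ subst (ℤ._< + 0) (sym (trans (𝔻.val-iji g h gh hg (unfold x)) (at-unit x h fh κh))) v<0
      ∷ []

    length-letter : ∀ {i w m} → Letter i w m → length w ≡ m
    length-letter (single _ _ _)             = refl
    length-letter (pair _ _ _ _ _ _ _ _)     = refl
    length-letter (triple _ _ _ _ _ _ _ _ _) = refl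

    pos-extend : ∀ w → 𝔻.pos (extend φ w) ≡ unfold (𝔹.pos w)
    pos-extend []      = refl
    pos-extend (i ∷ w) = trans (𝔻.posFrom-++ (φ i) (extend φ w)) (trans (cong (𝔻.posFrom (φ i)) (trans (pos-extend w)
        (trans (cong unfold (sym (𝔹.act-invol i (𝔹.pos w)))) (sym (play-letter (actᴮ (toℕ i) (𝔹.pos w)) (Fin.toℕ≤pred[n] i) (letters i))))))
      (𝔻.posFrom-play (φ i) _))

    -- Each letter of a B̃-play becomes a descending word in one fibre, so reduced words expand to
    -- reduced words. Hence the D̃-length of φ(w) is the weight of a reduced word of w.
    reduced-extend : ∀ u {x} → 𝔹.Reduced u x → 𝔻.Reduced (extend φ u) (unfold x)
    reduced-extend [] (_ 𝔹.! refl) = [] ! refl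
    reduced-extend (i ∷ u) {x} ((v<0 𝔹.∷ d) 𝔹.! e) = 𝔻.reduced-++ (φ i) (descends-letter x v<0 (letters i))
      (subst (𝔻.Reduced (extend φ u)) (sym (play-letter x (Fin.toℕ≤pred[n] i) (letters i))) (reduced-extend u (d 𝔹.! e)))

    length-extend : ∀ u → length (extend φ u) ≡ 𝔹.wtʷ u
    length-extend []      = refl
    length-extend (i ∷ u) = trans (length-++ (φ i)) (cong₂ _+_ (length-letter (letters i)) (length-extend u))

    hasLength : ∀ {u w} → 𝔹.Reduced u (𝔹.pos w) → HasLength (MD N) (extend φ w) (𝔹.wtʷ u)
    hasLength {u} {w} r = subst (HasLength (MD N) (extend φ w)) (length-extend u)
      (𝔻.reduced⇒HasLength (λ _ → refl) (subst (𝔻.Reduced (extend φ u)) (sym (pos-extend w)) (reduced-extend u r)))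

    open Enumerated-B p wt₀ wt₁ wt₀≥1 wt₁≥1 using (size)

    isUSeries : IsUSeries n (MD N) φ size
    isUSeries = Enumerate.countsTo gameᴮ _≟ᵛ_ (λ w → HasLength (MD N) (extend φ w))
      λ {u} {w} r → (λ h → HasLength-unique (hasLength {u} {w} r) h) , (λ e → subst (HasLength (MD N) (extend φ w)) e (hasLength {u} {w} r))

-- The graphs of D̃ and B̃ compared

T⇒≡true : ∀ {b} → T b → b ≡ true
T⇒≡true {true} _ = refl

¬T⇒≡false : ∀ {b} → ¬ T b → b ≡ false
¬T⇒≡false {true}  n = ⊥-elim (n tt)
¬T⇒≡false {false} n = refl

≡ᵇ⁺ : ∀ {a b} → a ≡ b → T (a ≡ᵇ b)
≡ᵇ⁺ = ≡⇒≡ᵇ _ _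

≡ᵇ⁻ : ∀ {a b} → T (a ≡ᵇ b) → a ≡ b
≡ᵇ⁻ = ≡ᵇ⇒≡ _ _

≤ᵇ⁺ : ∀ {a b} → a ≤ b → T (a ≤ᵇ b)
≤ᵇ⁺ = ≤⇒≤ᵇ

≤ᵇ⁻ : ∀ {a b} → T (a ≤ᵇ b) → a ≤ b
≤ᵇ⁻ = ≤ᵇ⇒≤ _ _

∧⁺ : ∀ {x y} → T x → T y → T (x ∧ y)
∧⁺ a b = Equivalence.from Bool.T-∧ (a , b)

∧⁻ : ∀ {x y} → T (x ∧ y) → T x × T y
∧⁻ = Equivalence.to Bool.T-∧

∨⁺ : ∀ {x y} → T x ⊎ T y → T (x ∨ y)
∨⁺ = Equivalence.from Bool.T-∨

∨⁻ : ∀ {x y} → T (x ∨ y) → T x ⊎ T y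
∨⁻ = Equivalence.to Bool.T-∨

EdgeD : ℕ → ℕ → ℕ → Set
EdgeD N a b = ((a ≡ 0 ⊎ a ≡ 1) × b ≡ 2) ⊎ (2 ≤ a × a ≤ N ∸ 3 × b ≡ suc a) ⊎ (a ≡ N ∸ 2 × (b ≡ N ∸ 1 ⊎ b ≡ N))

labD-edge : ∀ N a b → EdgeD N a b → labD N a b ≡ 3
labD-edge N a b e = cong (λ c → if c then 3 else 2) (T⇒≡true (∨⁺ (test e)))
  where
  test : EdgeD N a b → T (((a ≡ᵇ 0) ∨ (a ≡ᵇ 1)) ∧ (b ≡ᵇ 2)) ⊎ T (((2 ≤ᵇ a) ∧ (a ≤ᵇ N ∸ 3) ∧ (b ≡ᵇ suc a)) ∨ ((a ≡ᵇ N ∸ 2) ∧ ((b ≡ᵇ N ∸ 1) ∨ (b ≡ᵇ N))))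
  test (inj₁ (inj₁ a0 , b2))       = inj₁ (∧⁺ (∨⁺ (inj₁ (≡ᵇ⁺ a0))) (≡ᵇ⁺ b2))
  test (inj₁ (inj₂ a1 , b2))       = inj₁ (∧⁺ (∨⁺ {a ≡ᵇ 0} (inj₂ (≡ᵇ⁺ a1))) (≡ᵇ⁺ b2))
  test (inj₂ (inj₁ (l , l′ , e)))  = inj₂ (∨⁺ (inj₁ (∧⁺ (≤ᵇ⁺ l) (∧⁺ (≤ᵇ⁺ l′) (≡ᵇ⁺ e)))))
  test (inj₂ (inj₂ (e , inj₁ e′))) = inj₂ (∨⁺ {(2 ≤ᵇ a) ∧ (a ≤ᵇ N ∸ 3) ∧ (b ≡ᵇ suc a)} (inj₂ (∧⁺ (≡ᵇ⁺ e) (∨⁺ (inj₁ (≡ᵇ⁺ e′))))))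
  test (inj₂ (inj₂ (e , inj₂ e′))) = inj₂ (∨⁺ {(2 ≤ᵇ a) ∧ (a ≤ᵇ N ∸ 3) ∧ (b ≡ᵇ suc a)} (inj₂ (∧⁺ (≡ᵇ⁺ e) (∨⁺ {b ≡ᵇ N ∸ 1} (inj₂ (≡ᵇ⁺ e′))))))

labD-nonedge : ∀ N a b → ¬ EdgeD N a b → labD N a b ≡ 2
labD-nonedge N a b ne = cong (λ c → if c then 3 else 2) (¬T⇒≡false (λ t → ne (untest (∨⁻ t))))
  where
  untest : T (((a ≡ᵇ 0) ∨ (a ≡ᵇ 1)) ∧ (b ≡ᵇ 2)) ⊎ T (((2 ≤ᵇ a) ∧ (a ≤ᵇ N ∸ 3) ∧ (b ≡ᵇ suc a)) ∨ ((a ≡ᵇ N ∸ 2) ∧ ((b ≡ᵇ N ∸ 1) ∨ (b ≡ᵇ N)))) → EdgeD N a b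
  untest (inj₁ t) with ∧⁻ {(a ≡ᵇ 0) ∨ (a ≡ᵇ 1)} t
  ... | t₁ , t₂ with ∨⁻ {a ≡ᵇ 0} t₁
  ... | inj₁ u = inj₁ (inj₁ (≡ᵇ⁻ u) , ≡ᵇ⁻ t₂)
  ... | inj₂ u = inj₁ (inj₂ (≡ᵇ⁻ u) , ≡ᵇ⁻ t₂)
  untest (inj₂ t) with ∨⁻ {(2 ≤ᵇ a) ∧ (a ≤ᵇ N ∸ 3) ∧ (b ≡ᵇ suc a)} t
  ... | inj₁ u with ∧⁻ {2 ≤ᵇ a} u
  ... | u₁ , u₂ with ∧⁻ {a ≤ᵇ N ∸ 3} u₂
  ... | u₃ , u₄ = inj₂ (inj₁ (≤ᵇ⁻ u₁ , ≤ᵇ⁻ u₃ , ≡ᵇ⁻ u₄))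
  untest (inj₂ t) | inj₂ u with ∧⁻ {a ≡ᵇ N ∸ 2} u
  ... | u₁ , u₂ with ∨⁻ {b ≡ᵇ N ∸ 1} u₂
  ... | inj₁ v = inj₂ (inj₂ (≡ᵇ⁻ u₁ , inj₁ (≡ᵇ⁻ v)))
  ... | inj₂ v = inj₂ (inj₂ (≡ᵇ⁻ u₁ , inj₂ (≡ᵇ⁻ v)))

module Halves (p : ℕ) where
  open Affine-B p

  -- The edges i < j of the unlabelled graph; the bond of order 4 between 0 and 1 is the case i = 0
  -- of the first alternative.
  EdgeB : ℕ → ℕ → Set
  EdgeB i j = (i ≤ p × j ≡ suc i) ⊎ (i ≡ suc p × (j ≡ n-1 ⊎ j ≡ n))

  E : ℕ → ℕ → ℤ
  E i j = cartan₁ (mB i j)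

  edgeB : ∀ i j → i < j → j ≤ n → (EdgeB i j × cartan₁ (labB n i j) ≡ + 1) ⊎ (¬ EdgeB i j × cartan₁ (labB n i j) ≡ + 0)
  edgeB i j i<j j≤n with j ℕ.≟ suc i
  edgeB zero _ i<j j≤n | yes refl = inj₁ (inj₁ (z≤n , refl) , refl)
  edgeB (suc i) _ i<j j≤n | yes refl with i ℕ.≤? p
  ... | no i≰p = inj₂ (non , trans (cong (λ k → cartan₁ (labB n (suc k) (suc (suc k)))) i≡1+p) (cong cartan₁ labB-tip))
    where i≡1+p : i ≡ suc p
          i≡1+p = ≤-antisym (≤-pred (≤-pred j≤n)) (≰⇒> i≰p)
          non : ¬ EdgeB (suc i) (suc (suc i))
          non (inj₁ (l , _)) = i≰p (<⇒≤ l)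
          non (inj₂ (e , _)) = i≰p (≤-reflexive (suc-injective e))
  ... | yes i≤p with m≤n⇒m<n∨m≡n i≤p
  ... | inj₁ i<p  = inj₁ (inj₁ (i<p , refl) , cong cartan₁ (labB-step i i≤p))
  ... | inj₂ refl = inj₁ (inj₂ (refl , inj₁ refl) , cong cartan₁ (labB-step i i≤p))
  edgeB i j i<j j≤n | no j≢1+i with i ℕ.≟ suc p | j ℕ.≟ n
  ... | yes refl | yes refl = inj₁ (inj₂ (refl , inj₂ refl) , cong cartan₁ labB-fork)
  ... | no i≢    | _        = inj₂ ((λ { (inj₁ (_ , e)) → j≢1+i e ; (inj₂ (e , _)) → i≢ e }) , cong cartan₁ (labB-far i j (≤∧≢⇒< i<j (≢-sym j≢1+i)) (λ { (e , _) → i≢ e })))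
  ... | yes refl | no j≢n   = inj₂ ((λ { (inj₁ (l , _)) → <-irrefl refl l ; (inj₂ (_ , inj₁ e)) → j≢1+i e ; (inj₂ (_ , inj₂ e)) → j≢n e })
                                   , cong cartan₁ (labB-far i j (≤∧≢⇒< i<j (≢-sym j≢1+i)) (λ { (_ , e) → j≢n e })))

  labD≡labB : ∀ {N a b i j} → i < j → j ≤ n → (EdgeD N a b → EdgeB i j) → (EdgeB i j → EdgeD N a b) → cartan₁ (labD N a b) ≡ cartan₁ (labB n i j)
  labD≡labB {N} {a} {b} {i} {j} l j≤n to from with edgeB i j l j≤n
  ... | inj₁ (e , q)  = trans (cong cartan₁ (labD-edge N a b (from e))) (sym q)
  ... | inj₂ (ne , q) = trans (cong cartan₁ (labD-nonedge N a b (λ e → ne (to e)))) (sym q)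

  -- The nodes c, …, c + n of D̃, for N = c + n, form a copy of the graph of B̃ without labels.
  module UpperHalf (c : ℕ) (3≤c : 3 ≤ c) where
    N : ℕ
    N = c + n
    open TypeD N using (mD; cartanᴰ)

    private
      N-3 : N ∸ 3 ≡ c + p
      N-3 = +-∸-assoc c {n} {3} (s≤s (s≤s (s≤s z≤n)))
      N-2 : N ∸ 2 ≡ c + suc p
      N-2 = +-∸-assoc c {n} {2} (s≤s (s≤s z≤n))
      N-1 : N ∸ 1 ≡ c + suc (suc p)
      N-1 = +-∸-assoc c {n} {1} (s≤s z≤n)
      c+≥3 : ∀ i → 3 ≤ c + i
      c+≥3 i = ≤-trans 3≤c (m≤m+n c i)

      cancel : ∀ {i j} → c + i ≡ c + j → i ≡ j
      cancel {i} {j} = +-cancelˡ-≡ c i j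

      to : ∀ {i j} → EdgeD N (c + i) (c + j) → EdgeB i j
      to {i} (inj₁ (inj₁ e , _)) = ⊥-elim (<⇒≱ (c+≥3 i) (≤-trans (≤-reflexive e) z≤n))
      to {i} (inj₁ (inj₂ e , _)) = ⊥-elim (<⇒≱ (c+≥3 i) (≤-trans (≤-reflexive e) (s≤s z≤n)))
      to {i} {j} (inj₂ (inj₁ (_ , l , e))) = inj₁ (+-cancelˡ-≤ c i p (subst (c + i ≤_) N-3 l) , cancel (trans e (sym (+-suc c i))))
      to (inj₂ (inj₂ (e , inj₁ e′))) = inj₂ (cancel (trans e N-2) , inj₁ (cancel (trans e′ N-1)))
      to (inj₂ (inj₂ (e , inj₂ e′))) = inj₂ (cancel (trans e N-2) , inj₂ (cancel e′))

      from : ∀ {i j} → EdgeB i j → EdgeD N (c + i) (c + j)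
      from {i} (inj₁ (l , refl))       = inj₂ (inj₁ (≤-trans (s≤s (s≤s z≤n)) (c+≥3 i) , subst (c + i ≤_) (sym N-3) (+-monoʳ-≤ c l) , +-suc c i))
      from (inj₂ (refl , inj₁ refl))   = inj₂ (inj₂ (sym N-2 , inj₁ (sym N-1)))
      from (inj₂ (refl , inj₂ refl))   = inj₂ (inj₂ (sym N-2 , inj₂ refl))

    upper-< : ∀ {i j} → i < j → j ≤ n → cartan₁ (labD N (c + i) (c + j)) ≡ cartan₁ (labB n i j)
    upper-< l j≤n = labD≡labB l j≤n to from

    upper : ∀ i j → i ≤ n → j ≤ n → cartanᴰ (c + i) (c + j) ≡ E i j
    upper i j i≤n j≤n with <-cmp i j
    ... | tri< l _ _    = trans (cong cartan₁ (entry-< (labD N) (+-monoʳ-< c l))) (trans (upper-< l j≤n) (cong cartan₁ (sym (entry-< (labB n) l))))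
    ... | tri≈ _ refl _ = trans (cong cartan₁ (entry-self (labD N) (c + i))) (cong cartan₁ (sym (entry-self (labB n) i)))
    ... | tri> _ _ l    = trans (cong cartan₁ (entry-> (labD N) (+-monoʳ-< c l))) (trans (upper-< l i≤n) (cong cartan₁ (sym (entry-> (labB n) l))))

  -- The nodes n, …, 0 of D̃ form another copy, if N is large enough.
  module LowerHalf (N : ℕ) (n+n≤N : n + n ≤ N) where
    open TypeD N using (mD; cartanᴰ)

    private
      n≤N-3 : n ≤ N ∸ 3
      n≤N-3 = ≤-trans (≤-trans (m≤m+n n p) (≤-reflexive (sym (+-∸-assoc n {n} {3} (s≤s (s≤s (s≤s z≤n))))))) (∸-monoˡ-≤ 3 n+n≤N)
      n<N-2 : n < N ∸ 2
      n<N-2 = <-≤-trans (m<m+n n (s≤s z≤n)) (≤-trans (≤-reflexive (sym (+-∸-assoc n {n} {2} (s≤s (s≤s z≤n))))) (∸-monoˡ-≤ 2 n+n≤N))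

      to : ∀ {a b i j} → b + j ≡ n → a + i ≡ n → EdgeD N b a → EdgeB i j
      to refl a+i (inj₁ (inj₁ refl , refl)) = inj₂ (suc-injective (suc-injective a+i) , inj₂ refl)
      to b+j  a+i (inj₁ (inj₂ refl , refl)) = inj₂ (suc-injective (suc-injective a+i) , inj₁ (suc-injective b+j))
      to {b = b} {i} {j} b+j a+i (inj₂ (inj₁ (l , _ , refl))) =
        inj₁ (≤-pred (≤-pred (≤-pred (≤-trans (+-monoˡ-≤ i (s≤s l)) (≤-reflexive a+i)))) , +-cancelˡ-≡ b j (suc i) (trans b+j (trans (sym a+i) (sym (+-suc b i)))))
      to {b = b} {j = j} b+j a+i (inj₂ (inj₂ (e , _))) = ⊥-elim (<⇒≱ n<N-2 (≤-trans (≤-reflexive (sym e)) (m+n≤o⇒m≤o b (≤-reflexive b+j))))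

      from : ∀ {a b i j} → b + j ≡ n → a + i ≡ n → EdgeB i j → EdgeD N b a
      from {a} {b} {i} b+j a+i (inj₁ (l , refl)) = inj₂ (inj₁ (2≤b , ≤-trans (m+n≤o⇒m≤o b (≤-reflexive b+j)) n≤N-3 , a≡1+b))
        where
        a≡1+b : a ≡ suc b
        a≡1+b = +-cancelʳ-≡ i a (suc b) (trans a+i (trans (sym b+j) (+-suc b i)))
        2≤b : 2 ≤ b
        2≤b = +-cancelʳ-≤ (suc i) 2 b (≤-trans (s≤s (s≤s (s≤s l))) (≤-reflexive (sym b+j)))
      from {a} {b} b+j a+i (inj₂ (refl , inj₁ refl)) = inj₁ (inj₂ (+-cancelʳ-≡ n-1 b 1 b+j) , +-cancelʳ-≡ (suc p) a 2 a+i)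
      from {a} {b} b+j a+i (inj₂ (refl , inj₂ refl)) = inj₁ (inj₁ (+-cancelʳ-≡ n b 0 b+j) , +-cancelʳ-≡ (suc p) a 2 a+i)

      flip-< : ∀ {a b i j} → b + j ≡ n → a + i ≡ n → i < j → b < a
      flip-< {a} {b} {i} {j} b+j a+i l = ≰⇒> λ a≤b → <-irrefl (trans a+i (sym b+j)) (+-mono-≤-< a≤b l)

    lower : ∀ {a b} i j → a + i ≡ n → b + j ≡ n → cartanᴰ a b ≡ E i j
    lower {a} {b} i j a+i b+j with <-cmp i j
    ... | tri< l _ _    = trans (cong cartan₁ (entry-> (labD N) (flip-< b+j a+i l))) (trans (labD≡labB l (m+n≤o⇒n≤o b (≤-reflexive b+j)) (to b+j a+i) (from b+j a+i)) (cong cartan₁ (sym (entry-< (labB n) l))))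
    ... | tri≈ _ refl _ rewrite +-cancelʳ-≡ i a b (trans a+i (sym b+j)) = trans (cong cartan₁ (entry-self (labD N) b)) (cong cartan₁ (sym (entry-self (labB n) i)))
    ... | tri> _ _ l    = trans (cong cartan₁ (entry-< (labD N) (flip-< a+i b+j l))) (trans (labD≡labB l (m+n≤o⇒n≤o a (≤-reflexive a+i)) (to a+i b+j) (from a+i b+j)) (cong cartan₁ (sym (entry-> (labB n) l))))

    across : ∀ a b → a ≤ n → n ≤ b → suc a < b → cartanᴰ a b ≡ + 0
    across a b a≤n n≤b 1+a<b = trans (cong cartan₁ (entry-< (labD N) (<⇒≤ 1+a<b))) (cong cartan₁ (labD-nonedge N a b non))
      where
      non : ¬ EdgeD N a b
      non (inj₁ (_ , refl))         = case ≤-trans (s≤s (s≤s (s≤s z≤n))) n≤b of λ { (s≤s (s≤s ())) }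
      non (inj₂ (inj₁ (_ , _ , e))) = <-irrefl (sym e) 1+a<b
      non (inj₂ (inj₂ (e , _)))     = <⇒≱ n<N-2 (≤-trans (≤-reflexive (sym e)) a≤n)

toℕ-gen : ∀ k {m} → m ≤ k → toℕ (gen k m) ≡ m
toℕ-gen zero    z≤n     = refl
toℕ-gen (suc k) z≤n     = refl
toℕ-gen (suc k) (s≤s l) = cong suc (toℕ-gen k l)

cartanᴮ-suc : ∀ p i m → Affine-B.cartanᴮ p (suc i) m ≡ cartan₁ m
cartanᴮ-suc p i 0 = refl
cartanᴮ-suc p i 1 = refl
cartanᴮ-suc p i 2 = refl
cartanᴮ-suc p i 3 = refl
cartanᴮ-suc p i 4 = refl
cartanᴮ-suc p i (suc (suc (suc (suc (suc m))))) = refl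

module Part₁ (p : ℕ) where
  open Affine-B p

  f : ℕ → ℕ
  f zero    = 0
  f (suc s) = s

  open Folding p (suc n) f (λ _ → 1)
  open TypeD (suc n)

  letter₀ : ∀ s → s ≤ suc n → cartanᴰ 0 s ℤ.+ cartanᴰ 1 s ≡ + 1 ℤ.* B 0 (f s)
  letter₀ 0 l = refl
  letter₀ 1 l = refl
  letter₀ 2 l = refl
  letter₀ (suc (suc (suc s))) l = refl

  letter₊ : ∀ i s → cartanᴰ (suc (suc i)) s ℤ.* + 1 ≡ + 1 ℤ.* B (suc i) (f s)
  letter₊ zero    0 = refl
  letter₊ (suc i) 0 = refl
  letter₊ zero    1 = refl
  letter₊ (suc i) 1 = refl
  -- From node 2 of D̃ on, the graphs agree under the shift by one, and there `labD` computes to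
  -- `labB`.
  letter₊ i (suc (suc s)) = trans (ℤ.*-identityʳ _) (trans (sym (cartanᴮ-suc p i (mB (suc i) (suc s)))) (sym (ℤ.*-identityˡ _)))

  letters : ∀ r → Letter (toℕ r) (φ₁gen n r) (Weighted.weight 2 1 (s≤s z≤n) (s≤s z≤n) (toℕ r))
  letters Fin.zero    = pair (gen (suc n) 0) (gen (suc n) 1) refl refl refl refl refl letter₀
  letters (Fin.suc i) = single (gen (suc n) (suc (suc (toℕ i)))) (cong f toℕ-g)
      (λ s l → subst (λ g → cartanᴰ g s ℤ.* + 1 ≡ + 1 ℤ.* B (suc (toℕ i)) (f s)) (sym toℕ-g) (letter₊ (toℕ i) s))
    where toℕ-g : toℕ (gen (suc n) (suc (suc (toℕ i)))) ≡ suc (suc (toℕ i))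
          toℕ-g = toℕ-gen (suc n) (s≤s (Fin.toℕ<n i))

  f≤n : ∀ {s} → s ≤ suc n → f s ≤ n
  f≤n {zero}  l = z≤n
  f≤n {suc s} l = ≤-pred l

  isUSeries₁ : IsUSeries n (MD (suc n)) (φ₁gen n) (Enumerated-B.size p 2 1 (s≤s z≤n) (s≤s z≤n))
  isUSeries₁ = Folded.isUSeries f≤n (λ _ → s≤s z≤n) 2 1 (s≤s z≤n) (s≤s z≤n) (φ₁gen n) letters

module Swap (p : ℕ) where
  open Affine-B p
  open Halves p

  -- The symmetry of the fork; the folding maps of parts 2 and 3 swap its two ends.
  σ : ℕ → ℕ
  σ i with i ℕ.≟ n-1 | i ℕ.≟ n
  ... | yes _ | _     = n
  ... | no _  | yes _ = n-1
  ... | no _  | no _  = i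

  σ-low : ∀ {i} → i < n-1 → σ i ≡ i
  σ-low {i} l with i ℕ.≟ n-1 | i ℕ.≟ n
  ... | yes refl | _        = ⊥-elim (<-irrefl refl l)
  ... | no _     | yes refl = ⊥-elim (<-asym l ≤-refl)
  ... | no _     | no _     = refl

  σ-n-1 : σ n-1 ≡ n
  σ-n-1 with n-1 ℕ.≟ n-1
  ... | yes _ = refl
  ... | no n≢ = ⊥-elim (n≢ refl)

  σ-n : σ n ≡ n-1
  σ-n with n ℕ.≟ n-1 | n ℕ.≟ n
  ... | yes e | _     = ⊥-elim (1+n≢n e)
  ... | no _  | yes _ = refl
  ... | no _  | no n≢ = ⊥-elim (n≢ refl)

  data Node : ℕ → Set where
    low  : ∀ {i} → i < n-1 → Node i
    tip₁ : Node n-1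
    tip₂ : Node n

  node : ∀ {i} → i ≤ n → Node i
  node {i} l with m≤n⇒m<n∨m≡n l
  ... | inj₂ refl = tip₂
  ... | inj₁ i<n with m≤n⇒m<n∨m≡n (≤-pred i<n)
  ... | inj₂ refl = tip₁
  ... | inj₁ i<n-1 = low i<n-1

  σ≤n : ∀ {i} → i ≤ n → σ i ≤ n
  σ≤n l with node l
  ... | low l′ = subst (_≤ n) (sym (σ-low l′)) l
  ... | tip₁   = ≤-reflexive σ-n-1
  ... | tip₂   = ≤-trans (≤-reflexive σ-n) (n≤1+n _)

  σ-invol : ∀ {i} → i ≤ n → σ (σ i) ≡ i
  σ-invol l with node l
  ... | low l′ = trans (cong σ (σ-low l′)) (σ-low l′)
  ... | tip₁   = trans (cong σ σ-n-1) σ-n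
  ... | tip₂   = trans (cong σ σ-n) σ-n-1

  σ≥1 : ∀ {i} → i ≤ n → 1 ≤ i → 1 ≤ σ i
  σ≥1 l 1≤i with node l
  ... | low l′ = subst (1 ≤_) (sym (σ-low l′)) 1≤i
  ... | tip₁   = subst (1 ≤_) (sym σ-n-1) (s≤s z≤n)
  ... | tip₂   = subst (1 ≤_) (sym σ-n) (s≤s z≤n)

  labB-tips : ∀ {i} → i < n-1 → labB n i n-1 ≡ labB n i n
  labB-tips {i} l with m≤n⇒m<n∨m≡n (≤-pred l)
  ... | inj₁ i<1+p = trans (labB-far i n-1 (s≤s i<1+p) (λ { (_ , e) → 1+n≢n (sym e) }))
                       (sym (labB-far i n (s≤s l) (λ { (refl , _) → <-irrefl refl i<1+p })))
  ... | inj₂ refl = trans (labB-step p ≤-refl) (sym labB-fork)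

  mB-tips : ∀ {i} → i < n-1 → mB i n-1 ≡ mB i n
  mB-tips l = trans (entry-< (labB n) l) (trans (labB-tips l) (sym (entry-< (labB n) (m<n⇒m<1+n l))))

  mB-σ : ∀ {i j} → i ≤ n → j ≤ n → mB (σ i) (σ j) ≡ mB i j
  mB-σ {j = j} i≤n j≤n with node i≤n | node j≤n
  ... | low a | low b = cong₂ mB (σ-low a) (σ-low b)
  ... | low a | tip₁  = trans (cong₂ mB (σ-low a) σ-n-1) (sym (mB-tips a))
  ... | low a | tip₂  = trans (cong₂ mB (σ-low a) σ-n) (mB-tips a)
  ... | tip₁  | low b = trans (cong₂ mB σ-n-1 (σ-low b)) (trans (entry-sym (labB n) n j) (trans (sym (mB-tips b)) (entry-sym (labB n) j n-1)))
  ... | tip₂  | low b = trans (cong₂ mB σ-n (σ-low b)) (trans (entry-sym (labB n) n-1 j) (trans (mB-tips b) (entry-sym (labB n) j n)))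
  ... | tip₁  | tip₁  = trans (cong₂ mB σ-n-1 σ-n-1) (trans (entry-self (labB n) n) (sym (entry-self (labB n) n-1)))
  ... | tip₂  | tip₂  = trans (cong₂ mB σ-n σ-n) (trans (entry-self (labB n) n-1) (sym (entry-self (labB n) n)))
  ... | tip₁  | tip₂  = trans (cong₂ mB σ-n-1 σ-n) (entry-sym (labB n) n n-1)
  ... | tip₂  | tip₁  = trans (cong₂ mB σ-n σ-n-1) (entry-sym (labB n) n-1 n)

  E-σ : ∀ {i j} → i ≤ n → j ≤ n → E (σ i) j ≡ E i (σ j)
  E-σ {i} {j} i≤n j≤n = cong cartan₁ (trans (sym (mB-σ (σ≤n i≤n) j≤n)) (cong (λ k → mB k (σ j)) (σ-invol i≤n)))

  B₊ : ∀ {i j} → 1 ≤ i → cartanᴮ i (mB i j) ≡ E i j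
  B₊ {suc i} {j} _ = cartanᴮ-suc p i (mB (suc i) j)

  -- Off the diagonal, row 0 of B̃ is twice the row of the unlabelled graph, because the only
  -- neighbour of node 0 is at the bond of order 4. The swap of the tips does not affect adjacency
  -- to node 0.
  B₀ : ∀ {j} → 1 ≤ j → j ≤ n → cartanᴮ 0 (mB 0 (σ j)) ≡ + 2 ℤ.* E 0 j
  B₀ {j} 1≤j j≤n = trans (cong (cartanᴮ 0) (trans (sym (cong (λ k → mB k (σ j)) (σ-low (s≤s z≤n)))) (mB-σ z≤n j≤n))) double
    where
    double : cartanᴮ 0 (mB 0 j) ≡ + 2 ℤ.* cartan₁ (mB 0 j)
    double rewrite entry-< (labB n) 1≤j with labB-cases 0 j
    ... | inj₁ e                = trans (cong (cartanᴮ 0) e) (cong (λ m → + 2 ℤ.* cartan₁ m) (sym e))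
    ... | inj₂ (inj₁ (_ , 0≢0)) = ⊥-elim (0≢0 refl)
    ... | inj₂ (inj₂ (e , _))   = trans (cong (cartanᴮ 0) e) (cong (λ m → + 2 ℤ.* cartan₁ m) (sym e))

-- A folding of D̃ with N = c + n that identifies the nodes n - j and c + j, for c = n or c = n + 1.
module Symmetric (p c κ₀ : ℕ) (n≤c : Affine-B.n p ≤ c) (κ₀≥1 : 1 ≤ κ₀) where
  open Affine-B p
  open Halves p
  open Swap p

  N : ℕ
  N = c + n

  open UpperHalf c (≤-trans (s≤s (s≤s (s≤s z≤n))) n≤c) using (upper) public
  open LowerHalf N (+-monoˡ-≤ n n≤c) using (lower; across) public
  open TypeD N public

  -- The constant κ₀ counts the nodes of the pair n - 1, c + 1 that are adjacent to node n: both for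
  -- c = n, only the left one for c = n + 1. This is what `at-middle` asks for, so that firing a
  -- pair feeds node n by the right amount.
  f κ : ℕ → ℕ
  f s with s ℕ.≤? n
  ... | yes _ = σ (n ∸ s)
  ... | no _  = σ (s ∸ c)
  κ s with s ℕ.≟ n
  ... | yes _ = κ₀
  ... | no _  = 1

  open Folding p N f κ public

  data Side : ℕ → Set where
    middle : Side n
    left   : ∀ {a} j → a < n → a + j ≡ n → Side a
    right  : ∀ j → n < c + j → j ≤ n → Side (c + j)

  side : c ≤ suc n → ∀ s → s ≤ N → Side s
  side c≤1+n s l with <-cmp s n
  ... | tri≈ _ refl _ = middle
  ... | tri< s<n _ _  = left (n ∸ s) s<n (m+[n∸m]≡n (<⇒≤ s<n))
  ... | tri> _ _ n<s  = subst Side c+ (right (s ∸ c) (subst (n <_) (sym c+) n<s) (m≤n+o⇒m∸n≤o s c l))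
    where c+ : c + (s ∸ c) ≡ s
          c+ = m+[n∸m]≡n (≤-trans c≤1+n n<s)

  f-left : ∀ {a} j → a + j ≡ n → f a ≡ σ j
  f-left {a} j e with a ℕ.≤? n
  ... | yes _  = cong σ (trans (cong (_∸ a) (sym e)) (m+n∸m≡n a j))
  ... | no a≰n = ⊥-elim (a≰n (m+n≤o⇒m≤o a (≤-reflexive e)))

  f-right : ∀ j → n < c + j → f (c + j) ≡ σ j
  f-right j n<c+j with (c + j) ℕ.≤? n
  ... | yes l = ⊥-elim (<⇒≱ n<c+j l)
  ... | no _  = cong σ (m+n∸m≡n c j)

  f-middle : f n ≡ 0
  f-middle = trans (f-left 0 (+-identityʳ n)) (σ-low (s≤s z≤n))

  κ-middle : κ n ≡ κ₀
  κ-middle with n ℕ.≟ n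
  ... | yes _ = refl
  ... | no n≢ = ⊥-elim (n≢ refl)

  κ-other : ∀ {s} → s ≢ n → κ s ≡ 1
  κ-other {s} s≢n with s ℕ.≟ n
  ... | yes e = ⊥-elim (s≢n e)
  ... | no _  = refl

  κ-left : ∀ {a} → a < n → κ a ≡ 1
  κ-left a<n = κ-other (<⇒≢ a<n)

  κ-right : ∀ {b} → n < b → κ b ≡ 1
  κ-right n<b = κ-other (≢-sym (<⇒≢ n<b))

  cartanᴰ-sym : ∀ a b → cartanᴰ a b ≡ cartanᴰ b a
  cartanᴰ-sym a b = cong cartan₁ (entry-sym (labD N) a b)

  n<c+ : ∀ {k} → 1 ≤ k → n < c + k
  n<c+ 1≤k = ≤-<-trans n≤c (m<m+n c 1≤k)

  left≥1 : ∀ {a j} → a < n → a + j ≡ n → 1 ≤ j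
  left≥1 {a} {j} a<n e = +-cancelˡ-< a 0 j (subst₂ _<_ (sym (+-identityʳ a)) (sym e) a<n)

  across-< : ∀ {a b} → a < n → n < b → cartanᴰ a b ≡ + 0
  across-< a<n n<b = across _ _ (<⇒≤ a<n) (<⇒≤ n<b) (≤-<-trans a<n n<b)

  lower-middle : ∀ {s} j → s + j ≡ n → cartanᴰ n s ≡ E 0 j
  lower-middle j e = lower 0 j (+-identityʳ n) e

  module Letters (c≤1+n : c ≤ suc n) (at-middle : ∀ k → 1 ≤ k → k ≤ n → E k 0 ℤ.+ cartanᴰ (c + k) n ≡ + κ₀ ℤ.* E k 0) where

    letter₊ : ∀ {i} → 1 ≤ i → i ≤ n → ∀ {a} → a < n → a + σ i ≡ n → ∀ s → s ≤ N → cartanᴰ a s ℤ.+ cartanᴰ (c + σ i) s ≡ + κ s ℤ.* B i (f s)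
    letter₊ {i} 1≤i i≤n {a} a<n e s l with side c≤1+n s l
    ... | middle rewrite κ-middle | f-middle | lower {a} {n} (σ i) 0 e (+-identityʳ n) | at-middle (σ i) (σ≥1 i≤n 1≤i) (σ≤n i≤n)
        | B₊ {i} {0} 1≤i | E-σ {i} {0} i≤n z≤n | σ-low {0} (s≤s z≤n) = refl
    ... | left j s<n e′ rewrite κ-left s<n | f-left j e′ | B₊ {i} {σ j} 1≤i | lower {a} {s} (σ i) j e e′
        | cartanᴰ-sym (c + σ i) s | across-< s<n (n<c+ (σ≥1 i≤n 1≤i))
        | E-σ {i} {j} i≤n (m+n≤o⇒n≤o s (≤-reflexive e′)) = trans (ℤ.+-identityʳ _) (sym (ℤ.*-identityˡ _))
    ... | right j n<c+j j≤n rewrite κ-right n<c+j | f-right j n<c+j | B₊ {i} {σ j} 1≤i | upper (σ i) j (σ≤n i≤n) j≤n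
        | across-< a<n n<c+j | E-σ {i} {j} i≤n j≤n = trans (ℤ.+-identityˡ _) (sym (ℤ.*-identityˡ _))

    letter-pair : ∀ {i} → 1 ≤ i → i ≤ n → ∀ a b → a + σ i ≡ n → b ≡ c + σ i → Letter i (gen N a ∷ gen N b ∷ []) 2
    letter-pair {i} 1≤i i≤n a b e refl = pair (gen N a) (gen N (c + σ i))
        (trans (cong f g≡) (trans (f-left (σ i) e) (σ-invol i≤n)))
        (trans (cong f h≡) (trans (f-right (σ i) n<b) (σ-invol i≤n)))
        (trans (cong κ g≡) (κ-left a<n)) (trans (cong κ h≡) (κ-right n<b))
        (trans (cong₂ cartanᴰ g≡ h≡) (across-< a<n n<b))
        (λ s l → trans (cong₂ (λ x y → cartanᴰ x s ℤ.+ cartanᴰ y s) g≡ h≡) (letter₊ 1≤i i≤n a<n e s l))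
      where
      n<b : n < c + σ i
      n<b = n<c+ (σ≥1 i≤n 1≤i)
      a<n : a < n
      a<n = <-≤-trans (m<m+n a (σ≥1 i≤n 1≤i)) (≤-reflexive e)
      g≡ : toℕ (gen N a) ≡ a
      g≡ = toℕ-gen N (≤-trans (<⇒≤ a<n) (m≤n+m n c))
      h≡ : toℕ (gen N (c + σ i)) ≡ c + σ i
      h≡ = toℕ-gen N (+-monoʳ-≤ c (σ≤n i≤n))

    -- The common form of `φ₂gen` and `φ₃gen` at the generators other than r₀; it unfolds to the one
    -- for c = n and to the other for c = n + 1.
    pairWord : ℕ → Word (suc N)
    pairWord i = if i ≡ᵇ n ∸ 1 then gen N 0 ∷ gen N N ∷ [] else
                 if i ≡ᵇ n then gen N 1 ∷ gen N (N ∸ 1) ∷ [] else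
                 gen N (n ∸ i) ∷ gen N (c + i) ∷ []

    letter-pairWord : ∀ i → suc i ≤ n → Letter (suc i) (pairWord (suc i)) 2
    letter-pairWord i l with node l
    ... | tip₁ rewrite ≡ᵇ-refl p = letter-pair (s≤s z≤n) l 0 N σ-n-1 (cong (_+_ c) (sym σ-n-1))
    ... | tip₂ rewrite ≢⇒≡ᵇ {suc p} {p} 1+n≢n | ≡ᵇ-refl p = letter-pair (s≤s z≤n) l 1 (N ∸ 1) (cong suc σ-n)
                 (trans (+-∸-assoc c {n} {1} (s≤s z≤n)) (cong (_+_ c) (sym σ-n)))
    ... | low l′ rewrite ≢⇒≡ᵇ (λ e → <⇒≢ l′ (cong suc e)) | ≢⇒≡ᵇ (λ e → <⇒≢ (m<n⇒m<1+n l′) (cong suc e)) =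
      letter-pair (s≤s z≤n) l (n ∸ suc i) (c + suc i) (trans (cong (_+_ (n ∸ suc i)) (σ-low l′)) (m∸n+n≡m l)) (cong (_+_ c) (sym (σ-low l′)))

  f≤n : ∀ {s} → s ≤ N → f s ≤ n
  f≤n {s} l with s ℕ.≤? n
  ... | yes _ = σ≤n (m∸n≤m n s)
  ... | no _  = σ≤n (m≤n+o⇒m∸n≤o s c l)

  κ≥1 : ∀ s → 1 ≤ κ s
  κ≥1 s with s ℕ.≟ n
  ... | yes _ = κ₀≥1
  ... | no _  = s≤s z≤n

module Part₂ (p : ℕ) where
  open Affine-B p
  open Halves p
  open Swap p
  open Symmetric p n 2 ≤-refl (s≤s z≤n)

  upper-middle : ∀ j → j ≤ n → cartanᴰ n (n + j) ≡ E 0 j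
  upper-middle j l = trans (cong (λ k → cartanᴰ k (n + j)) (sym (+-identityʳ n))) (upper 0 j z≤n l)

  at-middle : ∀ k → 1 ≤ k → k ≤ n → E k 0 ℤ.+ cartanᴰ (n + k) n ≡ + 2 ℤ.* E k 0
  at-middle k _ k≤n = trans (cong (ℤ._+_ (E k 0)) (trans (cartanᴰ-sym (n + k) n)
    (trans (upper-middle k k≤n) (cong cartan₁ (entry-sym (labB n) 0 k))))) (twice (E k 0))
    where
    twice : ∀ x → x ℤ.+ x ≡ + 2 ℤ.* x
    twice = ℤ-Solver.solve-∀

  open Letters (n≤1+n n) at-middle

  letter₀ : ∀ s → s ≤ N → cartanᴰ n s ℤ.* + κ n ≡ + κ s ℤ.* B 0 (f s)
  letter₀ s l with side (n≤1+n n) s l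
  ... | middle rewrite κ-middle | f-middle | entry-self (labD N) n = refl
  ... | left j s<n e rewrite κ-middle | κ-left s<n | f-left j e | B₀ {j} (left≥1 s<n e) (m+n≤o⇒n≤o s (≤-reflexive e)) | lower-middle j e =
    trans (ℤ.*-comm (E 0 j) (+ 2)) (sym (ℤ.*-identityˡ _))
  ... | right j n<n+j j≤n rewrite κ-middle | κ-right n<n+j | f-right j n<n+j | B₀ {j} (+-cancelˡ-< n 0 j (subst (_< n + j) (sym (+-identityʳ n)) n<n+j)) j≤n | upper-middle j j≤n =
    trans (ℤ.*-comm (E 0 j) (+ 2)) (sym (ℤ.*-identityˡ _))

  letters : ∀ r → Letter (toℕ r) (φ₂gen n r) (Weighted.weight 1 2 (s≤s z≤n) (s≤s z≤n) (toℕ r))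
  letters Fin.zero    = single (gen N n) (trans (cong f n≡) f-middle) (λ s l → trans (cong₂ (λ x y → cartanᴰ x s ℤ.* + κ y) n≡ n≡) (letter₀ s l))
    where n≡ : toℕ (gen N n) ≡ n
          n≡ = toℕ-gen N (m≤m+n n n)
  letters (Fin.suc i) = letter-pairWord (toℕ i) (Fin.toℕ<n i)

  isUSeries₂ : IsUSeries n (MD (n + n)) (φ₂gen n) (Enumerated-B.size p 1 2 (s≤s z≤n) (s≤s z≤n))
  isUSeries₂ = Folded.isUSeries f≤n κ≥1 1 2 (s≤s z≤n) (s≤s z≤n) (φ₂gen n) letters

module Part₃ (p : ℕ) where
  open Affine-B p
  open Halves p
  open Swap p
  open Symmetric p (suc n) 1 (n≤1+n n) (s≤s z≤n)

  n<1+n+ : ∀ j → n < suc n + j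
  n<1+n+ j = s≤s (m≤m+n n j)

  κ≡1 : ∀ s → κ s ≡ 1
  κ≡1 s with s ℕ.≟ n
  ... | yes _ = refl
  ... | no _  = refl

  across-middle : ∀ k → 1 ≤ k → cartanᴰ n (suc n + k) ≡ + 0
  across-middle k 1≤k = across n (suc n + k) ≤-refl (<⇒≤ (n<1+n+ k)) (s≤s (m<m+n n 1≤k))

  at-middle : ∀ k → 1 ≤ k → k ≤ n → E k 0 ℤ.+ cartanᴰ (suc n + k) n ≡ + 1 ℤ.* E k 0
  at-middle k 1≤k _ = trans (cong (ℤ._+_ (E k 0)) (trans (cartanᴰ-sym (suc n + k) n) (across-middle k 1≤k)))
    (trans (ℤ.+-identityʳ _) (sym (ℤ.*-identityˡ _)))

  open Letters ≤-refl at-middle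

  bridge : cartanᴰ n (suc n) ≡ + 1
  bridge = cong cartan₁ (trans (entry-< (labD N) {n} {suc n} ≤-refl) (labD-edge N n (suc n)
    (inj₂ (inj₁ (s≤s (s≤s z≤n) , ≤-trans (m≤m+n n (suc p)) (≤-reflexive (trans (+-suc n p) (sym (+-∸-assoc (suc n) {n} {3} (s≤s (s≤s (s≤s z≤n))))))) , refl)))))

  letter₀ : ∀ s → s ≤ N → + 2 ℤ.* (cartanᴰ n s ℤ.+ cartanᴰ (suc n) s) ≡ + κ s ℤ.* B 0 (f s)
  letter₀ s l rewrite κ≡1 s with side ≤-refl s l
  ... | middle rewrite f-middle | entry-self (labD N) n | cartanᴰ-sym (suc n) n | bridge = refl
  ... | left j s<n e rewrite f-left j e | B₀ {j} (left≥1 s<n e) (m+n≤o⇒n≤o s (≤-reflexive e)) | lower-middle j e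
      | cartanᴰ-sym (suc n) s | across-< s<n (≤-refl {suc n}) =
    trans (cong (ℤ._*_ (+ 2)) (ℤ.+-identityʳ (E 0 j))) (sym (ℤ.*-identityˡ _))
  ... | right zero _ _ = trans (cong (λ k → + 2 ℤ.* (cartanᴰ n k ℤ.+ cartanᴰ (suc n) k)) (+-identityʳ (suc n)))
    (trans (cong₂ (λ x y → + 2 ℤ.* (x ℤ.+ y)) bridge (cong cartan₁ (entry-self (labD N) (suc n))))
      (sym (cong (λ k → + 1 ℤ.* B 0 k) (trans (f-right 0 (n<1+n+ 0)) (σ-low (s≤s z≤n))))))
  ... | right (suc j) _ j≤n rewrite f-right (suc j) (n<1+n+ (suc j)) | B₀ {suc j} (s≤s z≤n) j≤n | across-middle (suc j) (s≤s z≤n)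
      | trans (cong (λ k → cartanᴰ k (suc n + suc j)) (sym (+-identityʳ (suc n)))) (upper 0 (suc j) z≤n j≤n) =
    trans (cong (ℤ._*_ (+ 2)) (ℤ.+-identityˡ (E 0 (suc j)))) (sym (ℤ.*-identityˡ _))

  letters : ∀ r → Letter (toℕ r) (φ₃gen n r) (Weighted.weight 3 2 (s≤s z≤n) (s≤s z≤n) (toℕ r))
  letters Fin.zero    = triple (gen N n) (gen N (suc n))
      (trans (cong f g≡) f-middle) (trans (cong f (trans h≡ (sym (+-identityʳ (suc n))))) (trans (f-right 0 (n<1+n+ 0)) (σ-low (s≤s z≤n))))
      (κ≡1 _) (κ≡1 _) (trans (cong₂ cartanᴰ g≡ h≡) bridge) (trans (cong₂ cartanᴰ h≡ g≡) (trans (cartanᴰ-sym (suc n) n) bridge))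
      (λ s l → trans (cong₂ (λ x y → + 2 ℤ.* (cartanᴰ x s ℤ.+ cartanᴰ y s)) g≡ h≡) (letter₀ s l))
    where
    g≡ : toℕ (gen N n) ≡ n
    g≡ = toℕ-gen N (m≤n+m n (suc n))
    h≡ : toℕ (gen N (suc n)) ≡ suc n
    h≡ = toℕ-gen N (m≤m+n (suc n) n)
  letters (Fin.suc i) = letter-pairWord (toℕ i) (Fin.toℕ<n i)

  isUSeries₃ : IsUSeries n (MD (suc (n + n))) (φ₃gen n) (Enumerated-B.size p 3 2 (s≤s z≤n) (s≤s z≤n))
  isUSeries₃ = Folded.isUSeries f≤n κ≥1 3 2 (s≤s z≤n) (s≤s z≤n) (φ₃gen n) letters

-- The rational functions

prodˢ : (ℕ → Series) → ℕ → Series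
prodˢ g zero    = 1ˢ
prodˢ g (suc m) = g 0 ⊗ prodˢ (λ i → g (suc i)) m

prodˢ-cong : ∀ {g h} m → (∀ i → g i ≋ h i) → prodˢ g m ≋ prodˢ h m
prodˢ-cong zero    e = ˢ.refl
prodˢ-cong (suc m) e = ˢ.*-cong (e 0) (prodˢ-cong m (λ i → e (suc i)))

prodˢ-snoc : ∀ g m → prodˢ g (suc m) ≋ prodˢ g m ⊗ g m
prodˢ-snoc g zero    = ˢ.*-comm (g 0) 1ˢ
prodˢ-snoc g (suc m) = ˢ.trans (ˢ.*-congˡ (prodˢ-snoc (λ i → g (suc i)) m)) (ˢ.sym (ˢ.*-assoc _ _ _))

prodˢ-⊗ : ∀ g h m → prodˢ (λ i → g i ⊗ h i) m ≋ prodˢ g m ⊗ prodˢ h m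
prodˢ-⊗ g h zero    = ˢ.sym (ˢ.*-identityˡ 1ˢ)
prodˢ-⊗ g h (suc m) = ˢ.trans (ˢ.*-congˡ (prodˢ-⊗ (λ i → g (suc i)) (λ i → h (suc i)) m))
  (solve 4 (λ a b c d → (a :* b) :* (c :* d) := (a :* c) :* (b :* d)) (λ _ → refl) (g 0) (h 0) _ _)

double : ℕ → ℕ
double zero    = zero
double (suc n) = suc (suc (double n))

double≡ : ∀ n → double n ≡ 2 * n
double≡ zero    = refl
double≡ (suc n) = trans (cong (λ k → suc (suc k)) (double≡ n)) (sym (*-suc 2 n))

prodˢ-double : ∀ g m → prodˢ g (double m) ≋ prodˢ (λ i → g (double i) ⊗ g (suc (double i))) m
prodˢ-double g zero    = ˢ.refl
prodˢ-double g (suc m) = ˢ.trans (ˢ.sym (ˢ.*-assoc _ _ _)) (ˢ.*-congˡ (prodˢ-double (λ i → g (suc (suc i))) m))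

X-prodˢ : ∀ z t m → X z t m ≋ prodˢ (λ i → 1ˢ ⊕ z ⊗ t ^ˢ i) m
X-prodˢ z t zero    = ˢ.refl
X-prodˢ z t (suc m) = ˢ.trans (ˢ.*-congʳ (X-prodˢ z t m)) (ˢ.sym (prodˢ-snoc (λ i → 1ˢ ⊕ z ⊗ t ^ˢ i) m))

qfact-prodˢ : ∀ t m → qfact t m ≋ prodˢ (λ i → [ suc i ]⟨ t ⟩) m
qfact-prodˢ t zero    = ˢ.refl
qfact-prodˢ t (suc m) = ˢ.trans (ˢ.*-congʳ (qfact-prodˢ t m)) (ˢ.sym (prodˢ-snoc (λ i → [ suc i ]⟨ t ⟩) m))

D-prodˢ : ∀ t n s u → D s u t (suc n) ≋ prodˢ (λ i → 1ˢ ⊝ s ⊗ u ⊗ t ^ˢ (n + i)) (suc n)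
D-prodˢ t zero    s u = ˢ.refl
D-prodˢ t (suc n) s u = ˢ.*-cong (ˢ.reflexive (cong (λ k → 1ˢ ⊝ s ⊗ u ⊗ t ^ˢ k) (sym (+-identityʳ (suc n)))))
  (ˢ.trans (D-prodˢ t n (s ⊗ t) (u ⊗ t)) (prodˢ-cong (suc n) (λ i → ˢ.+-congˡ {1ˢ} (ˢ.-‿cong (ˢ.trans
    (solve 4 (λ s u t p → (s :* t) :* (u :* t) :* p := s :* u :* (t :* (t :* p))) (λ _ → refl) s u t (t ^ˢ (n + i)))
    (ˢ.reflexive (cong (λ k → s ⊗ u ⊗ t ^ˢ k) (cong suc (sym (+-suc n i)))))))))) 

^ˢ-* : ∀ x m n → (x ^ˢ m) ^ˢ n ≋ x ^ˢ (m * n)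
^ˢ-* x m zero    = ˢ.reflexive (cong (x ^ˢ_) (sym (*-zeroʳ m)))
^ˢ-* x m (suc n) = ˢ.trans (ˢ.*-congˡ (^ˢ-* x m n)) (ˢ.trans (ˢ.sym (^ˢ-+ x m (m * n))) (ˢ.reflexive (cong (x ^ˢ_) (sym (*-suc m n)))))

q^ : ∀ a b i → qˢ ^ˢ a ⊗ (qˢ ^ˢ b) ^ˢ i ≋ qˢ ^ˢ (a + b * i)
q^ a b i = ˢ.trans (ˢ.*-congˡ (^ˢ-* qˢ b i)) (ˢ.sym (^ˢ-+ qˢ a (b * i)))

[]-geometric : ∀ x k → [ k ]⟨ x ⟩ ⊗ (1ˢ ⊝ x) ≋ 1ˢ ⊝ x ^ˢ k
[]-geometric x zero    = solve 1 (λ x → con (+ 0) :* (con (+ 1) :- x) := con (+ 1) :- con (+ 1)) (λ _ → refl) x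
[]-geometric x (suc k) = ˢ.trans (solve 2 (λ x a → (con (+ 1) :+ x :* a) :* (con (+ 1) :- x) := (con (+ 1) :- x) :+ x :* (a :* (con (+ 1) :- x))) (λ _ → refl) x [ k ]⟨ x ⟩)
  (ˢ.trans (ˢ.+-congˡ (ˢ.*-congˡ ([]-geometric x k))) (solve 2 (λ x p → (con (+ 1) :- x) :+ x :* (con (+ 1) :- p) := con (+ 1) :- x :* p) (λ _ → refl) x (x ^ˢ k)))

[]-double : ∀ q i → [ double i ]⟨ q ⟩ ≋ (1ˢ ⊕ q) ⊗ [ i ]⟨ q ^ˢ 2 ⟩
[]-double q zero    = solve 1 (λ q → con (+ 0) := (con (+ 1) :+ q) :* con (+ 0)) (λ _ → refl) q
[]-double q (suc i) = ˢ.trans (ˢ.+-congˡ (ˢ.*-congˡ (ˢ.+-congˡ (ˢ.*-congˡ ([]-double q i)))))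
  (solve 2 (λ q a → con (+ 1) :+ q :* (con (+ 1) :+ q :* ((con (+ 1) :+ q) :* a)) := (con (+ 1) :+ q) :* (con (+ 1) :+ (q :* (q :* con (+ 1))) :* a)) (λ _ → refl) q [ i ]⟨ q ^ˢ 2 ⟩)

neg-odd : ∀ q i → (⊖ q) ^ˢ suc (double i) ≋ ⊖ (q ^ˢ suc (double i))
neg-odd q zero    = solve 1 (λ q → (:- q) :* con (+ 1) := :- (q :* con (+ 1))) (λ _ → refl) q
neg-odd q (suc i) = ˢ.trans (ˢ.*-congˡ (ˢ.*-congˡ (neg-odd q i))) (solve 2 (λ q p → (:- q) :* ((:- q) :* (:- p)) := :- (q :* (q :* p))) (λ _ → refl) q (q ^ˢ suc (double i)))

[]-odd : ∀ q i → [ suc (double i) ]⟨ ⊖ q ⟩ ⊗ (1ˢ ⊕ q) ≋ 1ˢ ⊕ q ^ˢ suc (double i)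
[]-odd q i = ˢ.trans (solve 2 (λ a q → a :* (con (+ 1) :+ q) := a :* (con (+ 1) :- (:- q))) (λ _ → refl) [ suc (double i) ]⟨ ⊖ q ⟩ q)
  (ˢ.trans ([]-geometric (⊖ q) (suc (double i))) (ˢ.+-congˡ (ˢ.trans (ˢ.-‿cong (neg-odd q i)) (solve 1 (λ p → :- (:- p) := p) (λ _ → refl) (q ^ˢ suc (double i))))))

opaque
  unfolding _⊕_

  coeff-cons : ∀ a p → coeff (a ∷ p) ≋ constˢ a ⊕ qˢ ⊗ coeff p
  coeff-cons a p zero    = sym (trans (cong (ℤ._+_ a) (qˢ-zero (coeff p))) (ℤ.+-identityʳ a))
  coeff-cons a p (suc m) = sym (trans (ℤ.+-identityˡ _) (qˢ-suc (coeff p) m))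

  coeff-+ : ∀ p r → coeff (p +ₚ r) ≋ coeff p ⊕ coeff r
  coeff-+ []      r       m       = sym (ℤ.+-identityˡ (coeff r m))
  coeff-+ (a ∷ p) []      m       = sym (ℤ.+-identityʳ (coeff (a ∷ p) m))
  coeff-+ (a ∷ p) (b ∷ r) zero    = refl
  coeff-+ (a ∷ p) (b ∷ r) (suc m) = coeff-+ p r m

  coeff-neg : ∀ p → coeff (negₚ p) ≋ ⊖ coeff p
  coeff-neg []      m       = refl
  coeff-neg (a ∷ p) zero    = refl
  coeff-neg (a ∷ p) (suc m) = coeff-neg p m

  coeff-scale : ∀ c p → coeff (scale c p) ≋ constˢ c ⊗ coeff p
  coeff-scale c []      zero    = sym (ℤ.*-zeroʳ c)
  coeff-scale c []      (suc m) = sym (trans (cong₂ ℤ._+_ (ℤ.*-zeroʳ c) (conv-zeroˡ (coeff []) m)) refl)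
  coeff-scale c (a ∷ p) zero    = refl
  coeff-scale c (a ∷ p) (suc m) = trans (coeff-scale-at p m) (sym (trans (cong (λ z → c ℤ.* coeff p m ℤ.+ z) (conv-zeroˡ (coeff (a ∷ p)) m)) (ℤ.+-identityʳ _)))
    where
    coeff-scale-at : ∀ p m → coeff (scale c p) m ≡ c ℤ.* coeff p m
    coeff-scale-at []      m       = sym (ℤ.*-zeroʳ c)
    coeff-scale-at (a ∷ p) zero    = refl
    coeff-scale-at (a ∷ p) (suc m) = coeff-scale-at p m

  convₚ-coeff : ∀ a p m → convₚ a p m ≡ (coeff p ⊗ a) m
  convₚ-coeff a []      m       = sym (conv-zeroˡ a m)
  convₚ-coeff a (c ∷ p) zero    = refl
  convₚ-coeff a (c ∷ p) (suc m) = cong (ℤ._+_ (c ℤ.* a (suc m))) (convₚ-coeff a p m)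

  ⊗-coeff₀ : ∀ a b → (a ⊗ b) 0 ≡ a 0 ℤ.* b 0
  ⊗-coeff₀ a b = refl

coeff-[] : coeff [] ≋ 0ˢ
coeff-[] zero    = refl
coeff-[] (suc m) = refl

coeff-* : ∀ p r → coeff (p *ₚ r) ≋ coeff p ⊗ coeff r
coeff-* []      r = ˢ.trans coeff-[] (ˢ.trans (ˢ.sym (ˢ.zeroˡ (coeff r))) (ˢ.*-congʳ (ˢ.sym coeff-[])))
coeff-* (a ∷ p) r = begin
  coeff (scale a r +ₚ (+ 0 ∷ (p *ₚ r)))             ≈⟨ coeff-+ (scale a r) (+ 0 ∷ (p *ₚ r)) ⟩
  coeff (scale a r) ⊕ coeff (+ 0 ∷ (p *ₚ r))        ≈⟨ ˢ.+-cong (coeff-scale a r) (ˢ.trans (coeff-cons (+ 0) (p *ₚ r)) (ˢ.+-congˡ (ˢ.*-congˡ (coeff-* p r)))) ⟩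
  constˢ a ⊗ coeff r ⊕ (0ˢ ⊕ qˢ ⊗ (coeff p ⊗ coeff r)) ≈⟨ solve 4 (λ a r q p → a :* r :+ (con (+ 0) :+ q :* (p :* r)) := (a :+ q :* p) :* r) (λ _ → refl) (constˢ a) (coeff r) qˢ (coeff p) ⟩
  (constˢ a ⊕ qˢ ⊗ coeff p) ⊗ coeff r               ≈⟨ ˢ.*-congʳ (ˢ.sym (coeff-cons a p)) ⟩
  coeff (a ∷ p) ⊗ coeff r ∎
  where open ≋-Reasoning

coeff-one : coeff oneₚ ≋ 1ˢ
coeff-one zero    = refl
coeff-one (suc m) = refl

coeff-qpow : ∀ a → coeff (qpow a) ≋ qˢ ^ˢ a
coeff-qpow zero    = coeff-one
coeff-qpow (suc a) = ˢ.trans (coeff-cons (+ 0) (qpow a)) (ˢ.trans (ˢ.+-identityˡ _) (ˢ.*-congˡ (coeff-qpow a)))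

coeff-- : ∀ p r → coeff (p -ₚ r) ≋ coeff p ⊝ coeff r
coeff-- p r = ˢ.trans (coeff-+ p (negₚ r)) (ˢ.+-congˡ (coeff-neg r))

coeff-qint : ∀ k → coeff (qint k) ≋ [ k ]⟨ qˢ ⟩
coeff-qint zero    = coeff-[]
coeff-qint (suc k) = ˢ.trans (coeff-cons (+ 1) (qint k)) (ˢ.+-congˡ (ˢ.*-congˡ (coeff-qint k)))

coeff-subNeg-qint : ∀ k → coeff (subNeg (qint k)) ≋ [ k ]⟨ ⊖ qˢ ⟩
coeff-subNeg-qint zero    = coeff-[]
coeff-subNeg-qint (suc k) = ˢ.trans (coeff-cons (+ 1) (negₚ (subNeg (qint k)))) (ˢ.+-congˡ
  (ˢ.trans (ˢ.*-congˡ (ˢ.trans (coeff-neg (subNeg (qint k))) (ˢ.-‿cong (coeff-subNeg-qint k))))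
    (solve 2 (λ q a → q :* (:- a) := (:- q) :* a) (λ _ → refl) qˢ [ k ]⟨ ⊖ qˢ ⟩)))

coeff-prod : ∀ (f : ℕ → Poly) a m → coeff (foldr _*ₚ_ oneₚ (applyUpTo (λ i → f (a + i)) m)) ≋ prodˢ (λ i → coeff (f (a + i))) m
coeff-prod f a m = go (λ i → f (a + i)) m
  where
  go : ∀ (g : ℕ → Poly) m → coeff (foldr _*ₚ_ oneₚ (applyUpTo g m)) ≋ prodˢ (λ i → coeff (g i)) m
  go g zero    = coeff-one
  go g (suc m) = ˢ.trans (coeff-* (g 0) (foldr _*ₚ_ oneₚ (applyUpTo (λ i → g (suc i)) m))) (ˢ.*-congˡ (go (λ i → g (suc i)) m))

double%2 : ∀ i → double i % 2 ≡ 0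
double%2 zero    = refl
double%2 (suc i) = trans (cong (_% 2) (+-comm 2 (double i))) (trans ([m+n]%n≡m%n (double i) 2) (double%2 i))

1+double%2 : ∀ i → suc (double i) % 2 ≡ 1
1+double%2 zero    = refl
1+double%2 (suc i) = trans (cong (_% 2) (+-comm 2 (suc (double i)))) (trans ([m+n]%n≡m%n (suc (double i)) 2) (1+double%2 i))

coeff-signed-odd : ∀ i → coeff (qintSigned (suc (double i))) ≋ [ suc (double i) ]⟨ ⊖ qˢ ⟩
coeff-signed-odd i rewrite 1+double%2 i = coeff-subNeg-qint (suc (double i))

coeff-signed-even : ∀ i → coeff (qintSigned (double i)) ≋ [ double i ]⟨ qˢ ⟩
coeff-signed-even i rewrite double%2 i = coeff-qint (double i)

module _ (p : ℕ) where
  open Affine-B p using (n)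

  -- The factor 1 + u = 2 of X 1 t n cancels the doubling of the count.
  module Halved (wt₀ wt₁ : ℕ) (wt₀≥1 : 1 ≤ wt₀) (wt₁≥1 : 1 ≤ wt₁) where
    open Enumerated-B p wt₀ wt₁ wt₀≥1 wt₁≥1 using (size; total-size)

    private
      s t : Series
      s = qˢ ^ˢ wt₀
      t = qˢ ^ˢ wt₁

    A : Series
    A m = + size m

    twice : (λ m → + (size m + size m)) ≋ (1ˢ ⊕ 1ˢ) ⊗ A
    twice m = trans (sym (⊕-coeff A A m)) (solve 1 (λ a → a :+ a := (con (+ 1) :+ con (+ 1)) :* a) (λ _ → refl) A m)

    denominator : A ⊗ prodˢ (λ i → 1ˢ ⊝ qˢ ^ˢ (wt₀ + wt₁ * (suc (suc p) + i))) n
                ≋ (prodˢ (λ i → [ suc i ]⟨ t ⟩) n ⊗ prodˢ (λ i → 1ˢ ⊕ qˢ ^ˢ (wt₀ + wt₁ * i)) n) ⊗ prodˢ (λ i → 1ˢ ⊕ qˢ ^ˢ (wt₁ * suc i)) (suc (suc p))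
    denominator = ⊗-cancelˡ (1ˢ ⊕ 1ˢ) two≢0 (begin
      (1ˢ ⊕ 1ˢ) ⊗ (A ⊗ prodˢ (λ i → 1ˢ ⊝ qˢ ^ˢ (wt₀ + wt₁ * (suc (suc p) + i))) n)
        ≈⟨ ˢ.trans (ˢ.sym (ˢ.*-assoc _ _ _)) (ˢ.*-cong (ˢ.sym twice) (ˢ.sym (ˢ.trans (D-prodˢ t (suc (suc p)) s 1ˢ) (prodˢ-cong n λ i → ˢ.+-congˡ {1ˢ} (ˢ.-‿cong
             (ˢ.trans (ˢ.*-congʳ (ˢ.*-identityʳ s)) (q^ wt₀ wt₁ (suc (suc p) + i)))))))) ⟩
      (λ m → + (size m + size m)) ⊗ D s 1ˢ t n
        ≈⟨ total-size ⟩
      qfact t n ⊗ (X s t n ⊗ X 1ˢ t n)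
        ≈⟨ ˢ.*-cong (qfact-prodˢ t n) (ˢ.*-cong
             (ˢ.trans (X-prodˢ s t n) (prodˢ-cong n λ i → ˢ.+-congˡ {1ˢ} (q^ wt₀ wt₁ i)))
             (ˢ.trans (X-head t 1ˢ (suc (suc p))) (ˢ.*-congˡ (ˢ.trans (X-prodˢ (1ˢ ⊗ t) t (suc (suc p))) (prodˢ-cong (suc (suc p)) λ i → ˢ.+-congˡ {1ˢ}
               (ˢ.trans (ˢ.*-congʳ (ˢ.*-identityˡ t)) (^ˢ-* qˢ wt₁ (suc i)))))))) ⟩
      F ⊗ (G ⊗ ((1ˢ ⊕ 1ˢ) ⊗ H))
        ≈⟨ solve 3 (λ f g h → f :* (g :* ((con (+ 1) :+ con (+ 1)) :* h)) := (con (+ 1) :+ con (+ 1)) :* ((f :* g) :* h)) (λ _ → refl) F G H ⟩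
      (1ˢ ⊕ 1ˢ) ⊗ ((F ⊗ G) ⊗ H) ∎)
      where
      open ≋-Reasoning
      F G H : Series
      F = prodˢ (λ i → [ suc i ]⟨ t ⟩) n
      G = prodˢ (λ i → 1ˢ ⊕ qˢ ^ˢ (wt₀ + wt₁ * i)) n
      H = prodˢ (λ i → 1ˢ ⊕ qˢ ^ˢ (wt₁ * suc i)) (suc (suc p))
      two≢0 : (1ˢ ⊕ 1ˢ) 0 ≢ + 0
      two≢0 e with trans (sym (⊕-coeff 1ˢ 1ˢ 0)) e
      ... | ()

  seriesEq : ∀ a num den → coeff den ⊗ (λ m → + a m) ≋ coeff num → SeriesEq a num den
  seriesEq a num den e m = trans (convₚ-coeff (λ i → + a i) den m) (e m)

  coeff-1+q : ∀ {a b} → a ≡ b → coeff (oneₚ +ₚ qpow a) ≋ 1ˢ ⊕ qˢ ^ˢ b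
  coeff-1+q {a} refl = ˢ.trans (coeff-+ oneₚ (qpow a)) (ˢ.+-cong coeff-one (coeff-qpow a))

  coeff-1-q : ∀ {a b} → a ≡ b → coeff (oneₚ -ₚ qpow a) ≋ 1ˢ ⊝ qˢ ^ˢ b
  coeff-1-q {a} refl = ˢ.trans (coeff-- oneₚ (qpow a)) (ˢ.+-cong coeff-one (ˢ.-‿cong (coeff-qpow a)))

  private
    ∸-eq : ∀ {a b} c → a ≡ c + b → a ∸ c ≡ b
    ∸-eq {b = b} c refl = m+n∸m≡n c b

    exponent₂ : ∀ p i → 2 * (3 + p + (1 + i)) ≡ 3 + (1 + 2 * (2 + p + i))
    exponent₂ = ℕ-Solver.solve-∀

    exponent₃ : ∀ p i → 2 * (3 + p + (1 + i)) ≡ 1 + (3 + 2 * (2 + p + i))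
    exponent₃ = ℕ-Solver.solve-∀

  -- Consecutive factors of the numerator combine: [2 i + 2] leaves a factor 1 + q over [i + 1] at
  -- q², and this completes [2 i + 1] at -q to the binomial 1 + q²ⁱ⁺¹.
  pair₂ : ∀ i → coeff (qintSigned (suc (double i))) ⊗ coeff (qintSigned (suc (suc (double i)))) ≋ [ suc i ]⟨ qˢ ^ˢ 2 ⟩ ⊗ (1ˢ ⊕ qˢ ^ˢ (1 + 2 * i))
  pair₂ i = begin
    coeff (qintSigned (suc (double i))) ⊗ coeff (qintSigned (double (suc i)))
      ≈⟨ ˢ.*-cong (coeff-signed-odd i) (ˢ.trans (coeff-signed-even (suc i)) ([]-double qˢ (suc i))) ⟩
    [ suc (double i) ]⟨ ⊖ qˢ ⟩ ⊗ ((1ˢ ⊕ qˢ) ⊗ [ suc i ]⟨ qˢ ^ˢ 2 ⟩)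
      ≈⟨ solve 3 (λ a b c → a :* (b :* c) := c :* (a :* b)) (λ _ → refl) _ (1ˢ ⊕ qˢ) _ ⟩
    [ suc i ]⟨ qˢ ^ˢ 2 ⟩ ⊗ ([ suc (double i) ]⟨ ⊖ qˢ ⟩ ⊗ (1ˢ ⊕ qˢ))
      ≈⟨ ˢ.*-congˡ (ˢ.trans ([]-odd qˢ i) (ˢ.reflexive (cong (λ k → 1ˢ ⊕ qˢ ^ˢ suc k) (double≡ i)))) ⟩
    [ suc i ]⟨ qˢ ^ˢ 2 ⟩ ⊗ (1ˢ ⊕ qˢ ^ˢ (1 + 2 * i)) ∎
    where open ≋-Reasoning

  -- The same pairing moved by one place, because the numerator of the third part has an odd number
  -- of factors.
  pair₃ : ∀ i → coeff (qintSigned (suc (suc (double i)))) ⊗ coeff (qintSigned (suc (suc (suc (double i))))) ≋ [ suc i ]⟨ qˢ ^ˢ 2 ⟩ ⊗ (1ˢ ⊕ qˢ ^ˢ (3 + 2 * i))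
  pair₃ i = begin
    coeff (qintSigned (double (suc i))) ⊗ coeff (qintSigned (suc (double (suc i))))
      ≈⟨ ˢ.*-cong (ˢ.trans (coeff-signed-even (suc i)) ([]-double qˢ (suc i))) (coeff-signed-odd (suc i)) ⟩
    ((1ˢ ⊕ qˢ) ⊗ [ suc i ]⟨ qˢ ^ˢ 2 ⟩) ⊗ [ suc (double (suc i)) ]⟨ ⊖ qˢ ⟩
      ≈⟨ solve 3 (λ a b c → (b :* c) :* a := c :* (a :* b)) (λ _ → refl) _ (1ˢ ⊕ qˢ) _ ⟩
    [ suc i ]⟨ qˢ ^ˢ 2 ⟩ ⊗ ([ suc (double (suc i)) ]⟨ ⊖ qˢ ⟩ ⊗ (1ˢ ⊕ qˢ))
      ≈⟨ ˢ.*-congˡ (ˢ.trans ([]-odd qˢ (suc i)) (ˢ.reflexive (cong (λ k → 1ˢ ⊕ qˢ ^ˢ suc (suc (suc k))) (double≡ i)))) ⟩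
    [ suc i ]⟨ qˢ ^ˢ 2 ⟩ ⊗ (1ˢ ⊕ qˢ ^ˢ (3 + 2 * i)) ∎
    where open ≋-Reasoning

  seriesEq₂ : SeriesEq (Enumerated-B.size p 1 2 (s≤s z≤n) (s≤s z≤n)) (num₂ n) (den₂ n)
  seriesEq₂ = seriesEq _ (num₂ n) (den₂ n) (begin
    coeff (den₂ n) ⊗ A
      ≈⟨ ˢ.trans (ˢ.*-comm _ A) (ˢ.*-congˡ (ˢ.trans (coeff-prod (λ k → oneₚ -ₚ qpow (2 * (n + k) ∸ 3)) 1 n)
           (prodˢ-cong n λ i → coeff-1-q (∸-eq 3 (exponent₂ p i))))) ⟩
    A ⊗ prodˢ (λ i → 1ˢ ⊝ qˢ ^ˢ (1 + 2 * (suc (suc p) + i))) n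
      ≈⟨ denominator ⟩
    (prodˢ (λ i → [ suc i ]⟨ qˢ ^ˢ 2 ⟩) n ⊗ prodˢ (λ i → 1ˢ ⊕ qˢ ^ˢ (1 + 2 * i)) n) ⊗ prodˢ (λ i → 1ˢ ⊕ qˢ ^ˢ (2 * suc i)) (suc (suc p))
      ≈⟨ ˢ.*-cong (ˢ.trans (ˢ.sym (prodˢ-⊗ (λ i → [ suc i ]⟨ qˢ ^ˢ 2 ⟩) (λ i → 1ˢ ⊕ qˢ ^ˢ (1 + 2 * i)) n)) (ˢ.trans (prodˢ-cong n (λ i → ˢ.sym (pair₂ i)))
                  (ˢ.trans (ˢ.sym (prodˢ-double (λ k → coeff (qintSigned (suc k))) n)) (ˢ.reflexive (cong (prodˢ (λ k → coeff (qintSigned (suc k)))) (double≡ n))))))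
                (prodˢ-cong (suc (suc p)) (λ i → ˢ.sym (coeff-1+q {2 * (1 + i)} refl))) ⟩
    prodˢ (λ k → coeff (qintSigned (1 + k))) (2 * n) ⊗ prodˢ (λ i → coeff (oneₚ +ₚ qpow (2 * (1 + i)))) (suc (suc p))
      ≈⟨ ˢ.sym (ˢ.trans (coeff-* (prodFromTo qintSigned 1 (2 * n)) _) (ˢ.*-cong (coeff-prod qintSigned 1 (2 * n)) (coeff-prod (λ k → oneₚ +ₚ qpow (2 * k)) 1 (suc (suc p))))) ⟩
    coeff (num₂ n) ∎)
    where
    open ≋-Reasoning
    open Halved 1 2 (s≤s z≤n) (s≤s z≤n)

  seriesEq₃ : SeriesEq (Enumerated-B.size p 3 2 (s≤s z≤n) (s≤s z≤n)) (num₃ n) (den₃ n)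
  seriesEq₃ = seriesEq _ (num₃ n) (den₃ n) (begin
    coeff (den₃ n) ⊗ A
      ≈⟨ ˢ.trans (ˢ.*-comm _ A) (ˢ.*-congˡ (ˢ.trans (coeff-prod (λ k → oneₚ -ₚ qpow (2 * (n + k) ∸ 1)) 1 n)
           (prodˢ-cong n λ i → coeff-1-q (∸-eq 1 (exponent₃ p i))))) ⟩
    A ⊗ prodˢ (λ i → 1ˢ ⊝ qˢ ^ˢ (3 + 2 * (suc (suc p) + i))) n
      ≈⟨ denominator ⟩
    (prodˢ (λ i → [ suc i ]⟨ qˢ ^ˢ 2 ⟩) n ⊗ prodˢ (λ i → 1ˢ ⊕ qˢ ^ˢ (3 + 2 * i)) n) ⊗ prodˢ (λ i → 1ˢ ⊕ qˢ ^ˢ (2 * suc i)) (suc (suc p))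
      ≈⟨ ˢ.*-cong (ˢ.trans (ˢ.sym (prodˢ-⊗ (λ i → [ suc i ]⟨ qˢ ^ˢ 2 ⟩) (λ i → 1ˢ ⊕ qˢ ^ˢ (3 + 2 * i)) n)) (ˢ.trans (prodˢ-cong n (λ i → ˢ.sym (pair₃ i)))
                  (ˢ.trans (ˢ.sym (prodˢ-double (λ k → coeff (qintSigned (suc (suc k)))) n)) first)))
                (prodˢ-cong (suc (suc p)) (λ i → ˢ.sym (coeff-1+q {2 * (1 + i)} refl))) ⟩
    prodˢ (λ k → coeff (qintSigned (1 + k))) (2 * n + 1) ⊗ prodˢ (λ i → coeff (oneₚ +ₚ qpow (2 * (1 + i)))) (suc (suc p))
      ≈⟨ ˢ.sym (ˢ.trans (coeff-* (prodFromTo qintSigned 1 (2 * n + 1)) _) (ˢ.*-cong (coeff-prod qintSigned 1 (2 * n + 1)) (coeff-prod (λ k → oneₚ +ₚ qpow (2 * k)) 1 (suc (suc p))))) ⟩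
    coeff (num₃ n) ∎)
    where
    open ≋-Reasoning
    open Halved 3 2 (s≤s z≤n) (s≤s z≤n)
    -- The factor left over by the pairing is [1] at -q, which is 1.
    first : prodˢ (λ k → coeff (qintSigned (suc (suc k)))) (double n) ≋ prodˢ (λ k → coeff (qintSigned (1 + k))) (2 * n + 1)
    first = ˢ.trans (ˢ.trans (ˢ.sym (ˢ.*-identityˡ _)) (ˢ.*-congʳ (ˢ.sym coeff-one)))
      (ˢ.reflexive (cong (prodˢ (λ k → coeff (qintSigned (1 + k)))) (trans (cong suc (double≡ n)) (+-comm 1 (2 * n)))))

  Δ : ℕ → ℕ → Series
  Δ a m = prodˢ (λ i → 1ˢ ⊝ qˢ ^ˢ (a + i)) m

  constant≢0 : ∀ {a : Series} → a 0 ≡ + 1 → a 0 ≢ + 0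
  constant≢0 e z with trans (sym e) z
  ... | ()

  constant-1-q : ∀ k → (1ˢ ⊝ qˢ ^ˢ suc k) 0 ≡ + 1
  constant-1-q k = trans (⊕-coeff 1ˢ (⊖ qˢ ^ˢ suc k) 0) (cong (ℤ._+_ (+ 1)) (trans (⊖-coeff (qˢ ^ˢ suc k) 0) (cong ℤ.-_ (qˢ-zero (qˢ ^ˢ k)))))

  constant-1+q : ∀ k → (1ˢ ⊕ qˢ ^ˢ suc k) 0 ≡ + 1
  constant-1+q k = trans (⊕-coeff 1ˢ (qˢ ^ˢ suc k) 0) (cong (ℤ._+_ (+ 1)) (qˢ-zero (qˢ ^ˢ k)))

  constant-prodˢ : ∀ (g : ℕ → Series) m → (∀ i → g i 0 ≡ + 1) → prodˢ g m 0 ≡ + 1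
  constant-prodˢ g zero    e = refl
  constant-prodˢ g (suc m) e = trans (⊗-coeff₀ (g 0) _) (cong₂ ℤ._*_ (e 0) (constant-prodˢ (λ i → g (suc i)) m (λ i → e (suc i))))

  odds evens₊ : ℕ → Series
  odds   m = prodˢ (λ i → 1ˢ ⊝ qˢ ^ˢ suc (double i)) m
  evens₊ m = prodˢ (λ i → 1ˢ ⊕ qˢ ^ˢ suc i) m

  -- Both sides are (1 - q)(1 - q²) ⋯ (1 - q²ⁿ) divided by (1 - q) ⋯ (1 - qⁿ).
  Δ-split : ∀ n → Δ (suc n) n ≋ odds n ⊗ evens₊ n
  Δ-split zero    = ˢ.sym (ˢ.*-identityˡ 1ˢ)
  Δ-split (suc n) = ⊗-cancelˡ (1ˢ ⊝ qˢ ^ˢ suc n) (constant≢0 {1ˢ ⊝ qˢ ^ˢ suc n} (constant-1-q n)) (begin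
    (1ˢ ⊝ qˢ ^ˢ suc n) ⊗ Δ (suc (suc n)) (suc n)
      ≈⟨ ˢ.*-cong (factor (sym (+-identityʳ (suc n)))) (prodˢ-cong (suc n) (λ i → factor (sym (+-suc (suc n) i)))) ⟩
    Δ (suc n) (suc (suc n))
      ≈⟨ ˢ.trans (prodˢ-snoc g (suc n)) (ˢ.*-congʳ (prodˢ-snoc g n)) ⟩
    (Δ (suc n) n ⊗ g n) ⊗ g (suc n)
      ≈⟨ ˢ.*-cong (ˢ.*-cong (Δ-split n) (factor (cong suc (sym (double-+ n))))) (ˢ.trans (factor (cong suc (+-suc n n)))
           (ˢ.trans (ˢ.+-congˡ {1ˢ} (ˢ.-‿cong (ˢ.trans (ˢ.reflexive (cong (λ k → qˢ ^ˢ suc k) (sym (+-suc n n)))) (^ˢ-+ qˢ (suc n) (suc n)))))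
             (solve 1 (λ x → con (+ 1) :- x :* x := (con (+ 1) :- x) :* (con (+ 1) :+ x)) (λ _ → refl) (qˢ ^ˢ suc n)))) ⟩
    ((odds n ⊗ evens₊ n) ⊗ (1ˢ ⊝ qˢ ^ˢ suc (double n))) ⊗ ((1ˢ ⊝ qˢ ^ˢ suc n) ⊗ (1ˢ ⊕ qˢ ^ˢ suc n))
      ≈⟨ solve 5 (λ o e a b c → ((o :* e) :* a) :* (b :* c) := b :* ((o :* a) :* (e :* c))) (λ _ → refl) (odds n) (evens₊ n) (1ˢ ⊝ qˢ ^ˢ suc (double n)) (1ˢ ⊝ qˢ ^ˢ suc n) (1ˢ ⊕ qˢ ^ˢ suc n) ⟩
    (1ˢ ⊝ qˢ ^ˢ suc n) ⊗ ((odds n ⊗ (1ˢ ⊝ qˢ ^ˢ suc (double n))) ⊗ (evens₊ n ⊗ (1ˢ ⊕ qˢ ^ˢ suc n)))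
      ≈⟨ ˢ.*-congˡ (ˢ.*-cong (ˢ.sym (prodˢ-snoc (λ i → 1ˢ ⊝ qˢ ^ˢ suc (double i)) n)) (ˢ.sym (prodˢ-snoc (λ i → 1ˢ ⊕ qˢ ^ˢ suc i) n))) ⟩
    (1ˢ ⊝ qˢ ^ˢ suc n) ⊗ (odds (suc n) ⊗ evens₊ (suc n)) ∎)
    where
    open ≋-Reasoning
    g : ℕ → Series
    g i = 1ˢ ⊝ qˢ ^ˢ (suc n + i)
    factor : ∀ {a b} → a ≡ b → 1ˢ ⊝ qˢ ^ˢ a ≋ 1ˢ ⊝ qˢ ^ˢ b
    factor refl = ˢ.refl
    double-+ : ∀ n → double n ≡ n + n
    double-+ n = trans (double≡ n) (cong (_+_ n) (+-identityʳ n))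

  -- Removing the middle power qᵏ from [2 k + 1] leaves two blocks of k powers each, [k] and qᵏ⁺¹
  -- [k].
  coeff-gap : ∀ k → coeff (qint (2 * k + 1) -ₚ qpow k) ≋ [ k ]⟨ qˢ ⟩ ⊗ (1ˢ ⊕ qˢ ^ˢ suc k)
  coeff-gap k = begin
    coeff (qint (2 * k + 1) -ₚ qpow k)
      ≈⟨ ˢ.trans (coeff-- (qint (2 * k + 1)) (qpow k)) (ˢ.+-cong (ˢ.trans (coeff-qint (2 * k + 1)) (ˢ.reflexive (cong [_]⟨ qˢ ⟩ (lem k)))) (ˢ.-‿cong (coeff-qpow k))) ⟩
    [ k + suc k ]⟨ qˢ ⟩ ⊝ qˢ ^ˢ k
      ≈⟨ ˢ.+-congʳ (ˢ.sym ([]-+ qˢ k (suc k))) ⟩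
    ([ k ]⟨ qˢ ⟩ ⊕ qˢ ^ˢ k ⊗ (1ˢ ⊕ qˢ ⊗ [ k ]⟨ qˢ ⟩)) ⊝ qˢ ^ˢ k
      ≈⟨ solve 3 (λ a q p → (a :+ p :* (con (+ 1) :+ q :* a)) :- p := a :* (con (+ 1) :+ q :* p)) (λ _ → refl) [ k ]⟨ qˢ ⟩ qˢ (qˢ ^ˢ k) ⟩
    [ k ]⟨ qˢ ⟩ ⊗ (1ˢ ⊕ qˢ ^ˢ suc k) ∎
    where
    open ≋-Reasoning
    lem : ∀ k → 2 * k + 1 ≡ k + suc k
    lem = ℕ-Solver.solve-∀

  -- Both sides are multiplied by P = (1 + q) ⋯ (1 + qⁿ⁻¹), which also occurs on the right of
  -- `denominator`. On the left, P (1 + qⁿ) and the odd factors combine by `Δ-split` to the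
  -- denominator that belongs to the weights 2 and 1.
  seriesEq₁ : SeriesEq (Enumerated-B.size p 2 1 (s≤s z≤n) (s≤s z≤n)) (num₁ n) (den₁ n)
  seriesEq₁ = seriesEq _ (num₁ n) (den₁ n) (⊗-cancelˡ P (constant≢0 {P} (constant-prodˢ (λ i → 1ˢ ⊕ qˢ ^ˢ suc i) (suc (suc p)) constant-1+q)) (begin
    P ⊗ (coeff (den₁ n) ⊗ A)
      ≈⟨ ˢ.*-congˡ (ˢ.*-congʳ coeff-den) ⟩
    P ⊗ ((d₁ ⊗ (d₃ ⊗ (dₙ ⊗ R))) ⊗ A)
      ≈⟨ solve 6 (λ P a b c r A → P :* ((a :* (b :* (c :* r))) :* A) := A :* ((a :* (b :* r)) :* (P :* c))) (λ _ → refl) P d₁ d₃ dₙ R A ⟩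
    A ⊗ (odds n ⊗ (P ⊗ dₙ))
      ≈⟨ ˢ.*-congˡ (ˢ.*-congˡ (ˢ.sym (prodˢ-snoc (λ i → 1ˢ ⊕ qˢ ^ˢ suc i) (suc (suc p))))) ⟩
    A ⊗ (odds n ⊗ evens₊ n)
      ≈⟨ ˢ.*-congˡ (ˢ.trans (ˢ.sym (Δ-split n)) (prodˢ-cong n (λ i → ˢ.reflexive (cong (λ k → 1ˢ ⊝ qˢ ^ˢ k) (exponent p i))))) ⟩
    A ⊗ prodˢ (λ i → 1ˢ ⊝ qˢ ^ˢ (2 + 1 * (suc (suc p) + i))) n
      ≈⟨ denominator ⟩
    (prodˢ (λ i → [ suc i ]⟨ qˢ ^ˢ 1 ⟩) n ⊗ prodˢ (λ i → 1ˢ ⊕ qˢ ^ˢ (2 + 1 * i)) n) ⊗ prodˢ (λ i → 1ˢ ⊕ qˢ ^ˢ (1 * suc i)) (suc (suc p))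
      ≈⟨ ˢ.*-cong (ˢ.trans (ˢ.sym (prodˢ-⊗ (λ i → [ suc i ]⟨ qˢ ^ˢ 1 ⟩) (λ i → 1ˢ ⊕ qˢ ^ˢ (2 + 1 * i)) n)) (prodˢ-cong n (λ i → ˢ.*-cong ([]-cong (suc i) (ˢ.*-identityʳ qˢ))
                    (ˢ.reflexive (cong (λ k → 1ˢ ⊕ qˢ ^ˢ (2 + k)) (+-identityʳ i))))))
                  (prodˢ-cong (suc (suc p)) (λ i → ˢ.reflexive (cong (λ k → 1ˢ ⊕ qˢ ^ˢ k) (+-identityʳ (suc i))))) ⟩
    (c 0 ⊗ (c 1 ⊗ prodˢ (λ i → c (2 + i)) (suc p))) ⊗ P
      ≈⟨ ˢ.trans (ˢ.*-comm _ P) (ˢ.*-congˡ (ˢ.sym (ˢ.*-assoc _ _ _))) ⟩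
    P ⊗ ((c 0 ⊗ c 1) ⊗ prodˢ (λ i → c (2 + i)) (suc p))
      ≈⟨ ˢ.*-congˡ (ˢ.trans (ˢ.*-congʳ small) (solve 4 (λ a b c d → (a :* (b :* c)) :* d := a :* (b :* (c :* d))) (λ _ → refl) [ 2 ]⟨ qˢ ⟩ [ 3 ]⟨ ⊖ qˢ ⟩ [ 4 ]⟨ qˢ ⟩ _)) ⟩
    P ⊗ ([ 2 ]⟨ qˢ ⟩ ⊗ ([ 3 ]⟨ ⊖ qˢ ⟩ ⊗ ([ 4 ]⟨ qˢ ⟩ ⊗ prodˢ (λ i → c (2 + i)) (suc p))))
      ≈⟨ ˢ.*-congˡ (ˢ.sym coeff-num) ⟩
    P ⊗ coeff (num₁ n) ∎))
    where
    open ≋-Reasoning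
    open Halved 2 1 (s≤s z≤n) (s≤s z≤n)
    P d₁ d₃ dₙ R : Series
    P  = evens₊ (suc (suc p))
    d₁ = 1ˢ ⊝ qˢ ^ˢ 1
    d₃ = 1ˢ ⊝ qˢ ^ˢ 3
    dₙ = 1ˢ ⊕ qˢ ^ˢ n
    R  = prodˢ (λ i → 1ˢ ⊝ qˢ ^ˢ suc (double (2 + i))) (suc p)
    c : ℕ → Series
    c i = [ suc i ]⟨ qˢ ⟩ ⊗ (1ˢ ⊕ qˢ ^ˢ suc (suc i))
    exponent : ∀ p i → suc (3 + p) + i ≡ 2 + 1 * (2 + p + i)
    exponent = ℕ-Solver.solve-∀
    odd-exponent : ∀ i → 2 * (3 + i) ∸ 1 ≡ suc (double (2 + i))
    odd-exponent i = cong (_∸ 1) (sym (double≡ (3 + i)))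
    []-cong : ∀ {x y} k → x ≋ y → [ k ]⟨ x ⟩ ≋ [ k ]⟨ y ⟩
    []-cong zero    e = ˢ.refl
    []-cong (suc k) e = ˢ.+-congˡ {1ˢ} (ˢ.*-cong e ([]-cong k e))
    denₚ numₚ : Poly
    denₚ = prodFromTo (λ k → oneₚ -ₚ qpow (2 * k ∸ 1)) 3 n
    numₚ = prodFromTo (λ k → qint (2 * k + 1) -ₚ qpow k) 3 n
    coeff-den : coeff (den₁ n) ≋ d₁ ⊗ (d₃ ⊗ (dₙ ⊗ R))
    coeff-den = ˢ.trans (coeff-* (oneₚ -ₚ qpow 1) ((oneₚ -ₚ qpow 3) *ₚ ((oneₚ +ₚ qpow n) *ₚ denₚ))) (ˢ.*-cong (coeff-1-q {1} refl) (ˢ.trans (coeff-* (oneₚ -ₚ qpow 3) ((oneₚ +ₚ qpow n) *ₚ denₚ)) (ˢ.*-cong (coeff-1-q {3} refl)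
      (ˢ.trans (coeff-* (oneₚ +ₚ qpow n) denₚ) (ˢ.*-cong (coeff-1+q {n} refl) (ˢ.trans (coeff-prod (λ k → oneₚ -ₚ qpow (2 * k ∸ 1)) 3 (suc p)) (prodˢ-cong (suc p) (λ i → coeff-1-q (odd-exponent i)))))))))
    coeff-num : coeff (num₁ n) ≋ [ 2 ]⟨ qˢ ⟩ ⊗ ([ 3 ]⟨ ⊖ qˢ ⟩ ⊗ ([ 4 ]⟨ qˢ ⟩ ⊗ prodˢ (λ i → c (2 + i)) (suc p)))
    coeff-num = ˢ.trans (coeff-* (qint 2) (subNeg (qint 3) *ₚ (qint 4 *ₚ numₚ))) (ˢ.*-cong (coeff-qint 2) (ˢ.trans (coeff-* (subNeg (qint 3)) (qint 4 *ₚ numₚ)) (ˢ.*-cong (coeff-subNeg-qint 3)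
      (ˢ.trans (coeff-* (qint 4) numₚ) (ˢ.*-cong (coeff-qint 4) (ˢ.trans (coeff-prod (λ k → qint (2 * k + 1) -ₚ qpow k) 3 (suc p)) (prodˢ-cong (suc p) (λ i → coeff-gap (3 + i)))))))))
    -- The factors k = 1 and k = 2 of the uniform product [k] (1 + qᵏ⁺¹) take their special form in
    -- the numerator because [4] = [2] (1 + q²) and [2] times [3] at -q is 1 + q³.
    small : c 0 ⊗ c 1 ≋ [ 2 ]⟨ qˢ ⟩ ⊗ ([ 3 ]⟨ ⊖ qˢ ⟩ ⊗ [ 4 ]⟨ qˢ ⟩)
    small = solve 1 (λ q → let o = con (+ 1) ; z = con (+ 0) in
        ((o :+ q :* z) :* (o :+ q :* (q :* o))) :* ((o :+ q :* (o :+ q :* z)) :* (o :+ q :* (q :* (q :* o))))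
        := (o :+ q :* (o :+ q :* z)) :* ((o :+ (:- q) :* (o :+ (:- q) :* (o :+ (:- q) :* z))) :* (o :+ q :* (o :+ q :* (o :+ q :* (o :+ q :* z))))))
      (λ _ → refl) qˢ

theorem1p8 : (n : ℕ) → 3 ≤ n →
    (Σ (ℕ → ℕ) λ a → IsUSeries n (MD (suc n)) (φ₁gen n) a × SeriesEq a (num₁ n) (den₁ n)) ×
    (Σ (ℕ → ℕ) λ a → IsUSeries n (MD (n + n)) (φ₂gen n) a × SeriesEq a (num₂ n) (den₂ n)) ×
    (Σ (ℕ → ℕ) λ a → IsUSeries n (MD (suc (n + n))) (φ₃gen n) a × SeriesEq a (num₃ n) (den₃ n))
theorem1p8 (suc (suc (suc p))) (s≤s (s≤s (s≤s _))) =
  (_ , Part₁.isUSeries₁ p , seriesEq₁ p) , (_ , Part₂.isUSeries₂ p , seriesEq₂ p) , (_ , Part₃.isUSeries₃ p , seriesEq₃ p)
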